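{- Let $G=C_{n_1}\oplus C_{n_2}$ with $n_1\mid n_2$, and let $p$ be the smallest prime divisor of $|G|$. Assume $p\geq 3$, $n_1\geq 2p$ and $|G|\geq 72p^6$. Then $\mathsf c_0(G)=|G|/p+p-2$.
   Context: For a finite abelian group $G$ (written additively), a sequence over $G$ is a finite unordered list of elements of $G$ with repetition allowed (an element of the free abelian monoid on $G$); its length $|S|$ is the number of terms counted with multiplicity. For a subgroup $H\le G$, $S_H$ denotes the subsequence of $S$ consisting of all terms of $S$ lying in $H$. A sequence $S$ is regular if $|S_H|\leq |H|-1$ for every proper subgroup $H\subsetneq G$. $\sum(S)$ denotes the set of all sums of nonempty subsequences of $S$, and $S$ is an additive basis of $G$ if $\sum(S)=G$. $\mathsf c_0(G)$ is the smallest integer $t$ such that every regular sequence over $G$ of length at least $t$ is an additive basis of $G$. $C_m$ denotes the cyclic group of order $m$. -}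

module Defs where

open import Data.Nat using (ℕ; zero; suc; _+_; _*_; _≤_; NonZero)
open import Data.Nat.DivMod using (_mod_)
open import Data.Fin using (Fin; toℕ)
open import Data.Bool using (Bool; true; false)
open import Data.Product using (_×_; _,_; ∃; Σ)
open import Data.List using (List; []; _∷_; length; foldr; filterᵇ; allFin; cartesianProduct)
open import Data.List.Relation.Binary.Sublist.Propositional using (_⊆_)
open import Relation.Binary.PropositionalEquality using (_≡_; _≢_)

module _ (n₁ n₂ : ℕ) .{{_ : NonZero n₁}} .{{_ : NonZero n₂}} where

  G : Set
  G = Fin n₁ × Fin n₂

  0G : G
  0G = (0 mod n₁ , 0 mod n₂)

  _+G_ : G → G → G
  (a , b) +G (c , d) = ((toℕ a + toℕ c) mod n₁ , (toℕ b + toℕ d) mod n₂)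

  -G_ : G → G
  -G (a , b) = ((n₁ Data.Nat.∸ toℕ a) mod n₁ , (n₂ Data.Nat.∸ toℕ b) mod n₂)

  elements : List G
  elements = cartesianProduct (allFin n₁) (allFin n₂)

  order : ℕ
  order = length elements

  record Subgroup : Set where
    field
      mem    : G → Bool
      mem-0  : mem 0G ≡ true
      mem-+  : ∀ x y → mem x ≡ true → mem y ≡ true → mem (x +G y) ≡ true
      mem-neg : ∀ x → mem x ≡ true → mem (-G x) ≡ true
  open Subgroup public

  ∣_∣H : Subgroup → ℕ
  ∣ H ∣H = length (filterᵇ (mem H) elements)

  Proper : Subgroup → Set
  Proper H = ∃ λ g → mem H g ≡ false

  -- sequences over G (unordered; represented by lists)
  Seq : Set
  Seq = List G

  restrict : Seq → Subgroup → Seq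
  restrict S H = filterᵇ (mem H) S

  σ : Seq → G
  σ = foldr _+G_ 0G

  Regular : Seq → Set
  Regular S = (H : Subgroup) → Proper H → suc (length (restrict S H)) ≤ ∣ H ∣H

  _∈Σ_ : G → Seq → Set
  g ∈Σ S = Σ Seq λ T → T ⊆ S × T ≢ [] × σ T ≡ g

  AdditiveBasis : Seq → Set
  AdditiveBasis S = (g : G) → g ∈Σ S

  C0Property : ℕ → Set
  C0Property t = (S : Seq) → Regular S → t ≤ length S → AdditiveBasis S

  IsC0 : ℕ → Set
  IsC0 t = C0Property t × ((t' : ℕ) → C0Property t' → t ≤ t')

{-# OPTIONS --safe #-}
module Submission where

-- Lower bound: take the nonzero elements of a subgroup of index p together with p - 2 copies of one element
-- outside it.
--
-- Upper bound: write Σ₀(S) for the set of all subset sums of S, the empty one included.  By Kneser's theorem,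
-- if Σ₀(S) has a stabilizer K with 1 < |K| < |G|, then at most |G/K| - 2 terms of S lie outside K and, by
-- regularity, at most |K| - 1 inside, which is too few.  So it suffices to show that Σ₀(S) is periodic, and
-- again by Kneser this holds once S splits into blocks T with Σ (|Σ₀(T)| - 1) ≥ |G|, i.e. with an average gain
-- of p per term.  A frequent term f is put in one block with 2p - 1 other terms whose subset sums meet 2p cosets
-- of ⟨f⟩; the infrequent terms are distributed over dissociated blocks.  The 2p - 1 terms can only fail to
-- exist if a proper subgroup L contains most of S, and then the same argument is run inside L, where blocks of
-- two terms suffice.  If S had no zero-sum subsequence, Scherk's theorem would give |Σ₀(S)| > Σ (|Σ₀(T)| - 1)
-- for the same blocks, so 0 is attained by a nonempty sum as well.

open import Algebra.Bundles using (AbelianGroup)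
import Algebra.Properties.AbelianGroup as AbelianGroupProperties
import Algebra.Properties.CommutativeMonoid.Mult as Mult
open import Algebra.Structures using (IsAbelianGroup)
import Data.Bool as Bool
open import Data.Bool using (Bool; true; false; _∧_; _∨_; not)
open import Data.Bool.Properties using (T?) renaming (_≟_ to _≟ᵇ_)
open import Data.Empty using (⊥; ⊥-elim)
open import Data.Fin using (Fin; toℕ)
import Data.Fin.Properties as FinP
open import Data.List using (List; []; _∷_; _++_; length; map; filterᵇ; foldr; replicate; upTo; applyUpTo; allFin; cartesianProduct)
open import Data.List.Membership.Propositional using (find) renaming (_∈_ to _∈ₗ_)
open import Data.List.Membership.Propositional.Properties using (∈-++⁺ʳ; ∈-++⁻; ∈-applyUpTo⁻; ∈-cartesianProduct⁺; ∈-cartesianProduct⁻; ∈-allFin; ∈-map⁻; ∈-filter⁺; ∈-filter⁻; ∈-map⁺; ∈-∃++; ∈-++⁺ˡ; ∈-upTo⁺; ∈-upTo⁻)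
open import Data.List.Properties using (length-++; length-replicate; length-applyUpTo; length-map; length-tabulate; length-upTo; ++-assoc; filter-++)
import Data.List.Relation.Binary.Permutation.Propositional as Perm
open import Data.List.Relation.Binary.Permutation.Propositional using (_↭_; prep; swap; ↭-sym; ↭-trans; ↭-refl; ↭-reflexive)
open import Data.List.Relation.Binary.Permutation.Propositional.Properties using (↭-length; ++-comm; ∈-resp-↭; shift; shifts; filter-↭; ++⁺ˡ)
open import Data.List.Relation.Binary.Sublist.Propositional using () renaming (_⊆_ to _⊑_; [] to ⊑[]; _∷_ to _⊑∷_; _∷ʳ_ to _⊑∷ʳ_)
import Data.List.Relation.Unary.All as All
open import Data.List.Relation.Unary.All using (All; []; _∷_)
open import Data.List.Relation.Unary.AllPairs using ([]; _∷_)
import Data.List.Relation.Unary.Any as Any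
open import Data.List.Relation.Unary.Any using (Any; here; there)
open import Data.List.Relation.Unary.Unique.Propositional using (Unique)
import Data.List.Relation.Unary.Unique.Propositional.Properties as Unique
import Data.Nat as ℕ
open import Data.Nat hiding (_≟_)
open import Data.Nat.DivMod
open import Data.Nat.Divisibility using (_∣_; divides; ∣⇒≤; ∣-trans; n∣m⇒m%n≡0; m∣m*n; ∣m⇒∣m*n)
open import Data.Nat.Induction using (<-wellFounded)
open import Data.Nat.ListAction using (product)
open import Data.Nat.Primality using (Prime; prime⇒nonZero; euclidsLemma)
open import Data.Nat.Primality.Factorisation using (factorise)
open import Data.Nat.Properties hiding (_≟_)
open import Data.Nat.Tactic.RingSolver using (solve-∀)
open import Data.Product using (_×_; _,_; ∃; ∃₂; proj₁; proj₂)
open import Data.Product.Properties using (≡-dec)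
open import Data.Sum using (_⊎_; inj₁; inj₂; [_,_]′)
open import Data.Unit using (tt)
import Data.Vec as Vec
open import Data.Vec using (Vec; []; _∷_; lookup; zipWith)
open import Function using (_∘_)
open import Induction.WellFounded using (Acc; acc)
open import Relation.Binary.PropositionalEquality using (_≡_; _≢_; refl; sym; trans; cong; cong₂; subst; isEquivalence; module ≡-Reasoning)
open import Relation.Nullary using (Dec; yes; no; ¬_; does; ¬?; _×-dec_)
open import Relation.Nullary.Decidable using (decidable-stable; map′)

-- The blocks and the constants come from counting gain per term. A block of v copies of f and 2p -
-- 1 other terms (helpers) has at least 2p (v + 1) subset sums: it gains 2p per copy but only 1 per
-- helper. The average reaches p only if helpers are scarce, so a term counts as frequent from 12p
-- copies on, and helpers then make up at most a sixth of S. Since n₁ ≥ 2p, every ⟨f⟩ has the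
-- required 2p cosets. If helpers run out, at least 5/6 of S lies in L, where the target drops from
-- |G| to |L| ≤ |G|/p ≤ |S|, that is 6/5 per term of L, against 3/2 from a pair. A dissociated block
-- of infrequent terms gains p + 1 per term. The surplus of one per term pays for the terms that no
-- such block can absorb: they take at most 3ᵏ ≤ 6p³ values, each fewer than 12p times, and each
-- falls short by p. This needs p · 6p³ · 12p ≤ |S|, and since |S| ≥ |G|/p it follows from |G| ≥
-- 72p⁶.

unique-⊆⇒length-≤ : ∀ {A : Set} {xs ys : List A} → Unique xs → (∀ {x} → x ∈ₗ xs → x ∈ₗ ys) →
                    length xs ≤ length ys
unique-⊆⇒length-≤ {xs = []} _ _ = z≤n
unique-⊆⇒length-≤ {xs = x ∷ xs} (x∉ ∷ u) s with ∈-∃++ (s (here refl))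
... | as , bs , refl = ≤-trans (s≤s (unique-⊆⇒length-≤ u s′)) (≤-reflexive (sym (↭-length (shift x as bs))))
  where
  s′ : ∀ {y} → y ∈ₗ xs → y ∈ₗ as ++ bs
  s′ y∈ with ∈-resp-↭ (shift x as bs) (s (there y∈))
  ... | here refl = ⊥-elim (All.lookup x∉ y∈ refl)
  ... | there q = q

length-filterᵇ-∪∩ : ∀ {A : Set} (P Q : A → Bool) (xs : List A) →
  length (filterᵇ (λ x → P x ∨ Q x) xs) + length (filterᵇ (λ x → P x ∧ Q x) xs) ≡
  length (filterᵇ P xs) + length (filterᵇ Q xs)
length-filterᵇ-∪∩ P Q [] = refl
length-filterᵇ-∪∩ P Q (x ∷ xs) with P x | Q x
... | true | true = cong suc (trans (+-suc _ _) (trans (cong suc (length-filterᵇ-∪∩ P Q xs)) (sym (+-suc _ _))))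
... | true | false = cong suc (length-filterᵇ-∪∩ P Q xs)
... | false | true = trans (cong suc (length-filterᵇ-∪∩ P Q xs)) (sym (+-suc _ _))
... | false | false = length-filterᵇ-∪∩ P Q xs

-- An additive constraint l ≤ r may be spent to prove a ≤ b once a + r + slack ≡ b + l.
≤-by : ∀ {l r a b} slack → l ≤ r → a + r + slack ≡ b + l → a ≤ b
≤-by {l} {r} {a} {b} slack l≤r e = +-cancelʳ-≤ r a b
  (≤-trans (m≤m+n (a + r) slack) (≤-trans (≤-reflexive e) (+-monoʳ-≤ b l≤r)))

≤-slack : ∀ {a b} slack → a + slack ≡ b → a ≤ b
≤-slack {a} slack e = ≤-trans (m≤m+n a slack) (≤-reflexive e)

-- Finite abelian groups and a reflective solver for their linear identities.

record FiniteAbelianGroup : Set₁ where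
  infixl 7 _∙_
  infix 8 _⁻¹
  field
    G : Set
    _∙_ : G → G → G
    ε : G
    _⁻¹ : G → G
    isAbelianGroup : IsAbelianGroup _≡_ _∙_ ε _⁻¹
    elements : List G
    elements-unique : Unique elements
    elements-complete : ∀ x → x ∈ₗ elements
    _≟_ : (x y : G) → Dec (x ≡ y)

  abelianGroup : AbelianGroup _ _
  abelianGroup = record { isAbelianGroup = isAbelianGroup }

  open AbelianGroup abelianGroup public using (assoc; comm; identityˡ; identityʳ; inverseˡ; inverseʳ; commutativeMonoid)

module Solver (𝔾 : FiniteAbelianGroup) where
  open FiniteAbelianGroup 𝔾
  open Mult commutativeMonoid public using (×-homo-+) renaming (_×_ to _⋆_)
  open AbelianGroupProperties abelianGroup public using (∙-cancelʳ; ∙-cancelˡ)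

  data Expr (n : ℕ) : Set where
    var : Fin n → Expr n
    _⊕_ : Expr n → Expr n → Expr n
    ⊝_ : Expr n → Expr n
    ⓪ : Expr n

  infixl 7 _⊕_
  infix 8 ⊝_

  Env : ℕ → Set
  Env = Vec G

  ⟦_⟧ : ∀ {n} → Expr n → Env n → G
  ⟦ var i ⟧ ρ = lookup ρ i
  ⟦ a ⊕ b ⟧ ρ = ⟦ a ⟧ ρ ∙ ⟦ b ⟧ ρ
  ⟦ ⊝ a ⟧ ρ = ⟦ a ⟧ ρ ⁻¹
  ⟦ ⓪ ⟧ ρ = ε

  unit : ∀ {n} → Fin n → Vec ℕ n
  unit Fin.zero = 1 ∷ Vec.replicate _ 0
  unit (Fin.suc i) = 0 ∷ unit i

  -- An expression is read as the difference of two vectors of multiplicities. Normal forms then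
  -- need only natural numbers, and the hypothesis of `solve` is a closed equation that `refl`
  -- proves.
  pos neg : ∀ {n} → Expr n → Vec ℕ n
  pos (var i) = unit i
  pos (a ⊕ b) = zipWith _+_ (pos a) (pos b)
  pos (⊝ a) = neg a
  pos ⓪ = Vec.replicate _ 0
  neg (var i) = Vec.replicate _ 0
  neg (a ⊕ b) = zipWith _+_ (neg a) (neg b)
  neg (⊝ a) = pos a
  neg ⓪ = Vec.replicate _ 0

  eval : ∀ {n} → Vec ℕ n → Env n → G
  eval [] [] = ε
  eval (k ∷ ks) (x ∷ ρ) = (k ⋆ x) ∙ eval ks ρ

  interchange : ∀ a b c d → (a ∙ b) ∙ (c ∙ d) ≡ (a ∙ c) ∙ (b ∙ d)
  interchange a b c d = begin
    (a ∙ b) ∙ (c ∙ d) ≡⟨ assoc a b _ ⟩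
    a ∙ (b ∙ (c ∙ d)) ≡⟨ cong (a ∙_) (trans (sym (assoc b c d)) (trans (cong (_∙ d) (comm b c)) (assoc c b d))) ⟩
    a ∙ (c ∙ (b ∙ d)) ≡⟨ assoc a c _ ⟨
    (a ∙ c) ∙ (b ∙ d) ∎
    where open ≡-Reasoning

  eval-+ : ∀ {n} (u v : Vec ℕ n) ρ → eval (zipWith _+_ u v) ρ ≡ eval u ρ ∙ eval v ρ
  eval-+ [] [] [] = sym (identityˡ ε)
  eval-+ (j ∷ u) (k ∷ v) (x ∷ ρ) =
    trans (cong₂ _∙_ (×-homo-+ x j k) (eval-+ u v ρ)) (interchange _ _ _ _)

  eval-0 : ∀ {n} (ρ : Env n) → eval (Vec.replicate _ 0) ρ ≡ ε
  eval-0 [] = refl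
  eval-0 (x ∷ ρ) = trans (identityˡ _) (eval-0 ρ)

  eval-unit : ∀ {n} (i : Fin n) ρ → eval (unit i) ρ ≡ lookup ρ i
  eval-unit Fin.zero (x ∷ ρ) = trans (cong₂ _∙_ (identityʳ x) (eval-0 ρ)) (identityʳ x)
  eval-unit (Fin.suc i) (x ∷ ρ) = trans (identityˡ _) (eval-unit i ρ)

  correct : ∀ {n} (e : Expr n) ρ → ⟦ e ⟧ ρ ∙ eval (neg e) ρ ≡ eval (pos e) ρ
  correct (var i) ρ = trans (cong (lookup ρ i ∙_) (eval-0 ρ)) (trans (identityʳ _) (sym (eval-unit i ρ)))
  correct (a ⊕ b) ρ = begin
    (⟦ a ⟧ ρ ∙ ⟦ b ⟧ ρ) ∙ eval (zipWith _+_ (neg a) (neg b)) ρ ≡⟨ cong ((⟦ a ⟧ ρ ∙ ⟦ b ⟧ ρ) ∙_) (eval-+ (neg a) (neg b) ρ) ⟩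
    (⟦ a ⟧ ρ ∙ ⟦ b ⟧ ρ) ∙ (eval (neg a) ρ ∙ eval (neg b) ρ)    ≡⟨ interchange _ _ _ _ ⟩
    (⟦ a ⟧ ρ ∙ eval (neg a) ρ) ∙ (⟦ b ⟧ ρ ∙ eval (neg b) ρ)    ≡⟨ cong₂ _∙_ (correct a ρ) (correct b ρ) ⟩
    eval (pos a) ρ ∙ eval (pos b) ρ                            ≡⟨ eval-+ (pos a) (pos b) ρ ⟨
    eval (zipWith _+_ (pos a) (pos b)) ρ ∎
    where open ≡-Reasoning
  correct (⊝ a) ρ = begin
    ⟦ a ⟧ ρ ⁻¹ ∙ eval (pos a) ρ              ≡⟨ cong (⟦ a ⟧ ρ ⁻¹ ∙_) (correct a ρ) ⟨
    ⟦ a ⟧ ρ ⁻¹ ∙ (⟦ a ⟧ ρ ∙ eval (neg a) ρ)  ≡⟨ assoc _ _ _ ⟨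
    (⟦ a ⟧ ρ ⁻¹ ∙ ⟦ a ⟧ ρ) ∙ eval (neg a) ρ  ≡⟨ cong (_∙ eval (neg a) ρ) (inverseˡ _) ⟩
    ε ∙ eval (neg a) ρ                       ≡⟨ identityˡ _ ⟩
    eval (neg a) ρ ∎
    where open ≡-Reasoning
  correct ⓪ ρ = trans (identityˡ _) refl

  solve : ∀ {n} (a b : Expr n) (ρ : Env n) →
          zipWith _+_ (pos a) (neg b) ≡ zipWith _+_ (pos b) (neg a) → ⟦ a ⟧ ρ ≡ ⟦ b ⟧ ρ
  solve a b ρ e = ∙-cancelʳ (eval (neg a) ρ ∙ eval (neg b) ρ) _ _ (begin
    ⟦ a ⟧ ρ ∙ (eval (neg a) ρ ∙ eval (neg b) ρ) ≡⟨ assoc _ _ _ ⟨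
    (⟦ a ⟧ ρ ∙ eval (neg a) ρ) ∙ eval (neg b) ρ ≡⟨ cong (_∙ eval (neg b) ρ) (correct a ρ) ⟩
    eval (pos a) ρ ∙ eval (neg b) ρ             ≡⟨ eval-+ (pos a) (neg b) ρ ⟨
    eval (zipWith _+_ (pos a) (neg b)) ρ        ≡⟨ cong (λ v → eval v ρ) e ⟩
    eval (zipWith _+_ (pos b) (neg a)) ρ        ≡⟨ eval-+ (pos b) (neg a) ρ ⟩
    eval (pos b) ρ ∙ eval (neg a) ρ             ≡⟨ cong (_∙ eval (neg a) ρ) (correct b ρ) ⟨
    (⟦ b ⟧ ρ ∙ eval (neg b) ρ) ∙ eval (neg a) ρ ≡⟨ assoc _ _ _ ⟩
    ⟦ b ⟧ ρ ∙ (eval (neg b) ρ ∙ eval (neg a) ρ) ≡⟨ cong (⟦ b ⟧ ρ ∙_) (comm _ _) ⟩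
    ⟦ b ⟧ ρ ∙ (eval (neg a) ρ ∙ eval (neg b) ρ) ∎)
    where open ≡-Reasoning

  pattern v0 = var Fin.zero
  pattern v1 = var (Fin.suc Fin.zero)
  pattern v2 = var (Fin.suc (Fin.suc Fin.zero))
  pattern v3 = var (Fin.suc (Fin.suc (Fin.suc Fin.zero)))
  pattern v4 = var (Fin.suc (Fin.suc (Fin.suc (Fin.suc Fin.zero))))

-- Decidable subsets, their cardinalities, sumsets, translates, subgroups and stabilizers.

module Subsets (𝔾 : FiniteAbelianGroup) where
  open FiniteAbelianGroup 𝔾 public
  open Solver 𝔾 public

  Subset : Set
  Subset = G → Bool

  infix 4 _∈_ _∉_ _⊆_
  record _∈_ (x : G) (X : Subset) : Set where
    constructor mk∈
    field un∈ : X x ≡ true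
  open _∈_ public

  _∉_ : G → Subset → Set
  x ∉ X = ¬ (x ∈ X)

  _⊆_ : Subset → Subset → Set
  X ⊆ Y = ∀ {x} → x ∈ X → x ∈ Y

  _∈?_ : ∀ x X → Dec (x ∈ X)
  x ∈? X = map′ mk∈ un∈ (X x ≟ᵇ true)

  full ∅ : Subset
  full _ = true
  ∅ _ = false

  infixr 5 _∪_
  infixr 6 _∩_
  abstract
    _∪_ _∩_ : Subset → Subset → Subset
    (X ∪ Y) x = X x ∨ Y x
    (X ∩ Y) x = X x ∧ Y x

    ∈∪⁻ : ∀ {x X Y} → x ∈ X ∪ Y → x ∈ X ⊎ x ∈ Y
    ∈∪⁻ {x} {X} {Y} (mk∈ p) with X x in eq
    ... | true = inj₁ (mk∈ eq)
    ... | false = inj₂ (mk∈ p)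

    ∈∪ˡ : ∀ {x X Y} → x ∈ X → x ∈ X ∪ Y
    ∈∪ˡ {x} {X} {Y} (mk∈ p) = mk∈ (cong (_∨ Y x) p)

    ∈∪ʳ : ∀ {x X Y} → x ∈ Y → x ∈ X ∪ Y
    ∈∪ʳ {x} {X} {Y} (mk∈ p) with X x in eq
    ... | true = mk∈ (cong (_∨ Y x) eq)
    ... | false = mk∈ (trans (cong (_∨ Y x) eq) p)

    ∈∩⁻ : ∀ {x X Y} → x ∈ X ∩ Y → x ∈ X × x ∈ Y
    ∈∩⁻ {x} {X} {Y} (mk∈ p) with X x in eq
    ... | true = mk∈ eq , mk∈ p
    ... | false with () ← p

    ∈∩⁺ : ∀ {x X Y} → x ∈ X → x ∈ Y → x ∈ X ∩ Y
    ∈∩⁺ (mk∈ p) (mk∈ q) = mk∈ (cong₂ _∧_ p q)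

  ⟪_⟫ : {P : G → Set} → (∀ x → Dec (P x)) → Subset
  ⟪ P? ⟫ x = does (P? x)

  ∈⟪⟫⁺ : {P : G → Set} (P? : ∀ x → Dec (P x)) → ∀ {x} → P x → x ∈ ⟪ P? ⟫
  ∈⟪⟫⁺ P? {x} p with P? x in eq
  ... | yes _ = mk∈ (cong does eq)
  ... | no ¬p = ⊥-elim (¬p p)

  ∈⟪⟫⁻ : {P : G → Set} (P? : ∀ x → Dec (P x)) → ∀ {x} → x ∈ ⟪ P? ⟫ → P x
  ∈⟪⟫⁻ P? {x} (mk∈ e) with P? x
  ... | yes p = p
  ... | no ¬p with () ← e

  any? : {P : G → Set} → (∀ x → Dec (P x)) → Dec (∃ P)
  any? P? = map′ Any.satisfied (λ (x , p) → Any.map (λ { refl → p }) (elements-complete x)) (Any.any? P? elements)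

  ⊆? : ∀ X Y → X ⊆ Y ⊎ ∃ λ x → x ∈ X × x ∉ Y
  ⊆? X Y with any? (λ x → (x ∈? X) ×-dec ¬? (x ∈? Y))
  ... | yes q = inj₂ q
  ... | no ¬q = inj₁ λ {x} xX → decidable-stable (x ∈? Y) λ n → ¬q (x , xX , n)

  nonempty? : ∀ X → (∃ λ x → x ∈ X) ⊎ (∀ {x} → x ∉ X)
  nonempty? X with any? (_∈? X)
  ... | yes q = inj₁ q
  ... | no ¬q = inj₂ λ xX → ¬q (_ , xX)

  abstract
    card : Subset → ℕ
    card X = length (filterᵇ X elements)

    card-def : ∀ X → card X ≡ length (filterᵇ X elements)
    card-def X = refl

    ∈-enum⁺ : ∀ {X x} → x ∈ X → x ∈ₗ filterᵇ X elements
    ∈-enum⁺ {X} {x} (mk∈ p) = ∈-filter⁺ (T? ∘ X) (elements-complete x) (subst Bool.T (sym p) tt)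

    ∈-enum⁻ : ∀ {X x} → x ∈ₗ filterᵇ X elements → x ∈ X
    ∈-enum⁻ {X} {x} i with X x in eq | proj₂ (∈-filter⁻ (T? ∘ X) {xs = elements} i)
    ... | true | _ = mk∈ eq

    enum-unique : ∀ X → Unique (filterᵇ X elements)
    enum-unique X = Unique.filter⁺ (T? ∘ X) elements-unique

    card-inj : ∀ {X Y} (f : G → G) → (∀ {x y} → f x ≡ f y → x ≡ y) → (∀ {x} → x ∈ X → f x ∈ Y) → card X ≤ card Y
    card-inj {X} {Y} f inj m = ≤-trans (≤-reflexive (sym (length-map f (filterᵇ X elements))))
      (unique-⊆⇒length-≤ (Unique.map⁺ inj (enum-unique X)) λ i →
        let x , x∈ , eq = ∈-map⁻ f i in subst (_∈ₗ _) (sym eq) (∈-enum⁺ (m (∈-enum⁻ {X} x∈))))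

    card-mono : ∀ {X Y} → X ⊆ Y → card X ≤ card Y
    card-mono s = card-inj (λ x → x) (λ e → e) s

    card-≤-list : ∀ {X} (l : List G) → (∀ {x} → x ∈ X → x ∈ₗ l) → card X ≤ length l
    card-≤-list {X} l s = unique-⊆⇒length-≤ (enum-unique X) (λ i → s (∈-enum⁻ i))

    card-≥-list : ∀ {X} {l : List G} → Unique l → (∀ {x} → x ∈ₗ l → x ∈ X) → length l ≤ card X
    card-≥-list u s = unique-⊆⇒length-≤ u (λ i → ∈-enum⁺ (s i))

    card-∪∩ : ∀ X Y → card (X ∪ Y) + card (X ∩ Y) ≡ card X + card Y
    card-∪∩ X Y = length-filterᵇ-∪∩ X Y elements

  card-∪≤ : ∀ X Y → card (X ∪ Y) ≤ card X + card Y
  card-∪≤ X Y = ≤-trans (m≤m+n _ _) (≤-reflexive (card-∪∩ X Y))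

  card-∅ : ∀ {X} → (∀ {x} → x ∉ X) → card X ≡ 0
  card-∅ n = n≤0⇒n≡0 (card-≤-list [] (λ i → ⊥-elim (n i)))

  card-disjoint : ∀ X Y → (∀ {x} → x ∈ X → x ∉ Y) → card (X ∪ Y) ≡ card X + card Y
  card-disjoint X Y d = trans (sym (+-identityʳ _)) (trans (cong (card (X ∪ Y) +_)
    (sym (card-∅ {X ∩ Y} λ i → let a , b = ∈∩⁻ {X = X} i in d a b))) (card-∪∩ X Y))

  card-disjoint-≤ : ∀ X Y Z → (∀ {x} → x ∈ X → x ∉ Y) → X ⊆ Z → Y ⊆ Z → card X + card Y ≤ card Z
  card-disjoint-≤ X Y Z d s t = ≤-trans (≤-reflexive (sym (card-disjoint X Y d)))
    (card-mono λ i → [ s , t ]′ (∈∪⁻ {X = X} i))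

  card-pos : ∀ {X x} → x ∈ X → 1 ≤ card X
  card-pos {X} {x} i = card-≥-list {X} {x ∷ []} ([] ∷ []) λ { (here refl) → i }

  card-strict : ∀ {X Y y} → X ⊆ Y → y ∈ Y → y ∉ X → card X < card Y
  card-strict {X} {Y} {y} s yY y∉ = ≤-trans (≤-reflexive (+-comm 1 _))
    (≤-trans (+-monoʳ-≤ (card X) (card-pos {⟪ _≟ y ⟫} (∈⟪⟫⁺ (_≟ y) refl)))
     (card-disjoint-≤ X ⟪ _≟ y ⟫ Y (λ i j → y∉ (subst (_∈ X) (∈⟪⟫⁻ (_≟ y) j) i)) s
       (λ j → subst (_∈ Y) (sym (∈⟪⟫⁻ (_≟ y) j)) yY)))

  card-⊆-≥ : ∀ {X Y} → X ⊆ Y → card Y ≤ card X → Y ⊆ X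
  card-⊆-≥ {X} s le {y} yY = decidable-stable (y ∈? X) λ n → <⇒≱ (card-strict s yY n) le

  infixl 7 _⊞_
  abstract
    ⊞-dec : ∀ (X Y : Subset) g → Dec (∃ λ x → x ∈ X × (g ∙ x ⁻¹) ∈ Y)
    ⊞-dec X Y g = any? λ x → (x ∈? X) ×-dec ((g ∙ x ⁻¹) ∈? Y)

    _⊞_ : Subset → Subset → Subset
    X ⊞ Y = ⟪ ⊞-dec X Y ⟫

    ∈⊞⁺ : ∀ {X Y x y} → x ∈ X → y ∈ Y → x ∙ y ∈ X ⊞ Y
    ∈⊞⁺ {X} {Y} {x} {y} i j = ∈⟪⟫⁺ (⊞-dec X Y)
      (x , i , subst (_∈ Y) (solve v1 ((v0 ⊕ v1) ⊕ ⊝ v0) (x ∷ y ∷ []) refl) j)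

    ∈⊞⁻ : ∀ {X Y g} → g ∈ X ⊞ Y → ∃₂ λ x y → x ∈ X × y ∈ Y × g ≡ x ∙ y
    ∈⊞⁻ {X} {Y} {g} i = let x , a , b = ∈⟪⟫⁻ (⊞-dec X Y) i in
      x , g ∙ x ⁻¹ , a , b , solve v0 (v1 ⊕ (v0 ⊕ ⊝ v1)) (g ∷ x ∷ []) refl

  ⊞-mono : ∀ {X X′ Y Y′} → X ⊆ X′ → Y ⊆ Y′ → X ⊞ Y ⊆ X′ ⊞ Y′
  ⊞-mono {X} {X′} {Y} {Y′} s t i with x , y , a , b , refl ← ∈⊞⁻ {X} {Y} i = ∈⊞⁺ (s a) (t b)

  infixl 7 _⊹_
  abstract
    _⊹_ : Subset → G → Subset
    (X ⊹ a) g = X (g ∙ a ⁻¹)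

    ∈⊹⁻ : ∀ {X a g} → g ∈ X ⊹ a → g ∙ a ⁻¹ ∈ X
    ∈⊹⁻ (mk∈ p) = mk∈ p

    ∈⊹⁻′ : ∀ {X a g} → g ∈ X ⊹ a → ∃ λ x → x ∈ X × g ≡ x ∙ a
    ∈⊹⁻′ {X} {a} {g} i = g ∙ a ⁻¹ , ∈⊹⁻ {X} i , solve v0 ((v0 ⊕ ⊝ v1) ⊕ v1) (g ∷ a ∷ []) refl

    ∈⊹⁺ : ∀ {X a x} → x ∈ X → x ∙ a ∈ X ⊹ a
    ∈⊹⁺ {X} {a} {x} i = mk∈ (un∈ (subst (_∈ X) (solve v0 ((v0 ⊕ v1) ⊕ ⊝ v1) (x ∷ a ∷ []) refl) i))

    ∈⊹⁺′ : ∀ {X a g} → g ∙ a ⁻¹ ∈ X → g ∈ X ⊹ a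
    ∈⊹⁺′ (mk∈ p) = mk∈ p

  card-⊹ : ∀ X a → card (X ⊹ a) ≡ card X
  card-⊹ X a = ≤-antisym
    (card-inj (_∙ a ⁻¹) (∙-cancelʳ _ _ _) (∈⊹⁻ {X}))
    (card-inj (_∙ a) (∙-cancelʳ _ _ _) ∈⊹⁺)

  record Sub : Set where
    field
      set : Subset
      ε∈ : ε ∈ set
      ∙∈ : ∀ {x y} → x ∈ set → y ∈ set → x ∙ y ∈ set
      ⁻¹∈ : ∀ {x} → x ∈ set → x ⁻¹ ∈ set
  open Sub public

  Stable : Subset → Sub → Set
  Stable X H = ∀ {x h} → x ∈ X → h ∈ set H → x ∙ h ∈ X

  stab-dec : ∀ X g → Dec (X ⊹ g ⊆ X)
  stab-dec X g with ⊆? (X ⊹ g) X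
  ... | inj₁ s = yes s
  ... | inj₂ (x , i , n) = no λ s → n (s i)

  abstract
    stabSet : Subset → Subset
    stabSet X = ⟪ stab-dec X ⟫

    ∈stab⁺ : ∀ {X g} → (∀ {x} → x ∈ X → x ∙ g ∈ X) → g ∈ stabSet X
    ∈stab⁺ {X} {g} f = ∈⟪⟫⁺ (stab-dec X) λ i → let x , a , e = ∈⊹⁻′ {X} i in subst (_∈ X) (sym e) (f a)

    ∈stab⁻ : ∀ {X x g} → x ∈ X → g ∈ stabSet X → x ∙ g ∈ X
    ∈stab⁻ {X} i j = ∈⟪⟫⁻ (stab-dec X) j (∈⊹⁺ i)

    stabSet-⊹ : ∀ {X g} → g ∈ stabSet X → X ⊹ g ⊆ X
    stabSet-⊹ {X} = ∈⟪⟫⁻ (stab-dec X)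

  stab : Subset → Sub
  set (stab X) = stabSet X
  ε∈ (stab X) = ∈stab⁺ λ {x} i → subst (_∈ X) (sym (identityʳ x)) i
  ∙∈ (stab X) {g} {h} i j = ∈stab⁺ λ {x} k → subst (_∈ X) (assoc x g h) (∈stab⁻ (∈stab⁻ k i) j)
  -- Membership in `stabSet` asks only for `X ⊹ g ⊆ X`. By finiteness the inclusion is an equality,
  -- which gives the inverse.
  ⁻¹∈ (stab X) {g} i = ∈stab⁺ λ {x} k → ∈⊹⁻ {X} {a = g} (card-⊆-≥ {X ⊹ g} {X} (stabSet-⊹ i)
      (≤-reflexive (sym (card-⊹ X g))) k)

  stab-stable : ∀ X → Stable X (stab X)
  stab-stable X = ∈stab⁻

  _⊓ₛ_ : Sub → Sub → Sub
  set (H ⊓ₛ K) = set H ∩ set K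
  ε∈ (H ⊓ₛ K) = ∈∩⁺ (ε∈ H) (ε∈ K)
  ∙∈ (H ⊓ₛ K) i j = let a , b = ∈∩⁻ {X = set H} i; c , d = ∈∩⁻ {X = set H} j in ∈∩⁺ (∙∈ H a c) (∙∈ K b d)
  ⁻¹∈ (H ⊓ₛ K) i = let a , b = ∈∩⁻ {X = set H} i in ∈∩⁺ (⁻¹∈ H a) (⁻¹∈ K b)

  card-Sub-pos : ∀ H → 1 ≤ card (set H)
  card-Sub-pos H = card-pos (ε∈ H)

  ⊞-stable : ∀ X H → Stable (X ⊞ set H) H
  ⊞-stable X H i j with x , h , a , b , refl ← ∈⊞⁻ {X} i =
    subst (_∈ X ⊞ set H) (sym (assoc _ _ _)) (∈⊞⁺ a (∙∈ H b j))

  ⊆⊞ : ∀ {X Y} → ε ∈ Y → X ⊆ X ⊞ Y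
  ⊆⊞ {X} {Y} e {x} i = subst (_∈ X ⊞ Y) (identityʳ x) (∈⊞⁺ i e)

  ⊞-absorb : ∀ {X H} → Stable X H → X ⊞ set H ⊆ X
  ⊞-absorb {X} s i with x , h , a , b , refl ← ∈⊞⁻ {X} i = s a b

-- Kneser's theorem.

module KneserTheorem (𝔾 : FiniteAbelianGroup) where
  open Subsets 𝔾

  KneserBound : Subset → Subset → Set
  KneserBound X Y = card (X ⊞ K) + card (Y ⊞ K) ≤ card (X ⊞ Y) + card K
    where
    K : Subset
    K = set (stab (X ⊞ Y))

  -- The sumset `X` of the parts of `A` and `B` in `H + c` and `H + d` lies in the `H`-coset of `e`
  -- but misses `e`, so its stabilizer is strictly smaller than `H`. The set `C`, a union of
  -- `H`-cosets inside `A + B`, must avoid that coset altogether. Hence `X` is smaller than `A + B`,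
  -- and the induction hypothesis applies to it.
  module CosetBlock (A B C : Subset) (H : Sub) (C⊆ : C ⊆ A ⊞ B) (C-stable : Stable C H) (z : G) (z∈C : z ∈ C)
    (ih : ∀ P Q {p q} → p ∈ P → q ∈ Q → card (P ⊞ Q) < card (A ⊞ B) → KneserBound P Q)
    (e : G) (e∉ : e ∉ A ⊞ B) (c d : G) (e∈ : e ∙ (c ∙ d) ⁻¹ ∈ set H)
    (p q : G) (p∈ : p ∈ A ∩ (set H ⊹ c)) (q∈ : q ∈ B ∩ (set H ⊹ d)) where

    P Q X : Subset
    P = A ∩ (set H ⊹ c)
    Q = B ∩ (set H ⊹ d)
    X = P ⊞ Q

    H₁ : Sub
    H₁ = stab X

    X⊆ : X ⊆ A ⊞ B
    X⊆ = ⊞-mono {P} {A} {Q} {B} (λ i → proj₁ (∈∩⁻ {X = A} i)) (λ i → proj₁ (∈∩⁻ {X = B} i))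

    X-coset : ∀ {x} → x ∈ X → x ∙ e ⁻¹ ∈ set H
    X-coset i with x , y , a , b , refl ← ∈⊞⁻ {P} {Q} i =
      subst (_∈ set H) (solve ((v0 ⊕ ⊝ v2) ⊕ ((v1 ⊕ ⊝ v3) ⊕ ⊝ (v4 ⊕ ⊝ (v2 ⊕ v3)))) ((v0 ⊕ v1) ⊕ ⊝ v4) (x ∷ y ∷ c ∷ d ∷ e ∷ []) refl)
        (∙∈ H (∈⊹⁻ {set H} (proj₂ (∈∩⁻ {X = A} a))) (∙∈ H (∈⊹⁻ {set H} (proj₂ (∈∩⁻ {X = B} b))) (⁻¹∈ H e∈)))

    x₀∈ : p ∙ q ∈ X
    x₀∈ = ∈⊞⁺ p∈ q∈

    H₁⊆ : set H₁ ⊆ set H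
    H₁⊆ {h} i = subst (_∈ set H) (solve (((v0 ⊕ v1) ⊕ ⊝ v2) ⊕ ⊝ (v0 ⊕ ⊝ v2)) v1 (p ∙ q ∷ h ∷ e ∷ []) refl)
      (∙∈ H (X-coset (stab-stable X x₀∈ i)) (⁻¹∈ H (X-coset x₀∈)))

    to-e : ∀ x → x ∙ (x ∙ e ⁻¹) ⁻¹ ≡ e
    to-e x = solve (v0 ⊕ ⊝ (v0 ⊕ ⊝ v1)) v1 (x ∷ e ∷ []) refl

    H₁< : card (set H₁) < card (set H)
    H₁< = card-strict {set H₁} H₁⊆ (⁻¹∈ H (X-coset x₀∈))
      λ i → e∉ (X⊆ (subst (_∈ X) (to-e (p ∙ q)) (stab-stable X x₀∈ i)))

    e-disjoint : ∀ {x} → x ∈ set H₁ ⊹ e → x ∉ X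
    e-disjoint {x} i j = e∉ (X⊆ (subst (_∈ X) (to-e x) (stab-stable X j (⁻¹∈ H₁ (∈⊹⁻ {set H₁} i)))))

    C-disjoint : ∀ {x} → x ∈ C → x ∉ X
    C-disjoint {x} i j = e∉ (C⊆ (subst (_∈ C) (to-e x) (C-stable i (⁻¹∈ H (X-coset j)))))

    bound : card (P ⊞ set H₁) + card (Q ⊞ set H₁) ≤ card X + card (set H₁)
    bound = ih P Q p∈ q∈ (card-strict {X} X⊆ (C⊆ z∈C) (C-disjoint z∈C))

  module Descent (A B : Subset)
    (ih : ∀ P Q {p q} → p ∈ P → q ∈ Q → card (P ⊞ Q) < card (A ⊞ B) → KneserBound P Q) where

    Z U : Subset
    Z = A ⊞ B
    U = A ∪ B

    -- `bound` is Kneser's inequality for the pair `A ∩ B`, `U`, with `C` in the role of the sumset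
    -- and `H` in that of its stabilizer. Once `Z` is stable under `H`, the identity |A ∩ B| + |U| =
    -- |A| + |B| turns it into the bound wanted for `A` and `B`.
    record Convergent (C : Subset) (H : Sub) : Set where
      field
        stable : Stable C H
        sub : C ⊆ Z
        {point} : G
        inhabited : point ∈ C
        bound : card (A ∩ B) + card (U ⊞ set H) ≤ card C + card (set H)

    coset-back : ∀ H {u h c} → h ∈ set H → u ∙ h ∈ set H ⊹ c → u ∈ set H ⊹ c
    coset-back H {u} {h} {c} i j = ∈⊹⁺′ ((subst (_∈ set H)
      (solve (((v0 ⊕ v1) ⊕ ⊝ v2) ⊕ ⊝ v1) (v0 ⊕ ⊝ v2) (u ∷ h ∷ c ∷ []) refl)
      (∙∈ H (∈⊹⁻ {set H} j) (⁻¹∈ H i))))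

    coset⊆ : ∀ {H c} → c ∈ U → set H ⊹ c ⊆ U ⊞ set H
    coset⊆ {H} {c} i j with h , a , refl ← ∈⊹⁻′ {set H} j = subst (_∈ U ⊞ set H) (comm c h) (∈⊞⁺ i a)

    -- Both `U + J` and `D` lie in `U + H`, so shrinking `H` to `J` frees at least |D| - m elements.
    -- This saving compensates for the smaller subgroup on the right of `bound`.
    grow : ∀ {H J D m} → set J ⊆ set H → D ⊆ U ⊞ set H → card ((U ⊞ set J) ∩ D) ≤ m →
           card (U ⊞ set J) + card D ≤ card (U ⊞ set H) + m
    grow {H} {J} {D} J⊆ D⊆ le = begin
      card (U ⊞ set J) + card D                         ≡⟨ card-∪∩ (U ⊞ set J) D ⟨
      card ((U ⊞ set J) ∪ D) + card ((U ⊞ set J) ∩ D)   ≤⟨ +-mono-≤ (card-mono λ i → [ ⊞-mono {U} {U} {set J} {set H} (λ u → u) J⊆ , D⊆ ]′ (∈∪⁻ {X = U ⊞ set J} i)) le ⟩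
      card (U ⊞ set H) + _ ∎
      where open ≤-Reasoning

    -- From a convergent (C, H) either the bound follows, or adding to C the part of A + B in one
    -- coset of H that A + B does not fill gives a convergent with a smaller subgroup.
    descend : ∀ {C H} → Convergent C H → Acc _<_ (card (set H)) → card A + card B ≤ card Z + card (set (stab Z))
    descend {C} {H} conv (acc rec) with ⊆? (Z ⊞ set H) Z
    ... | inj₁ Z-stable = begin
      card A + card B                       ≡⟨ card-∪∩ A B ⟨
      card U + card (A ∩ B)                 ≤⟨ +-monoˡ-≤ _ (card-mono (⊆⊞ (ε∈ H))) ⟩
      card (U ⊞ set H) + card (A ∩ B)       ≡⟨ +-comm (card (U ⊞ set H)) _ ⟩
      card (A ∩ B) + card (U ⊞ set H)       ≤⟨ Convergent.bound conv ⟩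
      card C + card (set H)                 ≤⟨ +-mono-≤ (card-mono (Convergent.sub conv))
                                                 (card-mono λ i → ∈stab⁺ {Z} λ j → Z-stable (∈⊞⁺ j i)) ⟩
      card Z + card (set (stab Z)) ∎
      where open ≤-Reasoning
    ... | inj₂ (e , e∈ , e∉) with z , h , z∈ , h∈ , refl ← ∈⊞⁻ {Z} e∈ with a , b , a∈ , b∈ , refl ← ∈⊞⁻ {A} {B} z∈ = cases
      where
      open Convergent conv

      self : ∀ c → c ∈ set H ⊹ c
      self c = ∈⊹⁺′ ((subst (_∈ set H) (sym (inverseʳ c)) (ε∈ H)))

      A₁ B₁ A₂ B₂ : Subset
      A₁ = A ∩ (set H ⊹ a)
      B₁ = B ∩ (set H ⊹ b)
      A₂ = A ∩ (set H ⊹ b)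
      B₂ = B ∩ (set H ⊹ a)

      module X = CosetBlock A B C H sub stable point inhabited ih (a ∙ b ∙ h) e∉ a b
        (subst (_∈ set H) (solve v2 (((v0 ⊕ v1) ⊕ v2) ⊕ ⊝ (v0 ⊕ v1)) (a ∷ b ∷ h ∷ []) refl) h∈)
        a b (∈∩⁺ a∈ (self a)) (∈∩⁺ b∈ (self b))

      open X using (X; H₁)

      -- Passing from `(C, H)` to `(C ∪ X, H₁)` replaces |C| + |H| by |C| + |X| + |H₁|. By the
      -- hypothesis, `U + H₁` has at least |H| - |X| - |H₁| fewer elements than `U + H` in the coset
      -- `H + c`, exactly the difference.
      one-block : ∀ {c} → c ∈ U → card ((U ⊞ set H₁) ∩ (set H ⊹ c)) ≤ card X + card (set H₁) →
                  card A + card B ≤ card Z + card (set (stab Z))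
      one-block {c} c∈ le = descend {C ∪ X} {H₁} record
        { stable = λ i j → [ (λ k → ∈∪ˡ (stable k (X.H₁⊆ j))) , (λ k → ∈∪ʳ {X = C} (stab-stable X k j)) ]′ (∈∪⁻ {X = C} i)
        ; sub = λ i → [ sub , X.X⊆ ]′ (∈∪⁻ {X = C} i)
        ; inhabited = ∈∪ˡ inhabited
        ; bound = subst (λ k → card (A ∩ B) + card (U ⊞ set H₁) ≤ k + card (set H₁)) (sym (card-disjoint C X X.C-disjoint))
            (≤-by 0 (+-mono-≤ bound (grow {H} {H₁} X.H₁⊆ (coset⊆ {H} c∈) le))
              (trans (arith (card (A ∩ B)) (card (U ⊞ set H₁)) (card C) (card (set H)) (card (U ⊞ set H)) (card X) (card (set H₁)))
                (cong (λ k → (card C + card X) + card (set H₁) + (card (A ∩ B) + card (U ⊞ set H) + (card (U ⊞ set H₁) + k))) (sym (card-⊹ (set H) c)))))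
        } (rec X.H₁<)
        where
        arith : ∀ i u₁ c h u x h₁ → i + u₁ + (c + h + (u + (x + h₁))) + 0 ≡ (c + x) + h₁ + (i + u + (u₁ + h))
        arith = solve-∀

      meets : ∀ {J c x} → set J ⊆ set H → x ∈ (U ⊞ set J) ∩ (set H ⊹ c) →
              x ∈ (A ∩ (set H ⊹ c)) ⊞ set J ⊎ x ∈ (B ∩ (set H ⊹ c)) ⊞ set J
      meets {J} {c} J⊆ i with i₁ , i₂ ← ∈∩⁻ {X = U ⊞ set J} i with u , j , u∈ , j∈ , refl ← ∈⊞⁻ {U} i₁
        with ∈∪⁻ {X = A} u∈
      ... | inj₁ uA = inj₁ (∈⊞⁺ (∈∩⁺ uA (coset-back H (J⊆ j∈) i₂)) j∈)
      ... | inj₂ uB = inj₂ (∈⊞⁺ (∈∩⁺ uB (coset-back H (J⊆ j∈) i₂)) j∈)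

      empty⊞ : ∀ {Y J} {x} → (∀ {y} → y ∉ Y) → x ∉ Y ⊞ J
      empty⊞ {Y} n i with y , _ , j , _ ← ∈⊞⁻ {Y} i = n j

      -- The cosets `H + a` and `H + b` are distinct and each contains a part of `A` and a part of
      -- `B`; the block `X` controls only one part in each. So `Y = A₂ + B₂` is added too. It lies
      -- in the same coset of `e` as `X`; `holes` bounds their overlap, and `J` stabilizes both.
      two-blocks : ∀ {p q} → p ∈ A₂ → q ∈ B₂ → b ∙ a ⁻¹ ∉ set H → card A + card B ≤ card Z + card (set (stab Z))
      two-blocks {p} {q} p∈ q∈ distinct = descend {C ∪ (X ∪ Y)} {J} record
        { stable = λ i j → let j₁ , j₂ = ∈∩⁻ {X = set H₁} j in
            [ (λ k → ∈∪ˡ (stable k (X.H₁⊆ j₁)))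
            , (λ k → ∈∪ʳ {X = C} ([ (λ l → ∈∪ˡ (stab-stable X l j₁)) , (λ l → ∈∪ʳ {X = X} (stab-stable Y l j₂)) ]′ (∈∪⁻ {X = X} k))) ]′ (∈∪⁻ {X = C} i)
        ; sub = λ i → [ sub , (λ k → [ X.X⊆ , Y.X⊆ ]′ (∈∪⁻ {X = X} k)) ]′ (∈∪⁻ {X = C} i)
        ; inhabited = ∈∪ˡ inhabited
        ; bound = subst (λ k → card (A ∩ B) + card (U ⊞ set J) ≤ k + card (set J))
            (sym (card-disjoint C (X ∪ Y) λ i j → [ X.C-disjoint i , Y.C-disjoint i ]′ (∈∪⁻ {X = X} j)))
            (final {card (X ∪ Y)} {card (X ∩ Y)} {card X} {card Y} {card (set H₁)} {card (set H₂)} {card (set H)} {card (set J)}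
               {card (A ∩ B)} {card (U ⊞ set H)} {card (U ⊞ set J)} {card C}
               {card (A₁ ⊞ set H₁)} {card (B₁ ⊞ set H₁)} {card (A₂ ⊞ set H₂)} {card (B₂ ⊞ set H₂)}
               (card-∪∩ X Y) holes growth bound X.bound Y.bound)
        } (rec (≤-trans (s≤s (card-mono {set J} {set H₁} (λ i → proj₁ (∈∩⁻ {X = set H₁} i)))) X.H₁<))
        where
        module Y = CosetBlock A B C H sub stable point inhabited ih (a ∙ b ∙ h) e∉ b a
          (subst (_∈ set H) (solve v2 (((v0 ⊕ v1) ⊕ v2) ⊕ ⊝ (v1 ⊕ v0)) (a ∷ b ∷ h ∷ []) refl) h∈)
          p q p∈ q∈
        open Y using () renaming (X to Y; H₁ to H₂)

        J : Sub
        J = H₁ ⊓ₛ H₂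

        J⊆₁ : set J ⊆ set H₁
        J⊆₁ i = proj₁ (∈∩⁻ {X = set H₁} i)

        J⊆₂ : set J ⊆ set H₂
        J⊆₂ i = proj₂ (∈∩⁻ {X = set H₁} i)

        E₁ E₂ D : Subset
        E₁ = set H₁ ⊹ (a ∙ b ∙ h)
        E₂ = set H₂ ⊹ (a ∙ b ∙ h)
        D = (set H ⊹ a) ∪ (set H ⊹ b)

        -- Within the coset `H + e`, the set `X ∩ Y` avoids both `H₁ + e` and `H₂ + e`, and these
        -- two meet exactly in `J + e`.
        holes : card (X ∩ Y) + (card (set H₁) + card (set H₂)) ≤ card (set H) + card (set J)
        holes = begin
          card (X ∩ Y) + (card (set H₁) + card (set H₂)) ≡⟨ cong₂ (λ s t → card (X ∩ Y) + (s + t)) (card-⊹ (set H₁) _) (card-⊹ (set H₂) _) ⟨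
          card (X ∩ Y) + (card E₁ + card E₂)             ≡⟨ cong (card (X ∩ Y) +_) (card-∪∩ E₁ E₂) ⟨
          card (X ∩ Y) + (card (E₁ ∪ E₂) + card (E₁ ∩ E₂)) ≡⟨ +-assoc (card (X ∩ Y)) _ _ ⟨
          card (X ∩ Y) + card (E₁ ∪ E₂) + card (E₁ ∩ E₂)
            ≤⟨ +-mono-≤ (card-disjoint-≤ (X ∩ Y) (E₁ ∪ E₂) (set H ⊹ (a ∙ b ∙ h))
                 (λ i j → [ (λ k → X.e-disjoint k (proj₁ (∈∩⁻ {X = X} i))) , (λ k → Y.e-disjoint k (proj₂ (∈∩⁻ {X = X} i))) ]′ (∈∪⁻ {X = E₁} j))
                 (λ i → ∈⊹⁺′ ((X.X-coset (proj₁ (∈∩⁻ {X = X} i)))))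
                 (λ j → [ (λ k → ∈⊹⁺′ ((X.H₁⊆ (∈⊹⁻ {set H₁} k)))) , (λ k → ∈⊹⁺′ ((Y.H₁⊆ (∈⊹⁻ {set H₂} k)))) ]′ (∈∪⁻ {X = E₁} j)))
               (≤-trans (card-mono {Y = set J ⊹ (a ∙ b ∙ h)} λ i → let i₁ , i₂ = ∈∩⁻ {X = E₁} i in
                   ∈⊹⁺′ (∈∩⁺ (∈⊹⁻ {set H₁} i₁) (∈⊹⁻ {set H₂} i₂)))
                 (≤-reflexive (card-⊹ (set J) _))) ⟩
          card (set H ⊹ (a ∙ b ∙ h)) + card (set J) ≡⟨ cong (_+ card (set J)) (card-⊹ (set H) _) ⟩
          card (set H) + card (set J) ∎
          where open ≤-Reasoning

        card-D : card D ≡ card (set H) + card (set H)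
        card-D = trans (card-disjoint (set H ⊹ a) (set H ⊹ b) (λ {x} i j → distinct (subst (_∈ set H)
            (solve ((v0 ⊕ ⊝ v1) ⊕ ⊝ (v0 ⊕ ⊝ v2)) (v2 ⊕ ⊝ v1) (x ∷ a ∷ b ∷ []) refl)
            (∙∈ H (∈⊹⁻ {set H} i) (⁻¹∈ H (∈⊹⁻ {set H} j))))))
          (cong₂ _+_ (card-⊹ (set H) a) (card-⊹ (set H) b))

        growth : card (U ⊞ set J) + (card (set H) + card (set H)) ≤ card (U ⊞ set H) +
          ((card (A₁ ⊞ set H₁) + card (B₂ ⊞ set H₂)) + (card (A₂ ⊞ set H₂) + card (B₁ ⊞ set H₁)))
        growth = subst (λ k → card (U ⊞ set J) + k ≤ card (U ⊞ set H) +
            ((card (A₁ ⊞ set H₁) + card (B₂ ⊞ set H₂)) + (card (A₂ ⊞ set H₂) + card (B₁ ⊞ set H₁)))) card-D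
          (grow {H} {J} (λ i → X.H₁⊆ (J⊆₁ i)) (λ i → [ coset⊆ {H} (∈∪ˡ a∈) , coset⊆ {H} (∈∪ʳ {X = A} b∈) ]′ (∈∪⁻ {X = set H ⊹ a} i))
            (≤-trans (card-mono {Y = (A₁ ⊞ set H₁ ∪ B₂ ⊞ set H₂) ∪ (A₂ ⊞ set H₂ ∪ B₁ ⊞ set H₁)} split)
              (≤-trans (card-∪≤ (A₁ ⊞ set H₁ ∪ B₂ ⊞ set H₂) (A₂ ⊞ set H₂ ∪ B₁ ⊞ set H₁))
                (+-mono-≤ (card-∪≤ (A₁ ⊞ set H₁) (B₂ ⊞ set H₂)) (card-∪≤ (A₂ ⊞ set H₂) (B₁ ⊞ set H₁))))))
          where
          split : (U ⊞ set J) ∩ D ⊆ (A₁ ⊞ set H₁ ∪ B₂ ⊞ set H₂) ∪ (A₂ ⊞ set H₂ ∪ B₁ ⊞ set H₁)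
          split i with i₁ , i₂ ← ∈∩⁻ {X = U ⊞ set J} i with ∈∪⁻ {X = set H ⊹ a} i₂
          ... | inj₁ k = ∈∪ˡ ([ (λ l → ∈∪ˡ (⊞-mono {A₁} {A₁} {set J} {set H₁} (λ t → t) J⊆₁ l))
                              , (λ l → ∈∪ʳ {X = A₁ ⊞ set H₁} (⊞-mono {B₂} {B₂} {set J} {set H₂} (λ t → t) J⊆₂ l)) ]′
                              (meets {J} (λ j → X.H₁⊆ (J⊆₁ j)) (∈∩⁺ i₁ k)))
          ... | inj₂ k = ∈∪ʳ {X = A₁ ⊞ set H₁ ∪ B₂ ⊞ set H₂}
                             ([ (λ l → ∈∪ˡ (⊞-mono {A₂} {A₂} {set J} {set H₂} (λ t → t) J⊆₂ l))
                              , (λ l → ∈∪ʳ {X = A₂ ⊞ set H₂} (⊞-mono {B₁} {B₁} {set J} {set H₁} (λ t → t) J⊆₁ l)) ]′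
                              (meets {J} (λ j → X.H₁⊆ (J⊆₁ j)) (∈∩⁺ i₁ k)))

        final : ∀ {u n x y h₁ h₂ h j i uH uJ c a₁ b₁ a₂ b₂} → u + n ≡ x + y → n + (h₁ + h₂) ≤ h + j →
                uJ + (h + h) ≤ uH + ((a₁ + b₂) + (a₂ + b₁)) → i + uH ≤ c + h → a₁ + b₁ ≤ x + h₁ → a₂ + b₂ ≤ y + h₂ →
                i + uJ ≤ (c + u) + j
        final {u} {n} {x} {y} {h₁} {h₂} {h} {j} {i} {uH} {uJ} {c} {a₁} {b₁} {a₂} {b₂} e p q r s t =
          ≤-by 0 (+-mono-≤ r (begin
            uJ + (h + h)                                ≤⟨ q ⟩
            uH + ((a₁ + b₂) + (a₂ + b₁))                ≡⟨ cong (uH +_) (regroup₁ a₁ b₂ a₂ b₁) ⟩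
            uH + ((a₁ + b₁) + (a₂ + b₂))                ≤⟨ +-monoʳ-≤ uH (+-mono-≤ s t) ⟩
            uH + ((x + h₁) + (y + h₂))                  ≡⟨ cong (uH +_) (regroup₂ x h₁ y h₂) ⟩
            uH + ((x + y) + (h₁ + h₂))                  ≡⟨ cong (λ k → uH + (k + (h₁ + h₂))) e ⟨
            uH + ((u + n) + (h₁ + h₂))                  ≡⟨ cong (uH +_) (+-assoc u n _) ⟩
            uH + (u + (n + (h₁ + h₂)))                  ≤⟨ +-monoʳ-≤ uH (+-monoʳ-≤ u p) ⟩
            uH + (u + (h + j)) ∎))
            (arith u h j i uH uJ c)
          where
          open ≤-Reasoning
          regroup₁ : ∀ a b c d → (a + b) + (c + d) ≡ (a + d) + (c + b)
          regroup₁ = solve-∀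
          regroup₂ : ∀ a b c d → (a + b) + (c + d) ≡ (a + c) + (b + d)
          regroup₂ = solve-∀
          arith : ∀ u h j i uH uJ c → i + uJ + (c + h + (uH + (u + (h + j)))) + 0 ≡ (c + u) + j + (i + uH + (uJ + (h + h)))
          arith = solve-∀

      cases : card A + card B ≤ card Z + card (set (stab Z))
      cases with nonempty? A₂ | nonempty? B₂ | (b ∙ a ⁻¹) ∈? set H
      ... | inj₂ n | _ | _ = one-block (∈∪ʳ {X = A} b∈) (≤-trans
        (card-mono {Y = B₁ ⊞ set H₁} λ i → [ (λ k → ⊥-elim (empty⊞ n k)) , (λ k → k) ]′ (meets {H₁} X.H₁⊆ i))
        (≤-trans (m≤n+m _ _) X.bound))
      ... | inj₁ _ | inj₂ n | _ = one-block (∈∪ˡ a∈) (≤-trans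
        (card-mono {Y = A₁ ⊞ set H₁} λ i → [ (λ k → k) , (λ k → ⊥-elim (empty⊞ n k)) ]′ (meets {H₁} X.H₁⊆ i))
        (≤-trans (m≤m+n _ _) X.bound))
      ... | inj₁ _ | inj₁ _ | yes same = one-block (∈∪ˡ a∈) (≤-trans
        (card-mono {Y = A₁ ⊞ set H₁ ∪ B₁ ⊞ set H₁} λ i → [ ∈∪ˡ , (λ k → ∈∪ʳ {X = A₁ ⊞ set H₁}
            (⊞-mono {B₂} {B₁} {set H₁} {set H₁} (λ {x} l → let l₁ , l₂ = ∈∩⁻ {X = B} l in ∈∩⁺ l₁ (∈⊹⁺′ ((subst (_∈ set H)
               (solve ((v0 ⊕ ⊝ v1) ⊕ ⊝ (v2 ⊕ ⊝ v1)) (v0 ⊕ ⊝ v2) (x ∷ a ∷ b ∷ []) refl)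
               (∙∈ H (∈⊹⁻ {set H} l₂) (⁻¹∈ H same)))))) (λ t → t) k)) ]′ (meets {H₁} X.H₁⊆ i))
        (≤-trans (card-∪≤ (A₁ ⊞ set H₁) (B₁ ⊞ set H₁)) X.bound))
      ... | inj₁ (_ , p∈) | inj₁ (_ , q∈) | no distinct = two-blocks p∈ q∈ distinct

  stab-mono : ∀ {X Y} → X ⊆ Y → Y ⊆ X → set (stab X) ⊆ set (stab Y)
  stab-mono {X} {Y} s t i = ∈stab⁺ λ j → s (stab-stable X (t j) i)

  ⊞-⊹ : ∀ {A B t} → A ⊞ (B ⊹ t) ⊆ (A ⊞ B) ⊹ t
  ⊞-⊹ {A} {B} {t} i with x , y , x∈ , y∈ , refl ← ∈⊞⁻ {A} i with z , z∈ , refl ← ∈⊹⁻′ {B} y∈ =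
    subst (_∈ (A ⊞ B) ⊹ t) (assoc x z t) (∈⊹⁺ (∈⊞⁺ x∈ z∈))

  ⊹-⊞ : ∀ {A B t} → (A ⊞ B) ⊹ t ⊆ A ⊞ (B ⊹ t)
  ⊹-⊞ {A} {B} {t} i with z , z∈ , refl ← ∈⊹⁻′ {A ⊞ B} i with x , y , x∈ , y∈ , refl ← ∈⊞⁻ {A} z∈ =
    subst (_∈ A ⊞ (B ⊹ t)) (sym (assoc x y t)) (∈⊞⁺ x∈ (∈⊹⁺ y∈))

  card-cong : ∀ {X Y} → X ⊆ Y → Y ⊆ X → card X ≡ card Y
  card-cong s t = ≤-antisym (card-mono s) (card-mono t)

  -- If `A` lies in one coset of the stabilizer K, then |A| ≤ |K| and |B| ≤ |A + B| suffice.
  -- Otherwise `B` is translated so that `A ∩ B′` is nonempty and smaller than `A`. The pair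
  -- `A ∩ B′`, `A ∪ B′` has the same total size and its sumset `C₀` lies in `A + B′`. If `C₀` is
  -- smaller, `ih` makes it the first convergent; if it is everything, the induction on |A|
  -- continues with this pair.
  kneser-stable : ∀ n → (∀ P Q {p q} → p ∈ P → q ∈ Q → card (P ⊞ Q) < n → KneserBound P Q) →
    ∀ A B {a b} → a ∈ A → b ∈ B → card (A ⊞ B) ≤ n → Stable A (stab (A ⊞ B)) → Stable B (stab (A ⊞ B)) →
    Acc _<_ (card A) → card A + card B ≤ card (A ⊞ B) + card (set (stab (A ⊞ B)))
  kneser-stable n ih A B {a} a∈ b∈ le A-stable B-stable (acc rec) with ⊆? A (set (stab (A ⊞ B)) ⊹ a)
  ... | inj₁ s = begin
    card A + card B                               ≤⟨ +-mono-≤ (card-mono s) (card-mono {B} {(A ⊞ B) ⊹ a ⁻¹} λ {y} i →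
                                                       ∈⊹⁺′ (subst (_∈ A ⊞ B) (solve (v0 ⊕ v1) (v1 ⊕ ⊝ (⊝ v0)) (a ∷ y ∷ []) refl) (∈⊞⁺ a∈ i))) ⟩
    card (K ⊹ a) + card ((A ⊞ B) ⊹ a ⁻¹)          ≡⟨ cong₂ _+_ (card-⊹ K a) (card-⊹ (A ⊞ B) _) ⟩
    card K + card (A ⊞ B)                         ≡⟨ +-comm (card K) _ ⟩
    card (A ⊞ B) + card K ∎
    where
    open ≤-Reasoning
    K : Subset
    K = set (stab (A ⊞ B))
  ... | inj₂ (a′ , a′∈ , a′∉) with ⊆? (B ⊹ (a′ ∙ a ⁻¹)) B
  -- If `a′ - a` moved `B` into itself, it would stabilize `A + B`, and `a′` would lie in the coset
  -- of `a` after all.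
  ...   | inj₁ s = ⊥-elim (a′∉ (∈⊹⁺′ (∈stab⁺ λ i → moved i)))
    where
    moved : ∀ {z} → z ∈ A ⊞ B → z ∙ (a′ ∙ a ⁻¹) ∈ A ⊞ B
    moved i with x , y , x∈ , y∈ , refl ← ∈⊞⁻ {A} i = subst (_∈ A ⊞ B) (sym (assoc x y _)) (∈⊞⁺ x∈ (s (∈⊹⁺ y∈)))
  ...   | inj₂ (c , c∈ , c∉) with b , b∈′ , refl ← ∈⊹⁻′ {B} c∈ = ≤-trans (≤-reflexive (cong (card A +_) (sym (card-⊹ B t))))
          (≤-trans bound (+-mono-≤ (≤-reflexive Z′≡) (card-mono stab⊆)))
    where
    -- This shift sends `b` to `a`, so `a` lies in `B′`; and `a′` does not, because `b + a′ - a` is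
    -- outside `B`.
    t : G
    t = a ∙ b ⁻¹

    B′ A′ U C₀ Z′ : Subset
    B′ = B ⊹ t
    A′ = A ∩ B′
    U = A ∪ B′
    C₀ = A′ ⊞ U
    Z′ = A ⊞ B′

    a∈B′ : a ∈ B′
    a∈B′ = ∈⊹⁺′ (subst (_∈ B) (solve v1 (v0 ⊕ ⊝ (v0 ⊕ ⊝ v1)) (a ∷ b ∷ []) refl) b∈′)

    a′∉A′ : a′ ∉ A′
    a′∉A′ i = c∉ (subst (_∈ B) (solve (v2 ⊕ ⊝ (v0 ⊕ ⊝ v1)) (v1 ⊕ (v2 ⊕ ⊝ v0)) (a ∷ b ∷ a′ ∷ []) refl)
      (∈⊹⁻ {B} (proj₂ (∈∩⁻ {X = A} i))))

    Z′≡ : card Z′ ≡ card (A ⊞ B)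
    Z′≡ = trans (card-cong (⊞-⊹ {A} {B}) (⊹-⊞ {A} {B})) (card-⊹ (A ⊞ B) t)

    stab⊆ : set (stab Z′) ⊆ set (stab (A ⊞ B))
    stab⊆ {g} i = ∈stab⁺ λ {z} j → subst (_∈ A ⊞ B) (solve (((v0 ⊕ v1) ⊕ v2) ⊕ ⊝ v1) (v0 ⊕ v2) (z ∷ t ∷ g ∷ []) refl)
      (∈⊹⁻ {A ⊞ B} (⊞-⊹ {A} {B} (stab-stable Z′ (⊹-⊞ {A} {B} (∈⊹⁺ j)) i)))

    C₀⊆ : C₀ ⊆ Z′
    C₀⊆ i with x , y , x∈ , y∈ , refl ← ∈⊞⁻ {A′} i with x₁ , x₂ ← ∈∩⁻ {X = A} x∈ with ∈∪⁻ {X = A} y∈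
    ... | inj₁ k = subst (_∈ Z′) (comm y x) (∈⊞⁺ k x₂)
    ... | inj₂ k = ∈⊞⁺ x₁ k

    A-stable′ : Stable A (stab Z′)
    A-stable′ i j = A-stable i (stab⊆ j)

    B-stable′ : Stable B′ (stab Z′)
    B-stable′ {x} {h} i j = ∈⊹⁺′ (subst (_∈ B) (solve ((v0 ⊕ ⊝ v1) ⊕ v2) ((v0 ⊕ v2) ⊕ ⊝ v1) (x ∷ t ∷ h ∷ []) refl)
      (B-stable (∈⊹⁻ {B} i) (stab⊆ j)))

    bound : card A + card B′ ≤ card Z′ + card (set (stab Z′))
    bound with card C₀ <? card Z′
    ... | yes C₀< = descend {C₀} {stab C₀} record
          { stable = λ i j → stab-stable C₀ i j
          ; sub = C₀⊆
          ; inhabited = ∈⊞⁺ (∈∩⁺ a∈ a∈B′) (∈∪ˡ {Y = B′} a∈)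
          ; bound = ≤-trans (+-monoˡ-≤ _ (card-mono (⊆⊞ (ε∈ (stab C₀)))))
              (ih A′ U (∈∩⁺ a∈ a∈B′) (∈∪ˡ {Y = B′} a∈) (≤-trans C₀< (≤-trans (≤-reflexive Z′≡) le)))
          } (<-wellFounded _)
      where open Descent A B′ (λ P Q p q lt → ih P Q p q (≤-trans lt (≤-trans (≤-reflexive Z′≡) le))) using (descend)
    ... | no C₀≮ = begin
      card A + card B′                    ≡⟨ card-∪∩ A B′ ⟨
      card U + card A′                    ≡⟨ +-comm (card U) _ ⟩
      card A′ + card U                    ≤⟨ kneser-stable n ih A′ U (∈∩⁺ a∈ a∈B′) (∈∪ˡ {Y = B′} a∈)
                                               (≤-trans (card-mono C₀⊆) (≤-trans (≤-reflexive Z′≡) le))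
                                               (λ i j → let i₁ , i₂ = ∈∩⁻ {X = A} i in ∈∩⁺ (A-stable′ i₁ (stab₀⊆ j)) (B-stable′ i₂ (stab₀⊆ j)))
                                               (λ i j → [ (λ k → ∈∪ˡ (A-stable′ k (stab₀⊆ j))) , (λ k → ∈∪ʳ {X = A} (B-stable′ k (stab₀⊆ j))) ]′ (∈∪⁻ {X = A} i))
                                               (rec (card-strict {A′} (λ i → proj₁ (∈∩⁻ {X = A} i)) a′∈ a′∉A′)) ⟩
      card C₀ + card (set (stab C₀))      ≤⟨ +-mono-≤ (card-mono C₀⊆) (card-mono stab₀⊆) ⟩
      card Z′ + card (set (stab Z′)) ∎
      where
      open ≤-Reasoning
      stab₀⊆ : set (stab C₀) ⊆ set (stab Z′)
      stab₀⊆ = stab-mono C₀⊆ (card-⊆-≥ C₀⊆ (≮⇒≥ C₀≮))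

  -- Adding the stabilizer of `X + Y` to each summand leaves the sumset and its stabilizer unchanged
  -- and makes both summands stable, as `kneser-stable` requires.
  kneser-acc : ∀ X Y {x y} → x ∈ X → y ∈ Y → Acc _<_ (card (X ⊞ Y)) → KneserBound X Y
  kneser-acc X Y x∈ y∈ (acc rec) = ≤-trans
    (kneser-stable (card (X ⊞ Y)) (λ P Q p q lt → kneser-acc P Q p q (rec lt)) A B
      (⊆⊞ (ε∈ K) x∈) (⊆⊞ (ε∈ K) y∈) (card-mono Z⊆)
      (λ i j → ⊞-stable X K i (stab-mono Z⊆ Z⊇ j)) (λ i j → ⊞-stable Y K i (stab-mono Z⊆ Z⊇ j)) (<-wellFounded _))
    (+-mono-≤ (card-mono Z⊆) (card-mono (stab-mono Z⊆ Z⊇)))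
    where
    K : Sub
    K = stab (X ⊞ Y)
    A B : Subset
    A = X ⊞ set K
    B = Y ⊞ set K
    Z⊇ : X ⊞ Y ⊆ A ⊞ B
    Z⊇ = ⊞-mono (⊆⊞ (ε∈ K)) (⊆⊞ (ε∈ K))
    Z⊆ : A ⊞ B ⊆ X ⊞ Y
    Z⊆ i with x , y , x∈ , y∈ , refl ← ∈⊞⁻ {A} i
      with x′ , k , x′∈ , k∈ , refl ← ∈⊞⁻ {X} x∈ with y′ , l , y′∈ , l∈ , refl ← ∈⊞⁻ {Y} y∈ =
      subst (_∈ X ⊞ Y) (solve ((v0 ⊕ v2) ⊕ (v1 ⊕ v3)) ((v0 ⊕ v1) ⊕ (v2 ⊕ v3)) (x′ ∷ k ∷ y′ ∷ l ∷ []) refl)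
        (stab-stable (X ⊞ Y) (∈⊞⁺ x′∈ y′∈) (∙∈ K k∈ l∈))

  kneser : ∀ X Y {x y} → x ∈ X → y ∈ Y → KneserBound X Y
  kneser X Y x∈ y∈ = kneser-acc X Y x∈ y∈ (<-wellFounded _)

-- Counting the terms of a list that satisfy a predicate.

count : ∀ {A : Set} → (A → Bool) → List A → ℕ
count P S = length (filterᵇ P S)

split-↭ : ∀ {A : Set} (P : A → Bool) S → S ↭ filterᵇ P S ++ filterᵇ (not ∘ P) S
split-↭ P [] = ↭-refl
split-↭ P (x ∷ S) with P x
... | true = prep x (split-↭ P S)
... | false = ↭-trans (prep x (split-↭ P S)) (↭-sym (shift x (filterᵇ P S) _))

count-not : ∀ {A : Set} (P : A → Bool) S → count P S + count (not ∘ P) S ≡ length S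
count-not P [] = refl
count-not P (x ∷ S) with P x
... | true = cong suc (count-not P S)
... | false = trans (+-suc _ _) (cong suc (count-not P S))

count-↭ : ∀ {A : Set} (P : A → Bool) {S S′} → S ↭ S′ → count P S ≡ count P S′
count-↭ P p = ↭-length (filter-↭ (T? ∘ P) p)

count-++ : ∀ {A : Set} (P : A → Bool) S S′ → count P (S ++ S′) ≡ count P S + count P S′
count-++ P [] S′ = refl
count-++ P (x ∷ S) S′ with P x
... | true = cong suc (count-++ P S S′)
... | false = count-++ P S S′

count-mono : ∀ {A : Set} (P Q : A → Bool) → (∀ {x} → P x ≡ true → Q x ≡ true) → ∀ S → count P S ≤ count Q S
count-mono P Q le [] = z≤n
count-mono P Q le (x ∷ S) with P x in eq | Q x in eq′
... | true | true = s≤s (count-mono P Q le S)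
... | true | false with () ← trans (sym eq′) (le eq)
... | false | true = m≤n⇒m≤1+n (count-mono P Q le S)
... | false | false = count-mono P Q le S

count-all : ∀ {A : Set} (P : A → Bool) S → (∀ {x} → x ∈ₗ S → P x ≡ true) → count P S ≡ length S
count-all P [] h = refl
count-all P (x ∷ S) h with P x in eq
... | true = cong suc (count-all P S (h ∘ there))
... | false with () ← trans (sym eq) (h (here refl))

count-filter-≤ : ∀ {A : Set} (P Q : A → Bool) S → count P (filterᵇ Q S) ≤ count P S
count-filter-≤ P Q [] = z≤n
count-filter-≤ P Q (x ∷ S) with Q x
... | true with P x
...   | true = s≤s (count-filter-≤ P Q S)
...   | false = count-filter-≤ P Q S
count-filter-≤ P Q (x ∷ S) | false with P x
...   | true = m≤n⇒m≤1+n (count-filter-≤ P Q S)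
...   | false = count-filter-≤ P Q S

filterᵇ-sound : ∀ {A : Set} (P : A → Bool) S {x} → x ∈ₗ filterᵇ P S → x ∈ₗ S × P x ≡ true
filterᵇ-sound P (y ∷ S) i with P y in eq
filterᵇ-sound P (y ∷ S) (here refl) | true = here refl , eq
filterᵇ-sound P (y ∷ S) (there i) | true = let a , b = filterᵇ-sound P S i in there a , b
filterᵇ-sound P (y ∷ S) i | false = let a , b = filterᵇ-sound P S i in there a , b

-- Sets of subset sums, Scherk's theorem, and growth along block decompositions.

module SubsetSums (𝔾 : FiniteAbelianGroup) where
  open Subsets 𝔾
  open KneserTheorem 𝔾

  -- These are Σ₀ and Σ. A subsequence that uses `x` may be empty elsewhere, so both recursions
  -- translate `sums S`.
  sums sums⁺ : List G → Subset
  sums [] = ⟪ _≟ ε ⟫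
  sums (x ∷ S) = sums S ∪ (sums S ⊹ x)
  sums⁺ [] = ∅
  sums⁺ (x ∷ S) = sums⁺ S ∪ (sums S ⊹ x)

  σ : List G → G
  σ = foldr _∙_ ε

  ε∈sums : ∀ S → ε ∈ sums S
  ε∈sums [] = ∈⟪⟫⁺ (_≟ ε) refl
  ε∈sums (x ∷ S) = ∈∪ˡ (ε∈sums S)

  sums-take : ∀ {x S g} → g ∈ sums S → g ∙ x ∈ sums (x ∷ S)
  sums-take {x} {S} i = ∈∪ʳ {X = sums S} (∈⊹⁺ i)

  sums-single : ∀ {x} → x ∈ sums (x ∷ [])
  sums-single {x} = subst (_∈ sums (x ∷ [])) (identityˡ x) (sums-take {x} {[]} (ε∈sums []))

  sums-∷⁻ : ∀ {x S g} → g ∈ sums (x ∷ S) → g ∈ sums S ⊎ ∃ λ h → h ∈ sums S × g ≡ h ∙ x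
  sums-∷⁻ {x} {S} i with ∈∪⁻ {X = sums S} i
  ... | inj₁ j = inj₁ j
  ... | inj₂ j = inj₂ (∈⊹⁻′ {sums S} j)

  sums⁺-∷⁻ : ∀ {x S g} → g ∈ sums⁺ (x ∷ S) → g ∈ sums⁺ S ⊎ ∃ λ h → h ∈ sums S × g ≡ h ∙ x
  sums⁺-∷⁻ {x} {S} i with ∈∪⁻ {X = sums⁺ S} i
  ... | inj₁ j = inj₁ j
  ... | inj₂ j = inj₂ (∈⊹⁻′ {sums S} j)

  sums⁺-take : ∀ {x S g} → g ∈ sums S → g ∙ x ∈ sums⁺ (x ∷ S)
  sums⁺-take {x} {S} i = ∈∪ʳ {X = sums⁺ S} (∈⊹⁺ i)

  sums⇒sums⁺ : ∀ S {g} → g ∈ sums S → g ≢ ε → g ∈ sums⁺ S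
  sums⇒sums⁺ [] i n = ⊥-elim (n (∈⟪⟫⁻ (_≟ ε) i))
  sums⇒sums⁺ (x ∷ S) i n with sums-∷⁻ {x} {S} i
  ... | inj₁ j = ∈∪ˡ (sums⇒sums⁺ S j n)
  ... | inj₂ (h , j , refl) = sums⁺-take {x} {S} j

  private
    twist : ∀ a x b → (a ∙ x) ∙ b ≡ (a ∙ b) ∙ x
    twist a x b = solve ((v0 ⊕ v1) ⊕ v2) ((v0 ⊕ v2) ⊕ v1) (a ∷ x ∷ b ∷ []) refl

  sums-++⁺ : ∀ S {T a b} → a ∈ sums S → b ∈ sums T → a ∙ b ∈ sums (S ++ T)
  sums-++⁺ [] {T} {a} {b} i j = subst (_∈ sums T) (sym (trans (cong (_∙ b) (∈⟪⟫⁻ (_≟ ε) i)) (identityˡ b))) j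
  sums-++⁺ (x ∷ S) {T} i j with sums-∷⁻ {x} {S} i
  ... | inj₁ k = ∈∪ˡ (sums-++⁺ S k j)
  ... | inj₂ (h , k , refl) = subst (_∈ sums (x ∷ S ++ T)) (sym (twist h x _)) (sums-take {x} {S ++ T} (sums-++⁺ S k j))

  sums⁺-++⁺ : ∀ S {T a b} → a ∈ sums⁺ S → b ∈ sums T → a ∙ b ∈ sums⁺ (S ++ T)
  sums⁺-++⁺ [] (mk∈ ()) j
  sums⁺-++⁺ (x ∷ S) {T} i j with sums⁺-∷⁻ {x} {S} i
  ... | inj₁ k = ∈∪ˡ (sums⁺-++⁺ S k j)
  ... | inj₂ (h , k , refl) = subst (_∈ sums⁺ (x ∷ S ++ T)) (sym (twist h x _)) (sums⁺-take {x} {S ++ T} (sums-++⁺ S k j))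

  sums-++⁻ : ∀ S {T} → sums (S ++ T) ⊆ sums S ⊞ sums T
  sums-++⁻ [] {T} {g} i = subst (_∈ sums [] ⊞ sums T) (identityˡ g) (∈⊞⁺ (ε∈sums []) i)
  sums-++⁻ (x ∷ S) {T} i with sums-∷⁻ {x} {S ++ T} i
  ... | inj₁ j = ⊞-mono {sums S} {sums (x ∷ S)} {sums T} ∈∪ˡ (λ k → k) (sums-++⁻ S j)
  ... | inj₂ (h , j , refl) with a , b , a∈ , b∈ , refl ← ∈⊞⁻ {sums S} (sums-++⁻ S j) =
    subst (_∈ sums (x ∷ S) ⊞ sums T) (twist a x b) (∈⊞⁺ (sums-take {x} {S} a∈) b∈)

  ⊞⊆sums-++ : ∀ S {T} → sums S ⊞ sums T ⊆ sums (S ++ T)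
  ⊞⊆sums-++ S i with a , b , a∈ , b∈ , refl ← ∈⊞⁻ {sums S} i = sums-++⁺ S a∈ b∈

  sums-↭ : ∀ {S S′} → S ↭ S′ → sums S ⊆ sums S′
  sums-↭ Perm.refl i = i
  sums-↭ (prep {S} {S′} x p) i with sums-∷⁻ {x} {S} i
  ... | inj₁ j = ∈∪ˡ (sums-↭ p j)
  ... | inj₂ (h , j , refl) = sums-take {x} {S′} (sums-↭ p j)
  sums-↭ (swap {S} {S′} x y p) i with sums-∷⁻ {x} {y ∷ S} i
  ... | inj₁ j with sums-∷⁻ {y} {S} j
  ...   | inj₁ k = ∈∪ˡ (∈∪ˡ (sums-↭ p k))
  ...   | inj₂ (h , k , refl) = sums-take {y} {x ∷ S′} (∈∪ˡ (sums-↭ p k))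
  sums-↭ (swap {S} {S′} x y p) i | inj₂ (h , j , refl) with sums-∷⁻ {y} {S} j
  ...   | inj₁ k = ∈∪ˡ (sums-take {x} {S′} (sums-↭ p k))
  ...   | inj₂ (h , k , refl) = subst (_∈ sums (y ∷ x ∷ S′)) (twist h x y) (sums-take {y} {x ∷ S′} (sums-take {x} {S′} (sums-↭ p k)))
  sums-↭ (Perm.trans p q) i = sums-↭ q (sums-↭ p i)

  sums⁺-↭ : ∀ {S S′} → S ↭ S′ → sums⁺ S ⊆ sums⁺ S′
  sums⁺-↭ Perm.refl i = i
  sums⁺-↭ (prep {S} {S′} x p) i with sums⁺-∷⁻ {x} {S} i
  ... | inj₁ j = ∈∪ˡ (sums⁺-↭ p j)
  ... | inj₂ (h , j , refl) = sums⁺-take {x} {S′} (sums-↭ p j)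
  sums⁺-↭ (swap {S} {S′} x y p) i with sums⁺-∷⁻ {x} {y ∷ S} i
  ... | inj₁ j with sums⁺-∷⁻ {y} {S} j
  ...   | inj₁ k = ∈∪ˡ (∈∪ˡ (sums⁺-↭ p k))
  ...   | inj₂ (h , k , refl) = sums⁺-take {y} {x ∷ S′} (∈∪ˡ (sums-↭ p k))
  sums⁺-↭ (swap {S} {S′} x y p) i | inj₂ (h , j , refl) with sums-∷⁻ {y} {S} j
  ...   | inj₁ k = ∈∪ˡ (sums⁺-take {x} {S′} (sums-↭ p k))
  ...   | inj₂ (h , k , refl) = subst (_∈ sums⁺ (y ∷ x ∷ S′)) (twist h x y) (sums⁺-take {y} {x ∷ S′} (sums-take {x} {S′} (sums-↭ p k)))
  sums⁺-↭ (Perm.trans p q) i = sums⁺-↭ q (sums⁺-↭ p i)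

  sums-sound : ∀ S {g} → g ∈ sums S → ∃ λ T → T ⊑ S × σ T ≡ g
  sums-sound [] i = [] , ⊑[] , sym (∈⟪⟫⁻ (_≟ ε) i)
  sums-sound (x ∷ S) i with sums-∷⁻ {x} {S} i
  ... | inj₁ j = let T , s , e = sums-sound S j in T , x ⊑∷ʳ s , e
  ... | inj₂ (h , j , refl) = let T , s , e = sums-sound S j in x ∷ T , refl ⊑∷ s , trans (cong (x ∙_) e) (comm x h)

  sums⁺-sound : ∀ S {g} → g ∈ sums⁺ S → ∃ λ T → T ⊑ S × T ≢ [] × σ T ≡ g
  sums⁺-sound (x ∷ S) i with sums⁺-∷⁻ {x} {S} i
  ... | inj₁ j = let T , s , n , e = sums⁺-sound S j in T , x ⊑∷ʳ s , n , e
  ... | inj₂ (h , j , refl) = let T , s , e = sums-sound S j in x ∷ T , refl ⊑∷ s , (λ ()) , trans (cong (x ∙_) e) (comm x h)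
  sums⁺-sound [] (mk∈ ())

  sums⊆ : ∀ S (H : Sub) → (∀ {x} → x ∈ₗ S → x ∈ set H) → sums S ⊆ set H
  sums⊆ [] H all i = subst (_∈ set H) (sym (∈⟪⟫⁻ (_≟ ε) i)) (ε∈ H)
  sums⊆ (x ∷ S) H all i with sums-∷⁻ {x} {S} i
  ... | inj₁ j = sums⊆ S H (all ∘ there) j
  ... | inj₂ (h , j , refl) = ∙∈ H (sums⊆ S H (all ∘ there) j) (all (here refl))

  stab⊆self : ∀ {X} → ε ∈ X → set (stab X) ⊆ X
  stab⊆self {X} e {g} i = subst (_∈ X) (identityˡ g) (stab-stable X e i)

  stab-⊞ : ∀ {X Y} → set (stab Y) ⊆ set (stab (X ⊞ Y))
  stab-⊞ {X} {Y} {g} i = ∈stab⁺ λ j → step j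
    where
    step : ∀ {z} → z ∈ X ⊞ Y → z ∙ g ∈ X ⊞ Y
    step j with x , y , x∈ , y∈ , refl ← ∈⊞⁻ {X} j = subst (_∈ X ⊞ Y) (sym (assoc x y g)) (∈⊞⁺ x∈ (stab-stable Y y∈ i))

  stab-sums-++ : ∀ T S → set (stab (sums S)) ⊆ set (stab (sums (T ++ S)))
  stab-sums-++ T S i = stab-mono (⊞⊆sums-++ T) (sums-++⁻ T) (stab-⊞ {sums T} i)

  -- Stated for arbitrary unions of cosets, so that the induction can split off one coset at a time.
  lagrange : ∀ X H → Stable X H → Acc _<_ (card X) → ∃ λ q → card X ≡ q * card (set H)
  lagrange X H st (acc rec) with nonempty? X
  ... | inj₂ n = 0 , card-∅ n
  ... | inj₁ (x , x∈) = let q , e = lagrange Y H Y-stable (rec smaller) in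
    suc q , trans size (cong₂ _+_ (card-⊹ (set H) x) e)
    where
    Y-dec : ∀ g → Dec (g ∈ X × g ∉ set H ⊹ x)
    Y-dec g = (g ∈? X) ×-dec ¬? (g ∈? (set H ⊹ x))
    Y : Subset
    Y = ⟪ Y-dec ⟫
    Y⊆ : Y ⊆ X
    Y⊆ i = proj₁ (∈⟪⟫⁻ Y-dec i)
    coset⊆ : set H ⊹ x ⊆ X
    coset⊆ i with h , h∈ , refl ← ∈⊹⁻′ {set H} i = subst (_∈ X) (comm x h) (st x∈ h∈)
    x∈coset : x ∈ set H ⊹ x
    x∈coset = ∈⊹⁺′ (subst (_∈ set H) (sym (inverseʳ x)) (ε∈ H))
    smaller : card Y < card X
    smaller = card-strict {Y} Y⊆ x∈ (λ i → proj₂ (∈⟪⟫⁻ Y-dec i) x∈coset)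
    Y-stable : Stable Y H
    Y-stable {y} {h} i j = let a , b = ∈⟪⟫⁻ Y-dec i in ∈⟪⟫⁺ Y-dec (st a j , λ k → b (∈⊹⁺′ (subst (_∈ set H)
      (solve (((v0 ⊕ v1) ⊕ ⊝ v2) ⊕ ⊝ v1) (v0 ⊕ ⊝ v2) (y ∷ h ∷ x ∷ []) refl) (∙∈ H (∈⊹⁻ {set H} k) (⁻¹∈ H j)))))
    size : card X ≡ card (set H ⊹ x) + card Y
    size = trans (card-cong {X} {(set H ⊹ x) ∪ Y} cover (λ i → [ coset⊆ , Y⊆ ]′ (∈∪⁻ {X = set H ⊹ x} i)))
      (card-disjoint (set H ⊹ x) Y λ i j → proj₂ (∈⟪⟫⁻ Y-dec j) i)
      where
      cover : X ⊆ (set H ⊹ x) ∪ Y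
      cover {g} i with g ∈? (set H ⊹ x)
      ... | yes j = ∈∪ˡ j
      ... | no n = ∈∪ʳ {X = set H ⊹ x} (∈⟪⟫⁺ Y-dec (i , n))

  stable-gap : ∀ {X Y H g} → Stable X H → X ⊆ Y → Stable Y H → g ∈ Y → g ∉ X → card X + card (set H) ≤ card Y
  stable-gap {X} {Y} {H} {g} X-st s Y-st i n = subst (λ k → card X + k ≤ card Y) (card-⊹ (set H) g)
    (card-disjoint-≤ X (set H ⊹ g) Y
      (λ {x} a b → n (subst (_∈ X) (solve (v0 ⊕ ⊝ (v0 ⊕ ⊝ v1)) v1 (x ∷ g ∷ []) refl) (X-st a (⁻¹∈ H (∈⊹⁻ {set H} b)))))
      s inner)
    where
    inner : set H ⊹ g ⊆ Y
    inner b with h , h∈ , refl ← ∈⊹⁻′ {set H} b = subst (_∈ Y) (comm g h) (Y-st i h∈)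

  -- Let K be the stabilizer of `A + B`. As 0 lies in both sets, `A ∪ K ⊆ A + K` and likewise for
  -- `B`, so Kneser gives |A| + |B| + |K| ≤ |A + B| + |A ∩ K| + |B ∩ K|. By uniqueness, `A ∩ K` and
  -- the negative of `B ∩ K` are subsets of K that share only 0, so their sizes add up to at most
  -- |K| + 1.
  scherk : ∀ A B → ε ∈ A → ε ∈ B → (∀ {a b} → a ∈ A → b ∈ B → a ∙ b ≡ ε → a ≡ ε) →
           card A + card B ≤ card (A ⊞ B) + 1
  scherk A B εA εB unique = ≤-by {l = lhs} {r = rhs} 0 facts (arith (card A) (card B) (card (A ∪ K)) (card (B ∪ K))
      (card (A ⊞ K)) (card (B ⊞ K)) (card (A ∩ K)) (card (B ∩ K)) (card (A ⊞ B)) (card K))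
    where
    K : Subset
    K = set (stab (A ⊞ B))
    open ≤-Reasoning
    εK : ε ∈ K
    εK = ε∈ (stab (A ⊞ B))

    bound : card (A ⊞ K) + card (B ⊞ K) ≤ card (A ⊞ B) + card K
    bound = kneser A B εA εB

    K⊆ : ∀ {X} → ε ∈ X → X ∪ K ⊆ X ⊞ K
    K⊆ {X} εX i = [ ⊆⊞ εK , (λ k → subst (_∈ X ⊞ K) (identityˡ _) (∈⊞⁺ εX k)) ]′ (∈∪⁻ {X = X} i)

    inv-dec : ∀ g → Dec (g ⁻¹ ∈ B ∩ K)
    inv-dec g = (g ⁻¹) ∈? (B ∩ K)

    involutive : ∀ x → (x ⁻¹) ⁻¹ ≡ x
    involutive x = solve (⊝ (⊝ v0)) v0 (x ∷ []) refl

    invB : Subset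
    invB = ⟪ inv-dec ⟫

    meet : card (A ∩ K) + card (B ∩ K) ≤ card K + 1
    meet = begin
      card (A ∩ K) + card (B ∩ K) ≤⟨ +-monoʳ-≤ _ (card-inj _⁻¹ (λ {x} {y} e → trans (sym (involutive x)) (trans (cong _⁻¹ e) (involutive y)))
                                       (λ {x} i → ∈⟪⟫⁺ inv-dec (subst (_∈ B ∩ K) (sym (involutive x)) i))) ⟩
      card (A ∩ K) + card invB    ≡⟨ card-∪∩ (A ∩ K) invB ⟨
      card ((A ∩ K) ∪ invB) + card ((A ∩ K) ∩ invB)
        ≤⟨ +-mono-≤ (card-mono λ {x} i → [ (λ j → proj₂ (∈∩⁻ {X = A} j))
                                     , (λ j → subst (_∈ K) (involutive x) (⁻¹∈ (stab (A ⊞ B)) (proj₂ (∈∩⁻ {X = B} (∈⟪⟫⁻ inv-dec j))))) ]′ (∈∪⁻ {X = A ∩ K} i))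
             (card-≤-list {(A ∩ K) ∩ invB} (ε ∷ []) λ {x} i → let i₁ , i₂ = ∈∩⁻ {X = A ∩ K} i in
                 here (unique (proj₁ (∈∩⁻ {X = A} i₁)) (proj₁ (∈∩⁻ {X = B} (∈⟪⟫⁻ inv-dec i₂))) (inverseʳ x))) ⟩
      card K + 1 ∎

    lhs rhs : ℕ
    lhs = (card A + card K + (card B + card K)) + (card (A ∪ K) + card (B ∪ K)) + (card (A ⊞ K) + card (B ⊞ K)) + (card (A ∩ K) + card (B ∩ K))
    rhs = ((card (A ∪ K) + card (A ∩ K)) + (card (B ∪ K) + card (B ∩ K))) + (card (A ⊞ K) + card (B ⊞ K)) + (card (A ⊞ B) + card K) + (card K + 1)

    facts : lhs ≤ rhs
    facts = +-mono-≤ (+-mono-≤ (+-mono-≤ (≤-reflexive (sym (cong₂ _+_ (card-∪∩ A K) (card-∪∩ B K))))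
      (+-mono-≤ (card-mono (K⊆ εA)) (card-mono (K⊆ εB)))) bound) meet

    arith : ∀ a b u v s t i j z k → a + b + (((u + i) + (v + j)) + (s + t) + (z + k) + (k + 1)) + 0 ≡
      z + 1 + ((a + k + (b + k)) + (u + v) + (s + t) + (i + j))
    arith = solve-∀

  -- Part S n: S splits into blocks T for which Σ (|Σ₀(T)| - 1) ≥ n.
  data Part : List G → ℕ → Set where
    done : Part [] 0
    block : ∀ T {S m n} → suc m ≤ card (sums T) → Part S n → Part (T ++ S) (m + n)
    perm : ∀ {S S′ n} → S ↭ S′ → Part S n → Part S′ n

  -- With trivial stabilizer, Kneser loses only 1 per block, which is the 1 subtracted in the gain.
  -- The induction goes through because a period of Σ₀(S) is also a period of Σ₀(T ++ S).
  aperiodic-bound : ∀ {S n} → Part S n → (∀ {g} → g ∈ set (stab (sums S)) → g ≡ ε) → suc n ≤ card (sums S)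
  aperiodic-bound done ap = card-pos (ε∈sums [])
  aperiodic-bound (perm p P) ap = ≤-trans (aperiodic-bound P λ i → ap (stab-mono (sums-↭ p) (sums-↭ (↭-sym p)) i)) (card-mono (sums-↭ p))
  aperiodic-bound (block T {S} {m} {n} big P) ap = s≤s⁻¹ (begin
    suc (suc (m + n))                    ≡⟨ cong suc (+-suc m n) ⟨
    suc m + suc n                        ≤⟨ +-mono-≤ big (aperiodic-bound P λ i → ap (stab-sums-++ T S i)) ⟩
    card (sums T) + card (sums S)        ≤⟨ +-mono-≤ (card-mono (⊆⊞ (ε∈ K))) (card-mono (⊆⊞ (ε∈ K))) ⟩
    card (sums T ⊞ set K) + card (sums S ⊞ set K)  ≤⟨ kneser (sums T) (sums S) (ε∈sums T) (ε∈sums S) ⟩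
    card (sums T ⊞ sums S) + card (set K)    ≤⟨ +-mono-≤ (card-mono (⊞⊆sums-++ T)) (card-≤-list {set K} (ε ∷ []) λ i →
                                             here (ap (stab-mono (⊞⊆sums-++ T) (sums-++⁻ T) i))) ⟩
    card (sums (T ++ S)) + 1             ≡⟨ +-comm _ 1 ⟩
    suc (card (sums (T ++ S))) ∎)
    where
    open ≤-Reasoning
    K : Sub
    K = stab (sums T ⊞ sums S)

  -- Absence of zero sums supplies the uniqueness that `scherk` asks for: if a + b = 0 with a ≠ 0,
  -- the subsequence with sum a is nonempty.
  zero-sum-free-bound : ∀ {S n} → Part S n → ε ∉ sums⁺ S → suc n ≤ card (sums S)
  zero-sum-free-bound done zsf = card-pos (ε∈sums [])
  zero-sum-free-bound (perm p P) zsf = ≤-trans (zero-sum-free-bound P λ i → zsf (sums⁺-↭ p i)) (card-mono (sums-↭ p))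
  zero-sum-free-bound (block T {S} {m} {n} big P) zsf = s≤s⁻¹ (begin
    suc (suc (m + n))                    ≡⟨ cong suc (+-suc m n) ⟨
    suc m + suc n                        ≤⟨ +-mono-≤ big (zero-sum-free-bound P λ i → zsf (grow T i)) ⟩
    card (sums T) + card (sums S)        ≤⟨ scherk (sums T) (sums S) (ε∈sums T) (ε∈sums S) only ⟩
    card (sums T ⊞ sums S) + 1           ≤⟨ +-monoˡ-≤ 1 (card-mono (⊞⊆sums-++ T)) ⟩
    card (sums (T ++ S)) + 1             ≡⟨ +-comm _ 1 ⟩
    suc (card (sums (T ++ S))) ∎)
    where
    open ≤-Reasoning
    grow : ∀ T {g} → g ∈ sums⁺ S → g ∈ sums⁺ (T ++ S)
    grow [] i = i
    grow (x ∷ T) i = ∈∪ˡ (grow T i)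
    only : ∀ {a b} → a ∈ sums T → b ∈ sums S → a ∙ b ≡ ε → a ≡ ε
    only {a} i j e with a ≟ ε
    ... | yes p = p
    ... | no n = ⊥-elim (zsf (subst (_∈ sums⁺ (T ++ S)) e (sums⁺-++⁺ T (sums⇒sums⁺ T i n) j)))

  outside : Sub → List G → ℕ
  outside H = count (not ∘ set H)

  -- This is Kneser's theorem modulo `K`, carried out without a quotient group: a term `x` outside
  -- `K` becomes the union `A` of the two cosets `K` and `K + x`. The stabilizer of each partial
  -- sumset lies in `K`, so adding `A` gains at least 2|K| - |K| elements.
  singles-bound′ : ∀ S K → set (stab (sums S ⊞ set K)) ⊆ set K → card (set K) * suc (outside K S) ≤ card (sums S ⊞ set K)
  singles-bound′ [] K sub = ≤-trans (≤-reflexive (*-identityʳ _))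
    (card-mono λ {k} i → subst (_∈ sums [] ⊞ set K) (identityˡ k) (∈⊞⁺ (ε∈sums []) i))
  singles-bound′ (x ∷ S) K sub with set K x in eq | singles-bound′ S K (λ {g} i → sub (descend i))
    where
    descend : ∀ {g} → g ∈ set (stab (sums S ⊞ set K)) → g ∈ set (stab (sums (x ∷ S) ⊞ set K))
    descend {g} i = ∈stab⁺ λ j → step j
      where
      back : ∀ {s k} → s ∈ sums S → k ∈ set K → ∃₂ λ s′ k′ → s′ ∈ sums S × k′ ∈ set K × (s ∙ k) ∙ g ≡ s′ ∙ k′
      back a b = ∈⊞⁻ {sums S} (stab-stable (sums S ⊞ set K) (∈⊞⁺ a b) i)
      step : ∀ {y} → y ∈ sums (x ∷ S) ⊞ set K → y ∙ g ∈ sums (x ∷ S) ⊞ set K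
      step j with s , k , s∈ , k∈ , refl ← ∈⊞⁻ {sums (x ∷ S)} j with sums-∷⁻ {x} {S} s∈
      ... | inj₁ s∈′ with s′ , k′ , a , b , e ← back s∈′ k∈ = subst (_∈ sums (x ∷ S) ⊞ set K) (sym e) (∈⊞⁺ (∈∪ˡ a) b)
      ... | inj₂ (h , h∈ , refl) with s′ , k′ , a , b , e ← back h∈ k∈ =
        subst (_∈ sums (x ∷ S) ⊞ set K)
          (trans (twist s′ x k′) (trans (cong (_∙ x) (sym e)) (solve (((v0 ⊕ v1) ⊕ v2) ⊕ v3) (((v0 ⊕ v3) ⊕ v1) ⊕ v2) (h ∷ k ∷ g ∷ x ∷ []) refl)))
          (∈⊞⁺ (sums-take {x} {S} a) b)
  ... | true | ih = ≤-trans ih (card-mono (⊞-mono {sums S} {sums (x ∷ S)} {set K} ∈∪ˡ (λ k → k)))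
  ... | false | ih = ≤-by {l = lhs} {r = rhs} 0 facts (arith (card (set K)) (outside K S) (card (A ⊞ L)) (card (W ⊞ L))
          (card W) (card (A ⊞ W)) (card L) (card (sums (x ∷ S) ⊞ set K)))
    where
    k = card (set K)
    W A L : Subset
    W = sums S ⊞ set K
    A = set K ∪ (set K ⊹ x)
    L = set (stab (A ⊞ W))
    lhs rhs : ℕ
    lhs = k * suc (outside K S) + (card (A ⊞ L) + card (W ⊞ L)) + card L + card (A ⊞ W) + (k + k) + card W
    rhs = card W + (card (A ⊞ W) + card L) + k + card (sums (x ∷ S) ⊞ set K) + card (A ⊞ L) + card (W ⊞ L)
    AW⊆ : A ⊞ W ⊆ sums (x ∷ S) ⊞ set K
    AW⊆ i with a , w , a∈ , w∈ , refl ← ∈⊞⁻ {A} i with s , j , s∈ , j∈ , refl ← ∈⊞⁻ {sums S} w∈ with ∈∪⁻ {X = set K} a∈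
    ... | inj₁ a∈K = subst (_∈ sums (x ∷ S) ⊞ set K) (solve (v1 ⊕ (v0 ⊕ v2)) (v0 ⊕ (v1 ⊕ v2)) (a ∷ s ∷ j ∷ []) refl) (∈⊞⁺ (∈∪ˡ s∈) (∙∈ K a∈K j∈))
    ... | inj₂ a∈Kx with l , l∈ , refl ← ∈⊹⁻′ {set K} a∈Kx =
      subst (_∈ sums (x ∷ S) ⊞ set K) (solve ((v1 ⊕ v3) ⊕ (v0 ⊕ v2)) ((v0 ⊕ v3) ⊕ (v1 ⊕ v2)) (l ∷ s ∷ j ∷ x ∷ []) refl)
        (∈⊞⁺ (sums-take {x} {S} s∈) (∙∈ K l∈ j∈))
    ⊆AW : sums (x ∷ S) ⊞ set K ⊆ A ⊞ W
    ⊆AW i with s , j , s∈ , j∈ , refl ← ∈⊞⁻ {sums (x ∷ S)} i with sums-∷⁻ {x} {S} s∈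
    ... | inj₁ s∈′ = subst (_∈ A ⊞ W) (identityˡ _) (∈⊞⁺ (∈∪ˡ (ε∈ K)) (∈⊞⁺ s∈′ j∈))
    ... | inj₂ (h , h∈ , refl) = subst (_∈ A ⊞ W) (solve ((⓪ ⊕ v0) ⊕ (v1 ⊕ v2)) ((v1 ⊕ v0) ⊕ v2) (x ∷ h ∷ j ∷ []) refl)
      (∈⊞⁺ (∈∪ʳ {X = set K} (∈⊹⁺ (ε∈ K))) (∈⊞⁺ h∈ j∈))
    two : card A ≡ k + k
    two = trans (card-disjoint (set K) (set K ⊹ x) λ {g} i j → x∉ (subst (_∈ set K)
        (solve (v0 ⊕ ⊝ (v0 ⊕ ⊝ v1)) v1 (g ∷ x ∷ []) refl) (∙∈ K i (⁻¹∈ K (∈⊹⁻ {set K} j)))))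
      (cong (k +_) (card-⊹ (set K) x))
      where
      x∉ : x ∉ set K
      x∉ (mk∈ e) with () ← trans (sym eq) e
    facts : lhs ≤ rhs
    facts = +-mono-≤ (+-mono-≤ (+-mono-≤ (+-mono-≤ (+-mono-≤ ih
        (kneser A W (∈∪ˡ {Y = set K ⊹ x} (ε∈ K)) (∈⊞⁺ (ε∈sums S) (ε∈ K))))
        (card-mono λ i → sub (stab-mono AW⊆ ⊆AW i)))
        (card-mono AW⊆))
        (≤-trans (≤-reflexive (sym two)) (card-mono (⊆⊞ (ε∈ (stab (A ⊞ W)))))))
        (card-mono (⊆⊞ (ε∈ (stab (A ⊞ W)))))
    arith : ∀ k o al wl w aw l s → k * suc (suc o) + (w + (aw + l) + k + s + al + wl) + 0 ≡
      s + (k * suc o + (al + wl) + l + aw + (k + k) + w)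
    arith = solve-∀

  singles-bound : ∀ S → card (set (stab (sums S))) * suc (outside (stab (sums S)) S) ≤ card (sums S)
  singles-bound S = ≤-trans (singles-bound′ S K (stab-mono abs (⊆⊞ (ε∈ K)))) (card-mono abs)
    where
    K : Sub
    K = stab (sums S)
    abs : sums S ⊞ set K ⊆ sums S
    abs = ⊞-absorb {sums S} {K} (stab-stable (sums S))

∈⇒↭ : ∀ {A : Set} {x : A} {S} → x ∈ₗ S → ∃ λ S′ → S ↭ x ∷ S′
∈⇒↭ {x = x} i with as , bs , refl ← ∈-∃++ i = as ++ bs , shift x as bs

count-pos : ∀ {A : Set} (P : A → Bool) {x} S → x ∈ₗ S → P x ≡ true → 1 ≤ count P S
count-pos P (x ∷ S) (here refl) e rewrite e = s≤s z≤n
count-pos P (y ∷ S) (there i) e with P y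
... | true = s≤s z≤n
... | false = count-pos P S i e

count-pos⁻ : ∀ {A : Set} (P : A → Bool) S → 1 ≤ count P S → ∃ λ x → x ∈ₗ S × P x ≡ true
count-pos⁻ P (x ∷ S) le with P x in eq
... | true = x , here refl , eq
... | false = let y , i , e = count-pos⁻ P S le in y , there i , e

-- Construction of blocks: single terms, pairs, frequent terms with helpers, dissociated sets.

module BlockConstructions (𝔾 : FiniteAbelianGroup) where
  open Subsets 𝔾
  open SubsetSums 𝔾

  search : ∀ {P : G → Set} → (∀ x → Dec (P x)) → ∀ S → (∃ λ x → x ∈ₗ S × P x) ⊎ (∀ {x} → x ∈ₗ S → ¬ P x)
  search P? S with Any.any? P? S
  ... | yes a = inj₁ (find a)
  ... | no n = inj₂ λ { i p → n (Any.map (λ { refl → p }) i) }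

  is : G → Subset
  is f = ⟪ f ≟_ ⟫

  is-self : ∀ f → is f f ≡ true
  is-self f = un∈ (∈⟪⟫⁺ (f ≟_) refl)

  is⇒≡ : ∀ {f x} → is f x ≡ true → f ≡ x
  is⇒≡ {f} e = ∈⟪⟫⁻ (f ≟_) (mk∈ e)

  remove : G → List G → List G
  remove f = filterᵇ (not ∘ is f)

  filter-is : ∀ f S → filterᵇ (is f) S ≡ replicate (count (is f) S) f
  filter-is f [] = refl
  filter-is f (x ∷ S) with is f x in eq
  ... | true = cong₂ _∷_ (sym (is⇒≡ eq)) (filter-is f S)
  ... | false = filter-is f S

  length-remove : ∀ f S → count (is f) S + length (remove f S) ≡ length S
  length-remove f S = count-not (is f) S

  singles-part : ∀ {S} → (∀ {x} → x ∈ₗ S → x ≢ ε) → Part S (length S)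
  singles-part {[]} _ = done
  singles-part {x ∷ S} nz = block (x ∷ []) {S} {1} (card-≥-list {sums (x ∷ [])} {ε ∷ x ∷ []}
    (((λ e → nz (here refl) (sym e)) ∷ []) ∷ [] ∷ [])
    λ { (here refl) → ε∈sums (x ∷ []) ; (there (here refl)) → sums-single }) (singles-part (nz ∘ there))

  ∈⇒∈sums : ∀ {x S} → x ∈ₗ S → x ∈ sums S
  ∈⇒∈sums {x} {.x ∷ S} (here refl) = subst (_∈ sums (x ∷ S)) (identityˡ x) (sums-take {x} {S} (ε∈sums S))
  ∈⇒∈sums (there i) = ∈∪ˡ (∈⇒∈sums i)

  module Cyclic (e : ℕ) (1≤e : 1 ≤ e) (exponent : ∀ x → e ⋆ x ≡ ε) where

    multiples? : ∀ x g → Dec (g ∈ₗ map (_⋆ x) (upTo e))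
    multiples? x g = Any.any? (g ≟_) (map (_⋆ x) (upTo e))

    multiples : G → Subset
    multiples x = ⟪ multiples? x ⟫

    multiples⁺ : ∀ {x j} → j < e → j ⋆ x ∈ multiples x
    multiples⁺ {x} lt = ∈⟪⟫⁺ (multiples? x) (∈-map⁺ (_⋆ x) (∈-upTo⁺ lt))

    multiples⁻ : ∀ {x g} → g ∈ multiples x → ∃ λ j → j < e × g ≡ j ⋆ x
    multiples⁻ {x} i = let j , j∈ , eq = ∈-map⁻ (_⋆ x) (∈⟪⟫⁻ (multiples? x) i) in j , ∈-upTo⁻ j∈ , eq

    -- The cyclic group ⟨x⟩, taken as the stabilizer of the set of multiples so that the subgroup
    -- laws come for free. It is contained in that set because 0 is a multiple.
    cyc : G → Sub
    cyc x = stab (multiples x)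

    ∈cyc : ∀ x → x ∈ set (cyc x)
    ∈cyc x = ∈stab⁺ λ i → step i
      where
      step : ∀ {g} → g ∈ multiples x → g ∙ x ∈ multiples x
      step i with j , j<e , refl ← multiples⁻ i with suc j <? e
      ... | yes lt = subst (_∈ multiples x) (comm x (j ⋆ x)) (multiples⁺ lt)
      ... | no nlt = subst (_∈ multiples x)
        (trans (sym (exponent x)) (trans (cong (_⋆ x) (≤-antisym (≮⇒≥ nlt) j<e)) (comm x (j ⋆ x)))) (multiples⁺ 1≤e)

    cyc⊆multiples : ∀ {x} → set (cyc x) ⊆ multiples x
    cyc⊆multiples = stab⊆self (multiples⁺ 1≤e)

    card-cyc : ∀ x → card (set (cyc x)) ≤ e
    card-cyc x = ≤-trans (card-≤-list {set (cyc x)} (map (_⋆ x) (upTo e)) (λ i → ∈⟪⟫⁻ (multiples? x) (cyc⊆multiples i)))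
      (≤-reflexive (trans (length-map (_⋆ x) (upTo e)) (length-upTo e)))

    cyc-least : ∀ {x Y} → ε ∈ Y → (∀ {y} → y ∈ Y → y ∙ x ∈ Y) → set (cyc x) ⊆ Y
    cyc-least {x} {Y} εY closed i with j , _ , refl ← multiples⁻ (cyc⊆multiples i) = go j
      where
      go : ∀ j → j ⋆ x ∈ Y
      go zero = εY
      go (suc j) = subst (_∈ Y) (comm (j ⋆ x) x) (closed (go j))

    -- One more copy of `f` yields a new sum unless the sums are already closed under adding `f`; in
    -- that case they contain all of ⟨f⟩.
    replicate-sums : ∀ f m → suc m ≤ card (set (cyc f)) → suc m ≤ card (sums (replicate m f))
    replicate-sums f zero _ = card-pos (ε∈sums [])
    replicate-sums f (suc m) le with ⊆? (sums (replicate m f) ⊹ f) (sums (replicate m f))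
    ... | inj₁ s = ≤-trans le (card-mono λ i → ∈∪ˡ (cyc-least (ε∈sums (replicate m f)) (λ k → s (∈⊹⁺ k)) i))
    ... | inj₂ (y , y∈ , y∉) = ≤-trans (s≤s (replicate-sums f m (≤-trans (n≤1+n _) le)))
      (card-strict {sums (replicate m f)} {sums (f ∷ replicate m f)} ∈∪ˡ (∈∪ʳ {X = sums (replicate m f)} y∈) y∉)

    pair-part : ∀ {x y S n} → x ≢ ε → y ≢ ε → y ≢ x → y ∙ x ≢ ε → Part S n → Part (x ∷ y ∷ S) (3 + n)
    pair-part {x} {y} x≢ε y≢ε y≢x yx≢ε = block (x ∷ y ∷ [])
      (card-≥-list {sums (x ∷ y ∷ [])} {ε ∷ x ∷ y ∷ (y ∙ x) ∷ []}
        (((x≢ε ∘ sym) ∷ (y≢ε ∘ sym) ∷ (yx≢ε ∘ sym) ∷ []) ∷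
         ((y≢x ∘ sym) ∷ (λ e → y≢ε (∙-cancelʳ x y ε (trans (sym e) (sym (identityˡ x))))) ∷ []) ∷
         ((λ e → x≢ε (∙-cancelˡ y x ε (trans (sym e) (sym (identityʳ y))))) ∷ []) ∷ [] ∷ [])
        λ { (here refl) → ε∈sums (x ∷ y ∷ [])
          ; (there (here refl)) → ∈⇒∈sums {x} {x ∷ y ∷ []} (here refl)
          ; (there (there (here refl))) → ∈⇒∈sums {y} {x ∷ y ∷ []} (there (here refl))
          ; (there (there (there (here refl)))) → sums-take {x} {y ∷ []} (∈⇒∈sums {y} {y ∷ []} (here refl)) })

    -- Greedy pairing; when it stops, all remaining terms lie in the cyclic group of the first one.
    pairs-part : ∀ T → Acc _<_ (length T) → (∀ {y} → y ∈ₗ T → y ≢ ε) → (∀ x → count (set (cyc x)) T ≤ e) →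
                 ∃ λ n → Part T n × 3 * length T ≤ 2 * n + e
    pairs-part [] _ _ _ = 0 , done , z≤n
    pairs-part (x ∷ T) (acc rec) nz few with search (λ y → ¬? (y ≟ x) ×-dec ¬? ((y ∙ x) ≟ ε)) T
    ... | inj₁ (y , y∈ , y≢x , yx≢ε) with S , p ← ∈⇒↭ y∈ =
      let n , P , le = pairs-part S (rec (subst (length S <_) (cong suc (sym (↭-length p))) (s≤s (n≤1+n _))))
                         (λ i → nz (there (∈-resp-↭ (↭-sym p) (there i))))
                         (λ z → ≤-trans (≤-trans (m≤n+m _ (count (set (cyc z)) (x ∷ y ∷ [])))
                            (≤-reflexive (trans (sym (count-++ (set (cyc z)) (x ∷ y ∷ []) S)) (count-↭ (set (cyc z)) (prep x (↭-sym p)))))) (few z))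
      in 3 + n , perm (prep x (↭-sym p)) (pair-part (nz (here refl)) (nz (there y∈)) y≢x yx≢ε P) ,
         ≤-trans (≤-reflexive (cong (3 *_) (cong suc (↭-length p)))) (≤-by {l = 3 * length S} 0 le (arith (length S) n e))
      where
      arith : ∀ s n e → 3 * (2 + s) + (2 * n + e) + 0 ≡ 2 * (3 + n) + e + 3 * s
      arith = solve-∀
    ... | inj₂ none = length (x ∷ T) , singles-part nz ,
      ≤-trans (≤-reflexive (arith (length (x ∷ T)))) (+-monoʳ-≤ (2 * length (x ∷ T)) (≤-trans (≤-reflexive (sym (count-all (set (cyc x)) (x ∷ T) λ i → un∈ (all i)))) (few x)))
      where
      arith : ∀ s → 3 * s ≡ 2 * s + s
      arith = solve-∀
      all : ∀ {y} → y ∈ₗ x ∷ T → y ∈ set (cyc x)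
      all (here refl) = ∈cyc x
      all {y} (there i) with y ≟ x | (y ∙ x) ≟ ε
      ... | yes refl | _ = ∈cyc x
      ... | no _ | yes e = subst (_∈ set (cyc x)) (sym (trans (solve v0 ((v0 ⊕ v1) ⊕ ⊝ v1) (y ∷ x ∷ []) refl)
              (trans (cong (_∙ x ⁻¹) e) (identityˡ _)))) (⁻¹∈ (cyc x) (∈cyc x))
      ... | no a | no b = ⊥-elim (none i (a , b))

    -- X consists of j + 1 subset sums of W in distinct cosets of ⟨f⟩.
    record Representatives (f : G) (W : List G) (j : ℕ) : Set where
      field
        X : Subset
        X⊆ : X ⊆ sums W
        ε∈X : ε ∈ X
        upper : card (X ⊞ set (cyc f)) ≤ suc j * card (set (cyc f))
        lower : ∀ I → I ⊆ set (cyc f) → suc j * card I ≤ card (X ⊞ I)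

    start-representatives : ∀ f → Representatives f [] 0
    start-representatives f = record
      { X = sums [] ; X⊆ = λ i → i ; ε∈X = ε∈sums []
      ; upper = ≤-trans (card-mono absorb) (≤-reflexive (sym (*-identityˡ _)))
      ; lower = λ I _ → ≤-trans (≤-reflexive (*-identityˡ _)) (card-mono λ {x} i → subst (_∈ sums [] ⊞ I) (identityˡ x) (∈⊞⁺ (ε∈sums []) i))
      }
      where
      absorb : ∀ {Y} → sums [] ⊞ Y ⊆ Y
      absorb {Y} i with x , y , x∈ , y∈ , refl ← ∈⊞⁻ {sums []} i =
        subst (_∈ Y) (sym (trans (cong (_∙ y) (∈⟪⟫⁻ (_≟ ε) x∈)) (identityˡ y))) y∈

    proper : ∀ {H} → card (set H) < card full → ∃ λ g → g ∉ set H
    proper {H} lt with ⊆? full (set H)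
    ... | inj₁ s = ⊥-elim (<⇒≱ lt (card-mono s))
    ... | inj₂ (g , _ , n) = g , n

    -- Let `L` be the stabilizer of `X + ⟨f⟩`. A term `w` outside `L` carries some coset `x + ⟨f⟩`
    -- of that set to a new one, and `x + w` represents it. If there is no such term, all of `R`
    -- lies in `L`, which is proper since |L| ≤ |X + ⟨f⟩| ≤ (j + 1) |⟨f⟩| < |G|.
    extend-representatives : ∀ {f W j} → Representatives f W j → suc j * card (set (cyc f)) < card full → ∀ R →
      (∃₂ λ L g → g ∉ set L × (∀ {x} → x ∈ₗ R → x ∈ set L)) ⊎
      (∃ λ w → w ∈ₗ R × Representatives f (w ∷ W) (suc j))
    extend-representatives {f} {W} {j} reps small R with search (λ w → ¬? (w ∈? set L)) R
      where
      open Representatives reps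
      L : Sub
      L = stab (X ⊞ set (cyc f))
    ... | inj₂ none = inj₁ (L , proj₁ outsider , proj₂ outsider , λ i → decidable-stable (_ ∈? set L) (none i))
      where
      open Representatives reps
      L : Sub
      L = stab (X ⊞ set (cyc f))
      outsider : ∃ λ g → g ∉ set L
      outsider = proper {L} (≤-trans (s≤s (≤-trans (card-mono (stab⊆self (∈⊞⁺-ε))) upper)) small)
        where
        ∈⊞⁺-ε : ε ∈ X ⊞ set (cyc f)
        ∈⊞⁺-ε = ⊆⊞ (ε∈ (cyc f)) ε∈X
    ... | inj₁ (w , w∈ , w∉) = inj₂ (w , w∈ , new)
      where
      open Representatives reps
      F Y : Subset
      F = set (cyc f)
      Y = X ⊞ F

      moved : ∃ λ x → x ∈ X × x ∙ w ∉ Y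
      moved with ⊆? (Y ⊹ w) Y
      ... | inj₁ s = ⊥-elim (w∉ (∈stab⁺ λ i → s (∈⊹⁺ i)))
      ... | inj₂ (y , y∈ , y∉) with z , z∈ , refl ← ∈⊹⁻′ {Y} y∈ with x , h , x∈ , h∈ , refl ← ∈⊞⁻ {X} z∈ =
        x , x∈ , λ i → y∉ (subst (_∈ Y) (solve ((v0 ⊕ v2) ⊕ v1) ((v0 ⊕ v1) ⊕ v2) (x ∷ h ∷ w ∷ []) refl) (⊞-stable X (cyc f) i h∈))

      y : G
      y = proj₁ moved ∙ w

      y∉ : y ∉ Y
      y∉ = proj₂ (proj₂ moved)

      X′ : Subset
      X′ = X ∪ is y

      cover : X′ ⊞ F ⊆ Y ∪ (F ⊹ y)
      cover i with x , h , x∈ , h∈ , refl ← ∈⊞⁻ {X′} i with ∈∪⁻ {X = X} x∈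
      ... | inj₁ k = ∈∪ˡ (∈⊞⁺ k h∈)
      ... | inj₂ k with refl ← ∈⟪⟫⁻ (y ≟_) k = ∈∪ʳ {X = Y} (subst (_∈ F ⊹ y) (comm h y) (∈⊹⁺ h∈))

      new : Representatives f (w ∷ W) (suc j)
      new = record
        { X = X′
        ; X⊆ = λ i → [ (λ k → ∈∪ˡ (X⊆ k))
                     , (λ k → subst (_∈ sums (w ∷ W)) (∈⟪⟫⁻ (y ≟_) k) (sums-take {w} {W} (X⊆ (proj₁ (proj₂ moved))))) ]′ (∈∪⁻ {X = X} i)
        ; ε∈X = ∈∪ˡ ε∈X
        ; upper = begin
            card (X′ ⊞ F)                     ≤⟨ card-mono cover ⟩
            card (Y ∪ (F ⊹ y))                ≤⟨ card-∪≤ Y (F ⊹ y) ⟩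
            card Y + card (F ⊹ y)             ≤⟨ +-mono-≤ upper (≤-reflexive (card-⊹ F y)) ⟩
            suc j * card F + card F           ≡⟨ +-comm (suc j * card F) _ ⟩
            suc (suc j) * card F ∎
        ; lower = λ I I⊆ → begin
            suc (suc j) * card I              ≡⟨ +-comm (card I) _ ⟩
            suc j * card I + card I           ≤⟨ +-mono-≤ (lower I I⊆) (≤-reflexive (sym (card-⊹ I y))) ⟩
            card (X ⊞ I) + card (I ⊹ y)       ≤⟨ card-disjoint-≤ (X ⊞ I) (I ⊹ y) (X′ ⊞ I) (apart I I⊆) (⊞-mono {X} {X′} {I} ∈∪ˡ (λ k → k)) (inner I) ⟩
            card (X′ ⊞ I) ∎
        }
        where
        open ≤-Reasoning
        apart : ∀ I → I ⊆ F → ∀ {z} → z ∈ X ⊞ I → z ∉ I ⊹ y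
        apart I I⊆ a b with x , h , x∈ , h∈ , refl ← ∈⊞⁻ {X} a = y∉ (subst (_∈ Y)
          (solve ((v0 ⊕ v1) ⊕ ⊝ ((v0 ⊕ v1) ⊕ ⊝ v2)) v2 (x ∷ h ∷ y ∷ []) refl)
          (⊞-stable X (cyc f) (∈⊞⁺ x∈ (I⊆ h∈)) (⁻¹∈ (cyc f) (I⊆ (∈⊹⁻ {I} b)))))
        inner : ∀ I → I ⊹ y ⊆ X′ ⊞ I
        inner I b with h , h∈ , refl ← ∈⊹⁻′ {I} b = subst (_∈ X′ ⊞ I) (comm y h) (∈⊞⁺ (∈∪ʳ {X = X} (∈⟪⟫⁺ (y ≟_) refl)) h∈)

    -- `large` is quantified over `m` because the helpers of other frequent terms may use up copies
    -- of `f`; how many remain is known only when all helpers are chosen.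
    record Helper (w : ℕ) (f : G) (W : List G) : Set where
      field
        size : length W ≡ w
        large : ∀ m → suc m ≤ card (set (cyc f)) → suc w * suc m ≤ card (sums (W ++ replicate m f))

    representatives⇒helper : ∀ {f W j} → length W ≡ j → Representatives f W j → Helper j f W
    representatives⇒helper {f} {W} {j} len reps = record { size = len ; large = λ m le → begin
      suc j * suc m                             ≤⟨ *-monoʳ-≤ (suc j) (replicate-sums f m le) ⟩
      suc j * card (sums (replicate m f))       ≤⟨ lower _ (sums⊆ (replicate m f) (cyc f) (all m)) ⟩
      card (X ⊞ sums (replicate m f))           ≤⟨ card-mono (λ i → ⊞⊆sums-++ W (⊞-mono {X} {sums W} {sums (replicate m f)} X⊆ (λ k → k) i)) ⟩
      card (sums (W ++ replicate m f)) ∎ }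
      where
      open ≤-Reasoning
      open Representatives reps
      all : ∀ m {x} → x ∈ₗ replicate m f → x ∈ set (cyc f)
      all (suc m) (here refl) = ∈cyc f
      all (suc m) (there i) = all m i

    Concentrated : List G → ℕ → Set
    Concentrated S s = ∃₂ λ L g → g ∉ set L × length S ≤ count (set L) S + s

    choose-representatives : ∀ f j → suc j * card (set (cyc f)) ≤ card full → ∀ R →
      Concentrated R j ⊎ (∃₂ λ W R′ → R ↭ W ++ R′ × length W ≡ j × Representatives f W j)
    choose-representatives f zero le R = inj₂ ([] , R , ↭-refl , refl , start-representatives f)
    choose-representatives f (suc j) le R with choose-representatives f j (≤-trans (m≤n+m _ (card (set (cyc f)))) le) R
    ... | inj₁ (L , g , g∉ , c) = inj₁ (L , g , g∉ , ≤-trans c (+-monoʳ-≤ (count (set L) R) (n≤1+n j)))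
    ... | inj₂ (W , R′ , p , len , reps) with extend-representatives reps (≤-trans (+-monoˡ-≤ _ (card-Sub-pos (cyc f))) le) R′
    ...   | inj₁ (L , g , g∉ , all) = inj₁ (L , g , g∉ , (begin
      length R                                          ≡⟨ ↭-length p ⟩
      length (W ++ R′)                                  ≡⟨ length-++ W ⟩
      length W + length R′                              ≡⟨ +-comm (length W) _ ⟩
      length R′ + length W                              ≡⟨ cong₂ _+_ (sym (count-all (set L) R′ (un∈ ∘ all))) len ⟩
      count (set L) R′ + j                              ≤⟨ +-mono-≤ (m≤n+m _ (count (set L) W)) (n≤1+n j) ⟩
      count (set L) W + count (set L) R′ + suc j        ≡⟨ cong (_+ suc j) (trans (count-↭ (set L) p) (count-++ (set L) W R′)) ⟨
      count (set L) R + suc j ∎))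
      where open ≤-Reasoning
    ...   | inj₂ (w , w∈ , reps′) with R″ , q ← ∈⇒↭ w∈ =
      inj₂ (w ∷ W , R″ , ↭-trans p (↭-trans (++⁺ˡ W q) (shift w W R″)) , cong suc len , reps′)

    data Helped (w : ℕ) : List G → List G → Set where
      [] : Helped w [] []
      _∷_ : ∀ {f fs W H} → Helper w f W → Helped w fs H → Helped w (f ∷ fs) (W ++ H)

    -- Helpers are drawn in turn from what is left. When no further helper exists, all remaining
    -- terms lie in a proper subgroup, so only terms already drawn, at most w for each frequent
    -- term, can lie outside it.
    choose-helpers : ∀ w → suc w * e ≤ card full → ∀ fs R → Concentrated R (w * length fs) ⊎
      (∃₂ λ H R′ → R ↭ H ++ R′ × length H ≡ w * length fs × Helped w fs H)
    choose-helpers w le [] R = inj₂ ([] , R , ↭-refl , sym (*-zeroʳ w) , [])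
    choose-helpers w le (f ∷ fs) R with choose-helpers w le fs R
    ... | inj₁ (L , g , g∉ , c) = inj₁ (L , g , g∉ , ≤-trans c (+-monoʳ-≤ (count (set L) R) (*-monoʳ-≤ w (n≤1+n _))))
    ... | inj₂ (H , R′ , p , len , helped) with choose-representatives f w (≤-trans (*-monoʳ-≤ (suc w) (card-cyc f)) le) R′
    ...   | inj₁ (L , g , g∉ , c) = inj₁ (L , g , g∉ , (begin
      length R                                                  ≡⟨ trans (↭-length p) (length-++ H) ⟩
      length H + length R′                                      ≤⟨ +-monoʳ-≤ (length H) c ⟩
      length H + (count (set L) R′ + w)                         ≡⟨ regroup (length H) _ w ⟩
      count (set L) R′ + (w + length H)                         ≡⟨ cong (λ k → count (set L) R′ + (w + k)) len ⟩
      count (set L) R′ + (w + w * length fs)                    ≤⟨ +-mono-≤ (m≤n+m _ (count (set L) H)) (≤-reflexive (sym (*-suc w _))) ⟩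
      count (set L) H + count (set L) R′ + w * suc (length fs)  ≡⟨ cong (_+ w * suc (length fs)) (trans (count-↭ (set L) p) (count-++ (set L) H R′)) ⟨
      count (set L) R + w * suc (length fs) ∎))
      where
      open ≤-Reasoning
      regroup : ∀ a b c → a + (b + c) ≡ b + (c + a)
      regroup = solve-∀
    ...   | inj₂ (W , R″ , q , lenW , reps) = inj₂ (W ++ H , R″ ,
      ↭-trans p (↭-trans (++⁺ˡ H q) (↭-trans (shifts H W) (↭-reflexive (sym (++-assoc W H R″))))) ,
      trans (length-++ W) (trans (cong₂ _+_ lenW len) (sym (*-suc w _))) , representatives⇒helper lenW reps ∷ helped)

    removeAll : List G → List G → List G
    removeAll [] S = S
    removeAll (f ∷ fs) S = removeAll fs (remove f S)

    -- The block of `f` with v copies gains (w + 1)(v + 1) - 1 = (w + 1) v + w. Summed over `fs`,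
    -- this is w + 1 for every copy removed from `S` and w for every block.
    popular-blocks : ∀ {w fs H} → Helped w fs H → ∀ S {n} → (∀ f → suc (count (is f) S) ≤ card (set (cyc f))) →
      Part (removeAll fs S) n →
      ∃ λ n′ → Part (H ++ S) n′ × n + suc w * length S + w * length fs ≤ n′ + suc w * length (removeAll fs S)
    popular-blocks {w} [] S {n} few P = n , P , ≤-reflexive (trans (cong (n + suc w * length S +_) (*-zeroʳ w)) (+-identityʳ _))
    popular-blocks {w} {f ∷ fs} (_∷_ {W = W} {H = H} helper helped) S {n} few P =
      let n′ , P′ , le = popular-blocks helped S′ (λ g → ≤-trans (s≤s (count-filter-≤ (is g) (not ∘ is f) S)) (few g)) P
      in (v + w * suc v) + n′ ,
         perm reorder (block (W ++ replicate v f) (Helper.large helper v (few f)) P′) ,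
         ≤-trans (≤-reflexive (cong (λ k → n + suc w * k + w * suc (length fs)) (sym (length-remove f S))))
           (≤-by {l = n + suc w * length S′ + w * length fs} 0 le
             (arith n w v (length S′) (length fs) n′ (suc w * length (removeAll fs S′))))
      where
      S′ = remove f S
      v = count (is f) S
      reorder : (W ++ replicate v f) ++ (H ++ S′) ↭ (W ++ H) ++ S
      reorder = ↭-trans (↭-reflexive (++-assoc W (replicate v f) (H ++ S′)))
        (↭-trans (++⁺ˡ W (↭-trans (shifts (replicate v f) H)
          (++⁺ˡ H (↭-trans (↭-reflexive (cong (_++ S′) (sym (filter-is f S)))) (↭-sym (split-↭ (is f) S))))))
          (↭-reflexive (sym (++-assoc W H S))))
      arith : ∀ n w v s fs n′ u → n + suc w * (v + s) + w * suc fs + (n′ + u) + 0 ≡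
        (v + w * suc v) + n′ + u + (n + suc w * s + w * fs)
      arith = solve-∀

    popular : ∀ c → 1 ≤ c → ∀ Q → Acc _<_ (length Q) →
      ∃ λ fs → length fs * c + length (removeAll fs Q) ≤ length Q × (∀ g → count (is g) (removeAll fs Q) < c)
    popular c 1≤c Q (acc rec) with search (λ f → c ≤? count (is f) Q) Q
    ... | inj₂ none = [] , ≤-refl , λ g → ≰⇒> λ le → let x , x∈ , e = count-pos⁻ (is g) Q (≤-trans 1≤c le) in
            none (subst (_∈ₗ Q) (sym (is⇒≡ e)) x∈) le
    ... | inj₁ (f , _ , le) =
      let fs , total , few = popular c 1≤c (remove f Q) (rec (≤-trans (+-monoˡ-≤ (length (remove f Q)) (≤-trans 1≤c le)) (≤-reflexive (length-remove f Q))))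
      in f ∷ fs , ≤-trans (≤-reflexive (+-assoc c _ _)) (≤-trans (+-mono-≤ le total) (≤-reflexive (length-remove f Q))) , few

    removeAll-++ : ∀ fs S T → removeAll fs (S ++ T) ≡ removeAll fs S ++ removeAll fs T
    removeAll-++ [] S T = refl
    removeAll-++ (f ∷ fs) S T = trans (cong (removeAll fs) (filter-++ (T? ∘ (not ∘ is f)) S T)) (removeAll-++ fs (remove f S) (remove f T))

    removeAll-↭ : ∀ fs {S T} → S ↭ T → removeAll fs S ↭ removeAll fs T
    removeAll-↭ [] p = p
    removeAll-↭ (f ∷ fs) p = removeAll-↭ fs (filter-↭ (T? ∘ (not ∘ is f)) p)

    removeAll⊆ : ∀ fs S {x} → x ∈ₗ removeAll fs S → x ∈ₗ S
    removeAll⊆ [] S i = i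
    removeAll⊆ (f ∷ fs) S i = proj₁ (filterᵇ-sound (not ∘ is f) S (removeAll⊆ fs (remove f S) i))

    -- All combinations of `T` with coefficients -1, 0 and 1, hence 3 to the power |T| entries. They
    -- cover the differences of subset sums, so a new term outside this list doubles the number of
    -- sums.
    differences : List G → List G
    differences [] = ε ∷ []
    differences (x ∷ T) = differences T ++ map (_∙ x) (differences T) ++ map (_∙ x ⁻¹) (differences T)

    length-differences : ∀ T → length (differences T) ≡ 3 ^ length T
    length-differences [] = refl
    length-differences (x ∷ T) = trans (length-++ (differences T)) (cong₂ _+_ (length-differences T)
      (trans (length-++ (map (_∙ x) (differences T)))
        (trans (cong₂ _+_ (trans (length-map _ (differences T)) (length-differences T)) (trans (length-map _ (differences T)) (length-differences T)))
          (cong (3 ^ length T +_) (sym (+-identityʳ _))))))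

    ∈differences : ∀ T {a b} → a ∈ sums T → b ∈ sums T → a ∙ b ⁻¹ ∈ₗ differences T
    ∈differences [] {a} {b} i j = here (trans (cong₂ (λ s t → s ∙ t ⁻¹) (∈⟪⟫⁻ (_≟ ε) i) (∈⟪⟫⁻ (_≟ ε) j)) (inverseʳ ε))
    ∈differences (x ∷ T) i j with sums-∷⁻ {x} {T} i | sums-∷⁻ {x} {T} j
    ... | inj₁ a | inj₁ b = ∈-++⁺ˡ (∈differences T a b)
    ... | inj₂ (g , a , refl) | inj₁ b = ∈-++⁺ʳ (differences T) (∈-++⁺ˡ (subst (_∈ₗ map (_∙ x) (differences T))
      (solve ((v0 ⊕ ⊝ v1) ⊕ v2) ((v0 ⊕ v2) ⊕ ⊝ v1) (g ∷ _ ∷ x ∷ []) refl) (∈-map⁺ (_∙ x) (∈differences T a b))))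
    ... | inj₁ a | inj₂ (h , b , refl) = ∈-++⁺ʳ (differences T) (∈-++⁺ʳ (map (_∙ x) (differences T)) (subst (_∈ₗ map (_∙ x ⁻¹) (differences T))
      (solve ((v0 ⊕ ⊝ v1) ⊕ ⊝ v2) (v0 ⊕ ⊝ (v1 ⊕ v2)) (_ ∷ h ∷ x ∷ []) refl) (∈-map⁺ (_∙ x ⁻¹) (∈differences T a b))))
    ... | inj₂ (g , a , refl) | inj₂ (h , b , refl) = ∈-++⁺ˡ (subst (_∈ₗ differences T)
      (solve (v0 ⊕ ⊝ v1) ((v0 ⊕ v2) ⊕ ⊝ (v1 ⊕ v2)) (g ∷ h ∷ x ∷ []) refl) (∈differences T a b))

    terms∈differences : ∀ T {x} → x ∈ₗ T → x ∈ₗ differences T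
    terms∈differences T {x} i = subst (_∈ₗ differences T) (solve (v0 ⊕ ⊝ ⓪) v0 (x ∷ []) refl) (∈differences T (∈⇒∈sums i) (ε∈sums T))

    doubling : ∀ T {x} → ¬ (x ∈ₗ differences T) → card (sums (x ∷ T)) ≡ card (sums T) + card (sums T)
    doubling T {x} n = trans (card-disjoint (sums T) (sums T ⊹ x) λ {g} i j → n (subst (_∈ₗ differences T)
        (solve (v0 ⊕ ⊝ (v0 ⊕ ⊝ v1)) v1 (g ∷ x ∷ []) refl) (∈differences T i (∈⊹⁻ {sums T} j))))
      (cong (card (sums T) +_) (card-⊹ (sums T) x))

    -- Greedy choice: each chosen term doubles the number of sums. If the choice gets stuck after j
    -- ≤ k terms, every term of `U`, including the chosen ones, is among the 3ʲ differences.
    dissociated : ∀ k U j → j ≤ suc k →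
      (∃ λ Δ → length Δ ≤ 3 ^ k × (∀ {x} → x ∈ₗ U → x ∈ₗ Δ)) ⊎
      (∃₂ λ T U′ → U ↭ T ++ U′ × length T ≡ j × 2 ^ j ≤ card (sums T))
    dissociated k U zero le = inj₂ ([] , U , ↭-refl , refl , card-pos (ε∈sums []))
    dissociated k U (suc j) le with dissociated k U j (≤-trans (n≤1+n j) le)
    ... | inj₁ small = inj₁ small
    ... | inj₂ (T , U′ , p , len , big) with search (λ x → ¬? (Any.any? (x ≟_) (differences T))) U′
    ...   | inj₂ none = inj₁ (differences T ,
              ≤-trans (≤-reflexive (trans (length-differences T) (cong (3 ^_) len))) (^-monoʳ-≤ 3 (s≤s⁻¹ le)) ,
              λ i → inside (∈-resp-↭ p i))
      where
      inside : ∀ {x} → x ∈ₗ T ++ U′ → x ∈ₗ differences T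
      inside {x} i with Any.any? (x ≟_) (differences T)
      ... | yes a = a
      ... | no n = ⊥-elim (n (from T (λ k → k) i))
        where
        from : ∀ V → (∀ {y} → y ∈ₗ V → y ∈ₗ T) → x ∈ₗ V ++ U′ → x ∈ₗ differences T
        from [] s i = decidable-stable (Any.any? (x ≟_) (differences T)) (none i)
        from (y ∷ V) s (here refl) = terms∈differences T (s (here refl))
        from (y ∷ V) s (there i) = from V (s ∘ there) i
    ...   | inj₁ (x , x∈ , n) with U″ , q ← ∈⇒↭ x∈ = inj₂ (x ∷ T , U″ , ↭-trans p (↭-trans (++⁺ˡ T q) (shift x T U″)) , cong suc len ,
              ≤-trans (+-mono-≤ big (≤-trans (≤-reflexive (+-identityʳ _)) big)) (≤-reflexive (sym (doubling T n))))

    cover-bound : ∀ c Δ U → (∀ {x} → x ∈ₗ U → x ∈ₗ Δ) → (∀ g → count (is g) U ≤ c) → length U ≤ length Δ * c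
    cover-bound c [] [] s few = z≤n
    cover-bound c [] (x ∷ U) s few with () ← s (here refl)
    cover-bound c (g ∷ Δ) U s few = ≤-trans (≤-reflexive (sym (length-remove g U))) (+-mono-≤ (few g)
      (cover-bound c Δ (remove g U) inside λ h → ≤-trans (count-filter-≤ (is h) (not ∘ is g) U) (few h)))
      where
      inside : ∀ {x} → x ∈ₗ remove g U → x ∈ₗ Δ
      inside i with i₁ , i₂ ← filterᵇ-sound (not ∘ is g) U i with s i₁
      ... | here refl with () ← trans (sym i₂) (cong not (is-self g))
      ... | there k = k

    -- Blocks of k + 1 terms, gaining q + 1 per term, are split off while they exist. By
    -- `cover-bound` at most 3ᵏ c terms are left over; as single terms they gain 1 each and so fall
    -- short by q each.
    dissociated-part : ∀ q k c → suc (suc q * suc k) ≤ 2 ^ suc k → ∀ U → Acc _<_ (length U) → (∀ {x} → x ∈ₗ U → x ≢ ε) →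
      (∀ g → count (is g) U ≤ c) → ∃ λ n → Part U n × suc q * length U ≤ n + q * (3 ^ k * c)
    dissociated-part q k c big U (acc rec) nz few with dissociated k U (suc k) ≤-refl
    ... | inj₁ (Δ , small , inside) = length U , singles-part nz ,
      +-monoʳ-≤ (length U) (*-monoʳ-≤ q (≤-trans (cover-bound c Δ U inside few) (*-monoˡ-≤ c small)))
    ... | inj₂ (T , U′ , p , len , large) =
      let n , P , le = dissociated-part q k c big U′ (rec smaller) (λ i → nz (∈-resp-↭ (↭-sym p) (∈-++⁺ʳ T i)))
                         (λ g → ≤-trans (≤-trans (m≤n+m _ (count (is g) T)) (≤-reflexive (sym (trans (count-↭ (is g) p) (count-++ (is g) T U′))))) (few g))
      in suc q * suc k + n , perm (↭-sym p) (block T (≤-trans big large) P) , (begin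
        suc q * length U                          ≡⟨ cong (suc q *_) size ⟩
        suc q * (suc k + length U′)               ≡⟨ *-distribˡ-+ (suc q) (suc k) _ ⟩
        suc q * suc k + suc q * length U′         ≤⟨ +-monoʳ-≤ (suc q * suc k) le ⟩
        suc q * suc k + (n + q * (3 ^ k * c))     ≡⟨ +-assoc (suc q * suc k) n _ ⟨
        suc q * suc k + n + q * (3 ^ k * c) ∎)
      where
      open ≤-Reasoning
      size : length U ≡ suc k + length U′
      size = trans (↭-length p) (trans (length-++ T) (cong (_+ length U′) len))
      smaller : length U′ < length U
      smaller = ≤-trans (s≤s (m≤n+m _ k)) (≤-reflexive (sym size))

-- Numerical estimates.

cube-bound : ∀ n → 1 ≤ n → 32 * (n * n * n * 3 ^ n) ≤ 81 * 8 ^ n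
cube-bound 1 _ = m≤m+n 96 552
cube-bound 2 _ = m≤m+n 2304 2880
cube-bound 3 _ = m≤m+n 23328 18144
-- From n = 3 on, the factor 3 ((n + 1) / n)³ by which n³ 3ⁿ grows is below 8.
cube-bound (suc n@(suc (suc (suc i)))) _ = begin
  32 * (suc n * suc n * suc n * (3 * 3 ^ n))        ≡⟨ regroup (suc n * suc n * suc n) (3 ^ n) ⟩
  32 * ((3 * (suc n * suc n * suc n)) * 3 ^ n)      ≤⟨ *-monoʳ-≤ 32 (*-monoˡ-≤ (3 ^ n) (≤-slack {3 * (suc n * suc n * suc n)} (24 + 72 * i + 36 * (i * i) + 5 * (i * i * i)) (poly i))) ⟩
  32 * ((8 * (n * n * n)) * 3 ^ n)                  ≡⟨ regroup′ (n * n * n) (3 ^ n) ⟩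
  8 * (32 * (n * n * n * 3 ^ n))                    ≤⟨ *-monoʳ-≤ 8 (cube-bound n (s≤s z≤n)) ⟩
  8 * (81 * 8 ^ n)                                  ≡⟨ regroup″ (8 ^ n) ⟩
  81 * (8 * 8 ^ n) ∎
  where
  open ≤-Reasoning
  regroup : ∀ a b → 32 * (a * (3 * b)) ≡ 32 * ((3 * a) * b)
  regroup = solve-∀
  regroup′ : ∀ a b → 32 * ((8 * a) * b) ≡ 8 * (32 * (a * b))
  regroup′ = solve-∀
  regroup″ : ∀ a → 8 * (81 * a) ≡ 81 * (8 * a)
  regroup″ = solve-∀
  poly : ∀ i → 3 * ((4 + i) * (4 + i) * (4 + i)) + (24 + 72 * i + 36 * (i * i) + 5 * (i * i * i)) ≡ 8 * ((3 + i) * (3 + i) * (3 + i))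
  poly = solve-∀

-- With k minimal, 2ᵏ ≤ (p + 1) k ≤ (4p/3) k, whence 3ᵏ ≤ 6 p³ by cube-bound.
block-size : ∀ p → 3 ≤ p → ∃ λ k → suc (suc p * suc k) ≤ 2 ^ suc k × 3 ^ k ≤ 6 * (p * p * p)
-- The search for the minimal k descends from 2p, where 2ᵖ ≥ p + 1 squared already suffices.
block-size p 3≤p = least (p + p) enough
  where
  Enough : ℕ → Set
  Enough k = suc (suc p * suc k) ≤ 2 ^ suc k

  open ≤-Reasoning

  suc≤2^ : ∀ n → suc n ≤ 2 ^ n
  suc≤2^ zero = ≤-refl
  suc≤2^ (suc n) = ≤-trans (+-mono-≤ (≤-trans (s≤s z≤n) (suc≤2^ n)) (suc≤2^ n)) (≤-reflexive (cong (2 ^ n +_) (sym (+-identityʳ _))))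

  enough : Enough (p + p)
  enough = begin
    suc (suc p * suc (p + p))      ≤⟨ ≤-slack p (arith p) ⟩
    2 * (suc p * suc p)            ≤⟨ *-monoʳ-≤ 2 (*-mono-≤ (suc≤2^ p) (suc≤2^ p)) ⟩
    2 * (2 ^ p * 2 ^ p)            ≡⟨ cong (2 *_) (^-distribˡ-+-* 2 p p) ⟨
    2 ^ suc (p + p) ∎
    where
    arith : ∀ p → suc (suc p * suc (p + p)) + p ≡ 2 * (suc p * suc p)
    arith = solve-∀

  -- From 2ⁿ ≤ (4/3) p n and the constant of `cube-bound` the factor is (81/32) (4/3)³ = 6.
  cancel : ∀ k → 2 ^ suc k ≤ suc p * suc k → 3 ^ suc k ≤ 6 * (p * p * p)
  cancel k le = *-cancelˡ-≤ (64 * (n * n * n)) (begin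
    64 * (n * n * n) * 3 ^ n                ≡⟨ r₁ (n * n * n) (3 ^ n) ⟩
    2 * (32 * (n * n * n * 3 ^ n))          ≤⟨ *-monoʳ-≤ 2 (cube-bound n (s≤s z≤n)) ⟩
    2 * (81 * 8 ^ n)                        ≡⟨ cong (λ x → 2 * (81 * x)) (^-*-assoc 2 3 n) ⟩
    2 * (81 * 2 ^ (3 * n))                  ≡⟨ cong (λ x → 2 * (81 * x)) (trans (cong (2 ^_) (*-comm 3 n)) (sym (^-*-assoc 2 n 3))) ⟩
    2 * (81 * (2 ^ n) ^ 3)                  ≡⟨ r₂ (2 ^ n) ⟩
    6 * ((3 * 2 ^ n) * (3 * 2 ^ n) * (3 * 2 ^ n))     ≤⟨ *-monoʳ-≤ 6 (*-mono-≤ (*-mono-≤ main main) main) ⟩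
    6 * ((4 * p * n) * (4 * p * n) * (4 * p * n))     ≡⟨ r₃ p n ⟩
    64 * (n * n * n) * (6 * (p * p * p)) ∎)
    where
    n = suc k
    main : 3 * 2 ^ n ≤ 4 * p * n
    main = begin
      3 * 2 ^ n          ≤⟨ *-monoʳ-≤ 3 le ⟩
      3 * (suc p * n)    ≡⟨ *-assoc 3 (suc p) n ⟨
      3 * suc p * n      ≤⟨ *-monoˡ-≤ n (≤-by {3} {p} {3 * suc p} {4 * p} 0 3≤p (r₀ p)) ⟩
      4 * p * n ∎
      where
      r₀ : ∀ p → 3 * suc p + p + 0 ≡ 4 * p + 3
      r₀ = solve-∀
    r₁ : ∀ a b → 64 * a * b ≡ 2 * (32 * (a * b))
    r₁ = solve-∀
    r₂ : ∀ a → 2 * (81 * (a * (a * (a * 1)))) ≡ 6 * ((3 * a) * (3 * a) * (3 * a))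
    r₂ = solve-∀
    r₃ : ∀ p n → 6 * ((4 * p * n) * (4 * p * n) * (4 * p * n)) ≡ 64 * (n * n * n) * (6 * (p * p * p))
    r₃ = solve-∀

  least : ∀ k → Enough k → ∃ λ k → Enough k × 3 ^ k ≤ 6 * (p * p * p)
  least zero (s≤s (s≤s le)) = ⊥-elim (<⇒≱ (≤-trans (s≤s z≤n) 3≤p) (≤-trans (≤-reflexive (sym (*-identityʳ p))) le))
  least (suc k) ok with suc (suc p * suc k) ≤? 2 ^ suc k
  ... | yes ok′ = least k ok′
  ... | no ¬ok = suc k , ok , cancel k (s≤s⁻¹ (≰⇒> ¬ok))

-- Write κ = p + a and q = p + b. Then qκ + p² = p (κ + q) + ab, while the bounds on `i` and `o`
-- make the right-hand side at most p (κ + q) - p.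
index-arithmetic : ∀ {p κ q i o} → 1 ≤ p → p ≤ κ → p ≤ q → suc i ≤ κ → 2 + o ≤ q →
                   ¬ (q * κ + p * p ≤ p * (i + o) + 2 * p)
index-arithmetic {p} {κ} {q} {i} {o} 1≤p p≤κ p≤q i< o< le
  with a , refl ← m≤n⇒∃[o]m+o≡n p≤κ with b , refl ← m≤n⇒∃[o]m+o≡n p≤q =
  <⇒≱ 1≤p (≤-by {l = le₁} {r = le₂} (a * b) (+-mono-≤ le (+-mono-≤ (*-monoʳ-≤ p i<) (*-monoʳ-≤ p o<))) (arith p a b i o))
  where
  le₁ le₂ : ℕ
  le₁ = (p + b) * (p + a) + p * p + (p * suc i + p * (2 + o))
  le₂ = p * (i + o) + 2 * p + (p * (p + a) + p * (p + b))
  arith : ∀ p a b i o → p + (p * (i + o) + 2 * p + (p * (p + a) + p * (p + b))) + a * b ≡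
    0 + ((p + b) * (p + a) + p * p + (p * suc i + p * (2 + o)))
  arith = solve-∀

-- Here p = i + 2, `s` counts the frequent values, and |S| = (2p - 1) s + R. The hypotheses give n′
-- ≥ (2p - 1) |S| - (2p - 1)² s - (p - 1) U. This is at least p |S| because |S| ≥ 12p s + U and 12p
-- (p - 1) ≥ (2p - 1)².
gain-arithmetic : ∀ i {s Q U R n n′ X} → X ≤ (3 + 2 * i) * s + R → s * (12 * (2 + i)) + Q ≤ (3 + 2 * i) * s + R → U ≤ Q →
  (3 + i) * U ≤ n + X → n + (4 + 2 * i) * R + (3 + 2 * i) * s ≤ n′ + (4 + 2 * i) * U →
  (2 + i) * ((3 + 2 * i) * s + R) ≤ n′
gain-arithmetic i {s} {Q} {U} {R} {n} {n′} {X} hX hs hU hd hp =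
  ≤-by {l = l} {r = r} ((15 + 24 * i + 8 * (i * i)) * s)
    (+-mono-≤ (+-mono-≤ hd hp) (+-mono-≤ hX (*-monoʳ-≤ (1 + i) (≤-trans (+-monoʳ-≤ (s * (12 * (2 + i))) hU) hs))))
    (arith i s U R n n′ X)
  where
  l r : ℕ
  l = (3 + i) * U + (n + (4 + 2 * i) * R + (3 + 2 * i) * s) + (X + (1 + i) * (s * (12 * (2 + i)) + U))
  r = n + X + (n′ + (4 + 2 * i) * U) + ((3 + 2 * i) * s + R + (1 + i) * ((3 + 2 * i) * s + R))
  arith : ∀ i s U R n n′ X → (2 + i) * ((3 + 2 * i) * s + R) +
    (n + X + (n′ + (4 + 2 * i) * U) + ((3 + 2 * i) * s + R + (1 + i) * ((3 + 2 * i) * s + R))) + (15 + 24 * i + 8 * (i * i)) * s ≡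
    n′ + ((3 + i) * U + (n + (4 + 2 * i) * R + (3 + 2 * i) * s) + (X + (1 + i) * (s * (12 * (2 + i)) + U)))
  arith = solve-∀

-- The 12 in the frequency threshold is chosen for this: at most (2p - 1) s terms are lost, and 6
-- (2p - 1) ≤ 12p.
concentrated-arithmetic : ∀ i {s L u} → s * (12 * (2 + i)) ≤ L → L ≤ u + (3 + 2 * i) * s → 5 * L ≤ 6 * u
concentrated-arithmetic i {s} {L} {u} h₁ h₂ =
  ≤-by {l = s * (12 * (2 + i)) + 6 * L} {r = L + 6 * (u + (3 + 2 * i) * s)} (6 * s) (+-mono-≤ h₁ (*-monoʳ-≤ 6 h₂)) (arith i s L u)
  where
  arith : ∀ i s L u → 5 * L + (L + 6 * (u + (3 + 2 * i) * s)) + 6 * s ≡ 6 * u + (s * (12 * (2 + i)) + 6 * L)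
  arith = solve-∀

-- The chain is 4n ≥ 6u - 2e ≥ 5s - s, so a loss of one sixth of the terms is just affordable.
pairs-arithmetic : ∀ {s u n e} → 5 * s ≤ 6 * u → 3 * u ≤ 2 * n + e → 2 * e ≤ s → s ≤ n
pairs-arithmetic {s} {u} {n} {e} h₁ h₂ h₃ = *-cancelˡ-≤ 4
  (≤-by {l = 5 * s + 2 * (3 * u) + 2 * e} {r = 6 * u + 2 * (2 * n + e) + s} 0 (+-mono-≤ (+-mono-≤ h₁ (*-monoʳ-≤ 2 h₂)) h₃) (arith s u n e))
  where
  arith : ∀ s u n e → 4 * s + (6 * u + 2 * (2 * n + e) + s) + 0 ≡ 4 * n + (5 * s + 2 * (3 * u) + 2 * e)
  arith = solve-∀

-- The upper bound.

module UpperBound (𝔾 : FiniteAbelianGroup) (p e : ℕ) (3≤p : 3 ≤ p)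
  (least-divisor : ∀ d q → d * q ≡ length (FiniteAbelianGroup.elements 𝔾) → 2 ≤ d → p ≤ d)
  (1≤e : 1 ≤ e) (exponent : ∀ x → Solver._⋆_ 𝔾 e x ≡ FiniteAbelianGroup.ε 𝔾)
  -- For e = n₂ this is n₁ ≥ 2p; it says that every cyclic subgroup has index at least 2p.
  (rank : 2 * p * e ≤ length (FiniteAbelianGroup.elements 𝔾))
  (large : 72 * p ^ 6 ≤ length (FiniteAbelianGroup.elements 𝔾)) where

  open Subsets 𝔾
  open SubsetSums 𝔾
  open BlockConstructions 𝔾
  open Cyclic e 1≤e exponent
  open KneserTheorem 𝔾 using (stab-mono)

  N : ℕ
  N = length elements

  card-full : card full ≡ N
  card-full = trans (card-def full) (go elements)
    where
    go : ∀ (l : List G) → length (filterᵇ full l) ≡ length l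
    go [] = refl
    go (x ∷ l) = cong suc (go l)

  Regular : List G → Set
  Regular S = ∀ (H : Sub) {g} → g ∉ set H → suc (count (set H) S) ≤ card (set H)

  -- The condition |S| ≥ |G|/p + p - 2 multiplied by p, which avoids division and truncated
  -- subtraction.
  Long : List G → Set
  Long S = N + p * p ≤ p * length S + 2 * p

  2e<N : 2 * e < N
  2e<N = begin
    suc (2 * e)      ≤⟨ +-mono-≤ 1≤e (≤-reflexive (*-comm 2 e)) ⟩
    e + e * 2        ≡⟨ *-suc e 2 ⟨
    e * 3            ≤⟨ *-monoʳ-≤ e (≤-trans 3≤p (m≤m+n p _)) ⟩
    e * (2 * p)      ≡⟨ *-comm e (2 * p) ⟩
    2 * p * e        ≤⟨ rank ⟩
    N ∎
    where open ≤-Reasoning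

  instance
    p-nonZero : NonZero p
    p-nonZero = >-nonZero (≤-trans (s≤s z≤n) 3≤p)

  e<card-full : e < card full
  e<card-full = ≤-trans (s≤s (m≤m+n e _)) (≤-trans 2e<N (≤-reflexive (sym card-full)))

  long⇒ : ∀ {S} → Long S → N ≤ p * length S
  long⇒ {S} long = ≤-by {l = N + p * p + p * 2} {r = p * length S + 2 * p + p * p} 0 (+-mono-≤ long (*-monoʳ-≤ p (≤-trans (n≤1+n 2) 3≤p)))
    (arith N p (length S))
    where
    arith : ∀ N p s → N + (p * s + 2 * p + p * p) + 0 ≡ p * s + (N + p * p + p * 2)
    arith = solve-∀

  subgroup-index : ∀ H {g} → g ∉ set H → p * card (set H) ≤ N
  subgroup-index H {g} g∉ with q , eq ← lagrange full H (λ _ _ → mk∈ refl) (<-wellFounded _) =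
    ≤-trans (*-monoˡ-≤ (card (set H)) (least-divisor q (card (set H)) (trans (sym eq) card-full) q≥2))
      (≤-reflexive (trans (sym eq) card-full))
    where
    q≥2 : 2 ≤ q
    q≥2 = *-cancelʳ-≤ 2 q (card (set H)) {{>-nonZero (card-Sub-pos H)}} (≤-trans (≤-reflexive (cong (card (set H) +_) (+-identityʳ _)))
      (≤-trans (stable-gap {set H} {full} {H} (∙∈ H) (λ _ → mk∈ refl) (λ _ _ → mk∈ refl) (mk∈ refl) g∉) (≤-reflexive eq)))

  -- With k = |stab Σ₀(S)| > 1 and q = N / k > 1, at most k - 1 terms would lie in the stabilizer and at most
  -- q - 2 outside, contradicting (k - p)(q - p) ≥ 0.
  periodic⇒full : ∀ S → Regular S → Long S → ∀ {k} → k ∈ set (stab (sums S)) → k ≢ ε → ∀ g → g ∈ sums S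
  periodic⇒full S reg long {k} k∈ k≢ε g = decidable-stable (g ∈? sums S) λ g∉ → impossible g∉
    where
    K : Sub
    K = stab (sums S)
    κ : ℕ
    κ = card (set K)

    κ≥2 : 2 ≤ κ
    κ≥2 = card-≥-list {set K} {ε ∷ k ∷ []} (((k≢ε ∘ sym) ∷ []) ∷ [] ∷ []) λ { (here refl) → ε∈ K ; (there (here refl)) → k∈ }

    impossible : g ∉ sums S → ⊥
    impossible g∉ with q , eq ← lagrange full K (λ _ _ → mk∈ refl) (<-wellFounded _) =
        index-arithmetic (≤-trans (s≤s z≤n) 3≤p) p≤κ p≤q in-bound q-bound
          (subst (λ n → n + p * p ≤ p * (count (set K) S + out) + 2 * p) (trans (sym card-full) eq)
            (subst (λ n → N + p * p ≤ p * n + 2 * p) (sym (count-not (set K) S)) long))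
      where
      out : ℕ
      out = outside K S

      q-bound : 2 + out ≤ q
      q-bound = *-cancelˡ-≤ κ {{>-nonZero (card-Sub-pos K)}} (begin
        κ * (2 + out)            ≡⟨ *-suc κ (suc out) ⟩
        κ + κ * suc out          ≡⟨ +-comm κ _ ⟩
        κ * suc out + κ          ≤⟨ +-monoˡ-≤ κ (singles-bound S) ⟩
        card (sums S) + κ        ≤⟨ stable-gap {sums S} {full} {K} (stab-stable (sums S)) (λ _ → mk∈ refl) (λ _ _ → mk∈ refl) (mk∈ refl) g∉ ⟩
        card full                ≡⟨ trans eq (*-comm q κ) ⟩
        κ * q ∎)
        where open ≤-Reasoning

      p≤κ : p ≤ κ
      p≤κ = least-divisor κ q (trans (*-comm κ q) (trans (sym eq) card-full)) κ≥2

      p≤q : p ≤ q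
      p≤q = least-divisor q κ (trans (sym eq) card-full) (≤-trans (m≤m+n 2 out) q-bound)

      in-bound : suc (count (set K) S) ≤ κ
      in-bound = reg K (λ i → g∉ (stab⊆self (ε∈sums S) i))

  trivial : Sub
  trivial = record
    { set = ⟪ _≟ ε ⟫
    ; ε∈ = ∈⟪⟫⁺ (_≟ ε) refl
    ; ∙∈ = λ i j → ∈⟪⟫⁺ (_≟ ε) (trans (cong₂ _∙_ (∈⟪⟫⁻ (_≟ ε) i) (∈⟪⟫⁻ (_≟ ε) j)) (identityˡ ε))
    ; ⁻¹∈ = λ i → ∈⟪⟫⁺ (_≟ ε) (trans (cong _⁻¹ (∈⟪⟫⁻ (_≟ ε) i)) (trans (sym (identityˡ _)) (inverseʳ ε)))
    }

  -- Regularity at the trivial subgroup leaves room for no term 0.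
  regular⇒nonzero : ∀ {S} → Regular S → ∀ {x} → x ∈ₗ S → x ≢ ε
  regular⇒nonzero {S} reg {x} x∈ x≡ε = <⇒≱ (s≤s (count-pos (set trivial) S x∈ (un∈ (∈⟪⟫⁺ (_≟ ε) x≡ε))))
    (≤-trans (reg trivial (proj₂ (proper {trivial} (≤-trans (s≤s one) (≤-trans (s≤s 1≤e) e<card-full))))) one)
    where
    one : card (set trivial) ≤ 1
    one = card-≤-list {set trivial} (ε ∷ []) λ i → here (∈⟪⟫⁻ (_≟ ε) i)

  regular⇒cyc : ∀ {S} → Regular S → ∀ x → suc (count (set (cyc x)) S) ≤ card (set (cyc x))
  regular⇒cyc reg x = reg (cyc x) (proj₂ (proper {cyc x} (≤-trans (s≤s (card-cyc x)) e<card-full)))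

  Rich : List G → Set
  Rich S = (∃ λ k → k ∈ set (stab (sums S)) × k ≢ ε) × ε ∈ sums⁺ S

  -- Both lower bounds for |Σ₀(T)| are violated, one for lack of aperiodicity, the other for lack of
  -- zero-sum freeness. Comparing n with |Σ₀(T)| instead of |G| lets the lemma serve inside a proper
  -- subgroup as well.
  rich-part : ∀ {T n} → Part T n → card (sums T) ≤ n → Rich T
  rich-part {T} P le = nontrivial , decidable-stable (ε ∈? sums⁺ T) (λ n → <⇒≱ (zero-sum-free-bound P n) le)
    where
    nontrivial : ∃ λ k → k ∈ set (stab (sums T)) × k ≢ ε
    nontrivial with any? (λ k → (k ∈? set (stab (sums T))) ×-dec ¬? (k ≟ ε))
    ... | yes q = q
    ... | no n = ⊥-elim (<⇒≱ (aperiodic-bound P λ {g} i → decidable-stable (g ≟ ε) λ ne → n (g , i , ne)) le)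

  rich-++ : ∀ {S T R} → S ↭ T ++ R → Rich T → Rich S
  rich-++ {S} {T} {R} p ((k , k∈ , k≢ε) , z) =
    (k , stab-mono (sums-↭ q) (sums-↭ (↭-sym q)) (stab-sums-++ R T k∈) , k≢ε) ,
    sums⁺-↭ (↭-sym p) (subst (_∈ sums⁺ (T ++ R)) (identityˡ ε) (sums⁺-++⁺ T z (ε∈sums R)))
    where
    q : R ++ T ↭ S
    q = ↭-trans (++-comm R T) (↭-sym p)

  -- Inside `L` the gain has to reach only |L| ≤ |G|/p ≤ |S|. Pairing stops only when the remaining
  -- terms lie in one cyclic group, so by regularity at most e ≤ |S|/2 terms stay unpaired.
  concentrated⇒rich : ∀ {S} → Regular S → Long S → ∀ L {g} → g ∉ set L → 5 * length S ≤ 6 * count (set L) S → Rich S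
  concentrated⇒rich {S} reg long L g∉ le = rich-++ {S} {T} {filterᵇ (not ∘ set L) S} (split-↭ (set L) S) (rich-part {T} P (begin
    card (sums T)       ≤⟨ card-mono (sums⊆ T L λ i → mk∈ (proj₂ (filterᵇ-sound (set L) S i))) ⟩
    card (set L)        ≤⟨ *-cancelˡ-≤ p (≤-trans (subgroup-index L g∉) (long⇒ {S} long)) ⟩
    length S            ≤⟨ pairs-arithmetic {length S} {length T} {n} {e} le bound 2e≤ ⟩
    n ∎))
    where
    open ≤-Reasoning
    T : List G
    T = filterᵇ (set L) S
    paired : ∃ λ n → Part T n × 3 * length T ≤ 2 * n + e
    paired = pairs-part T (<-wellFounded _) (λ i → regular⇒nonzero {S} reg (proj₁ (filterᵇ-sound (set L) S i)))
      λ x → ≤-trans (count-filter-≤ (set (cyc x)) (set L) S) (≤-trans (n≤1+n _) (≤-trans (regular⇒cyc {S} reg x) (card-cyc x)))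
    n : ℕ
    n = proj₁ paired
    P : Part T n
    P = proj₁ (proj₂ paired)
    bound : 3 * length T ≤ 2 * n + e
    bound = proj₂ (proj₂ paired)
    2e≤ : 2 * e ≤ length S
    2e≤ = *-cancelˡ-≤ p (≤-trans (≤-reflexive (trans (sym (*-assoc p 2 e)) (cong (_* e) (*-comm p 2)))) (≤-trans rank (long⇒ {S} long)))

  rich : ∀ S → Regular S → Long S → Rich S
  -- Writing p = i + 2 expresses the number 2p - 1 of helpers as 3 + 2i.
  rich S reg long with i , refl ← m≤n⇒∃[o]m+o≡n (≤-trans (n≤1+n 2) 3≤p)
    with popular (12 * p) (≤-trans (≤-trans (s≤s z≤n) 3≤p) (m≤m+n p _)) S (<-wellFounded _) | block-size p 3≤p
  ... | fs , total , few | k , enough , small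
    with choose-helpers (3 + 2 * i) (≤-trans (*-monoˡ-≤ e (≤-reflexive (double i))) (≤-trans rank (≤-reflexive (sym card-full)))) fs S
    where
    double : ∀ i → 4 + 2 * i ≡ 2 * (2 + i)
    double = solve-∀
  ...   | inj₁ (L , g , g∉ , c) = concentrated⇒rich {S} reg long L g∉ (concentrated-arithmetic i {length fs} {length S} {count (set L) S} (≤-trans (m≤m+n _ _) total) c)
  ...   | inj₂ (H , R , π , lenH , helped) = rich-part (perm (↭-sym π) (proj₁ (proj₂ blocks))) (begin
    card (sums S)                                     ≤⟨ card-mono {sums S} {full} (λ _ → mk∈ refl) ⟩
    card full                                         ≡⟨ card-full ⟩
    N                                                 ≤⟨ long⇒ {S} long ⟩
    p * length S                                      ≡⟨ cong (p *_) lenS ⟩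
    p * ((3 + 2 * i) * length fs + length R)          ≤⟨ gain-arithmetic i {length fs} {length (removeAll fs S)} {length U} {length R} {proj₁ free} {proj₁ blocks} {X} (subst (X ≤_) lenS X≤)
                                                           (subst (length fs * (12 * p) + length (removeAll fs S) ≤_) lenS total)
                                                           (≤-trans (m≤n+m _ (length (removeAll fs H))) (≤-reflexive (trans (sym (length-++ (removeAll fs H))) (sym (↭-length reduce)))))
                                                           (proj₂ (proj₂ free)) (proj₂ (proj₂ blocks)) ⟩
    proj₁ blocks ∎)
    where
    open ≤-Reasoning

    lenS : length S ≡ (3 + 2 * i) * length fs + length R
    lenS = trans (↭-length π) (trans (length-++ H) (cong (_+ length R) lenH))

    U : List G
    U = removeAll fs R

    reduce : removeAll fs S ↭ removeAll fs H ++ U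
    reduce = ↭-trans (removeAll-↭ fs π) (↭-reflexive (removeAll-++ fs H R))

    X : ℕ
    -- The total shortfall of the infrequent terms. The hypothesis |G| ≥ 72p⁶ is what keeps it below
    -- |S|.
    X = p * (3 ^ k * (12 * p))

    X≤ : X ≤ length S
    X≤ = *-cancelˡ-≤ p (begin
      p * (p * (3 ^ k * (12 * p)))                ≤⟨ *-monoʳ-≤ p (*-monoʳ-≤ p (*-monoˡ-≤ (12 * p) small)) ⟩
      p * (p * (6 * (p * p * p) * (12 * p)))      ≡⟨ sixth p ⟩
      72 * p ^ 6                                  ≤⟨ large ⟩
      N                                           ≤⟨ long⇒ {S} long ⟩
      p * length S ∎)
      where
      sixth : ∀ p → p * (p * (6 * (p * p * p) * (12 * p))) ≡ 72 * (p * (p * (p * (p * (p * (p * 1))))))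
      sixth = solve-∀

    free : ∃ λ n → Part U n × suc p * length U ≤ n + X
    free = dissociated-part p k (12 * p) enough U (<-wellFounded _)
      (λ j → regular⇒nonzero {S} reg (∈-resp-↭ (↭-sym π) (∈-++⁺ʳ H (removeAll⊆ fs R j))))
      λ g → ≤-trans (m≤n+m _ (count (is g) (removeAll fs H))) (≤-trans (≤-reflexive (trans (sym (count-++ (is g) (removeAll fs H) U))
        (count-↭ (is g) (↭-sym reduce)))) (≤-trans (n≤1+n _) (few g)))

    blocks : ∃ λ n′ → Part (H ++ R) n′ × proj₁ free + (4 + 2 * i) * length R + (3 + 2 * i) * length fs ≤ n′ + (4 + 2 * i) * length U
    blocks = popular-blocks helped R (λ f → ≤-trans (s≤s (begin
        count (is f) R                            ≤⟨ m≤n+m _ (count (is f) H) ⟩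
        count (is f) H + count (is f) R           ≡⟨ trans (sym (count-++ (is f) H R)) (count-↭ (is f) (↭-sym π)) ⟩
        count (is f) S                            ≤⟨ count-mono (is f) (set (cyc f)) (λ {x} q → un∈ (subst (_∈ set (cyc f)) (is⇒≡ q) (∈cyc f))) S ⟩
        count (set (cyc f)) S ∎)) (regular⇒cyc {S} reg f))
      (proj₁ (proj₂ free))

  additive-basis : ∀ S → Regular S → Long S → ∀ g → g ∈ sums⁺ S
  additive-basis S reg long g with rich S reg long | g ≟ ε
  ... | _ , z | yes refl = z
  ... | (k , k∈ , k≢ε) , _ | no g≢ε = sums⇒sums⁺ S (periodic⇒full S reg long k∈ k≢ε g) g≢ε

-- Residue arithmetic and other preparations for the concrete group.

%-idem-+ˡ : ∀ a b n .{{_ : NonZero n}} → (a % n + b) % n ≡ (a + b) % n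
%-idem-+ˡ a b n = begin
  (a % n + b) % n            ≡⟨ %-distribˡ-+ (a % n) b n ⟩
  (a % n % n + b % n) % n    ≡⟨ cong (λ k → (k + b % n) % n) (m%n%n≡m%n a n) ⟩
  (a % n + b % n) % n        ≡⟨ %-distribˡ-+ a b n ⟨
  (a + b) % n ∎
  where open ≡-Reasoning

%-idem-+ʳ : ∀ a b n .{{_ : NonZero n}} → (a + b % n) % n ≡ (a + b) % n
%-idem-+ʳ a b n = trans (cong (_% n) (+-comm a (b % n))) (trans (%-idem-+ˡ b a n) (cong (_% n) (+-comm b a)))

module Residues (n : ℕ) .{{_ : NonZero n}} where
  toℕ-mod : ∀ m → toℕ (m mod n) ≡ m % n
  toℕ-mod m = FinP.toℕ-fromℕ< (m%n<n m n)

  toℕ-% : ∀ (a : Fin n) → toℕ a % n ≡ toℕ a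
  toℕ-% a = m<n⇒m%n≡m (FinP.toℕ<n a)

  mod-≡ : ∀ {a : Fin n} {m} → m % n ≡ toℕ a → m mod n ≡ a
  mod-≡ {a} {m} e = FinP.toℕ-injective (trans (toℕ-mod m) e)

  add : Fin n → Fin n → Fin n
  add a b = (toℕ a + toℕ b) mod n

  add-assoc : ∀ a b c → add (add a b) c ≡ add a (add b c)
  add-assoc a b c = mod-≡ (begin
    (toℕ (add a b) + toℕ c) % n             ≡⟨ cong (λ k → (k + toℕ c) % n) (toℕ-mod _) ⟩
    ((toℕ a + toℕ b) % n + toℕ c) % n       ≡⟨ %-idem-+ˡ (toℕ a + toℕ b) (toℕ c) n ⟩
    (toℕ a + toℕ b + toℕ c) % n             ≡⟨ cong (_% n) (+-assoc (toℕ a) (toℕ b) (toℕ c)) ⟩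
    (toℕ a + (toℕ b + toℕ c)) % n           ≡⟨ %-idem-+ʳ (toℕ a) (toℕ b + toℕ c) n ⟨
    (toℕ a + (toℕ b + toℕ c) % n) % n       ≡⟨ cong (λ k → (toℕ a + k) % n) (toℕ-mod _) ⟨
    (toℕ a + toℕ (add b c)) % n             ≡⟨ toℕ-mod _ ⟨
    toℕ (add a (add b c)) ∎)
    where open ≡-Reasoning

  add-comm : ∀ a b → add a b ≡ add b a
  add-comm a b = cong (_mod n) (+-comm (toℕ a) (toℕ b))

  add-identityˡ : ∀ a → add (0 mod n) a ≡ a
  add-identityˡ a = mod-≡ (trans (cong (λ k → (k + toℕ a) % n) (toℕ-mod 0)) (trans (%-idem-+ˡ 0 (toℕ a) n) (toℕ-% a)))

  add-inverseˡ : ∀ a → add ((n ∸ toℕ a) mod n) a ≡ 0 mod n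
  add-inverseˡ a = mod-≡ (begin
    (toℕ ((n ∸ toℕ a) mod n) + toℕ a) % n   ≡⟨ cong (λ k → (k + toℕ a) % n) (toℕ-mod _) ⟩
    ((n ∸ toℕ a) % n + toℕ a) % n           ≡⟨ %-idem-+ˡ (n ∸ toℕ a) (toℕ a) n ⟩
    (n ∸ toℕ a + toℕ a) % n                 ≡⟨ cong (_% n) (m∸n+n≡m (<⇒≤ (FinP.toℕ<n a))) ⟩
    n % n                                   ≡⟨ n%n≡0 n ⟩
    0                                       ≡⟨ 0%n≡0 n ⟨
    0 % n                                   ≡⟨ toℕ-mod 0 ⟨
    toℕ (0 mod n) ∎)
    where
    open ≡-Reasoning
    0%n≡0 : ∀ n .{{_ : NonZero n}} → 0 % n ≡ 0
    0%n≡0 n = m<n⇒m%n≡m (>-nonZero⁻¹ n)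

length-cartesianProduct : ∀ {A B : Set} (xs : List A) (ys : List B) → length (cartesianProduct xs ys) ≡ length xs * length ys
length-cartesianProduct [] ys = refl
length-cartesianProduct (x ∷ xs) ys = trans (length-++ (map (x ,_) ys)) (cong₂ _+_ (length-map (x ,_) ys) (length-cartesianProduct xs ys))

length-allFin : ∀ n → length (allFin n) ≡ n
length-allFin n = length-tabulate {n = n} (λ i → i)

prime-divisor : ∀ d → 2 ≤ d → ∃ λ r → Prime r × r ∣ d
prime-divisor d@(suc _) 2≤d with factorise d
... | record { factors = [] ; isFactorisation = refl } = ⊥-elim (<⇒≱ 2≤d ≤-refl)
... | record { factors = r ∷ rs ; isFactorisation = e ; factorsPrime = pr ∷ _ } = r , pr , subst (r ∣_) (sym e) (m∣m*n (product rs))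

-- With p = i + 2, the extremal sequence consists of
-- the nonzero elements of ker φ and p - 2 copies of g; no subset sum lies in the class of -g.
module LowerBound (𝔾 : FiniteAbelianGroup) (i : ℕ) (φ : FiniteAbelianGroup.G 𝔾 → ℕ)
  (φ-homo : ∀ x y → φ (FiniteAbelianGroup._∙_ 𝔾 x y) ≡ (φ x + φ y) % (2 + i))
  (φ-ε : φ (FiniteAbelianGroup.ε 𝔾) ≡ 0) (g : FiniteAbelianGroup.G 𝔾) (φ-g : φ g ≡ 1 % (2 + i)) where

  open Subsets 𝔾 hiding (G)
  open SubsetSums 𝔾
  open FiniteAbelianGroup 𝔾 using () renaming (G to 𝔸)

  p : ℕ
  p = 2 + i

  kernel? : ∀ x → Dec (φ x ≡ 0)
  kernel? x = φ x ℕ.≟ 0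

  nonzero? : ∀ x → Dec (φ x ≡ 0 × x ≢ ε)
  nonzero? x = kernel? x ×-dec ¬? (x ≟ ε)

  kernel nonzero : Subset
  kernel = ⟪ kernel? ⟫
  nonzero = ⟪ nonzero? ⟫

  Hs S : List 𝔸
  Hs = filterᵇ nonzero elements
  S = Hs ++ replicate i g

  -- The length is at least |ker φ| - 1 + (p - 2), one less than the threshold when the kernel has
  -- index p.
  length-S : card kernel + i ≤ suc (length S)
  length-S = begin
    card kernel + i                       ≤⟨ +-monoˡ-≤ i (card-mono {kernel} {nonzero ∪ ⟪ _≟ ε ⟫} cover) ⟩
    card (nonzero ∪ ⟪ _≟ ε ⟫) + i         ≤⟨ +-monoˡ-≤ i (card-∪≤ nonzero ⟪ _≟ ε ⟫) ⟩
    card nonzero + card ⟪ _≟ ε ⟫ + i      ≤⟨ +-monoˡ-≤ i (+-mono-≤ (≤-reflexive (card-def nonzero)) (card-≤-list {⟪ _≟ ε ⟫} (ε ∷ []) λ j → here (∈⟪⟫⁻ (_≟ ε) j))) ⟩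
    length Hs + 1 + i                     ≡⟨ cong (_+ i) (+-comm (length Hs) 1) ⟩
    suc (length Hs + i)                   ≡⟨ cong (λ k → suc (length Hs + k)) (length-replicate i) ⟨
    suc (length Hs + length (replicate i g)) ≡⟨ cong suc (length-++ Hs) ⟨
    suc (length S) ∎
    where
    open ≤-Reasoning
    cover : kernel ⊆ nonzero ∪ ⟪ _≟ ε ⟫
    cover {x} j with x ≟ ε
    ... | yes e = ∈∪ʳ {X = nonzero} (∈⟪⟫⁺ (_≟ ε) e)
    ... | no n = ∈∪ˡ (∈⟪⟫⁺ nonzero? (∈⟪⟫⁻ kernel? j , n))

  φ-multiple : ∀ j → φ (j ⋆ g) ≡ j % p
  φ-multiple zero = φ-ε
  φ-multiple (suc j) = begin
    φ (g ∙ j ⋆ g)           ≡⟨ φ-homo g (j ⋆ g) ⟩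
    (φ g + φ (j ⋆ g)) % p   ≡⟨ cong₂ (λ a b → (a + b) % p) φ-g (φ-multiple j) ⟩
    (1 % p + j % p) % p     ≡⟨ %-distribˡ-+ 1 j p ⟨
    suc j % p ∎
    where open ≡-Reasoning

  φ-small : ∀ {j} → j < p → φ (j ⋆ g) ≡ j
  φ-small {j} lt = trans (φ-multiple j) (m<n⇒m%n≡m lt)

  Hs-sound : ∀ {x} → x ∈ₗ Hs → φ x ≡ 0 × x ≢ ε
  Hs-sound j = ∈⟪⟫⁻ nonzero? (mk∈ (proj₂ (filterᵇ-sound nonzero elements j)))

  -- If `g` lies in `K`, the p - 2 equal copies of `g` are traded for the elements g, 2g, ..., (p -
  -- 2)g of `K`. Their images 1, ..., p - 2 under φ separate them from each other and from the
  -- kernel. Together with 0, which is not a term of `S`, this makes |S_K| + 1 distinct elements of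
  -- `K`.
  regular : ∀ (K : Sub) → suc (count (set K) S) ≤ card (set K)
  regular K with set K g in eq
  ... | false = begin
    suc (count (set K) S)                       ≡⟨ cong suc (trans (count-++ (set K) Hs (replicate i g)) (trans (cong (count (set K) Hs +_) (none i)) (+-identityʳ _))) ⟩
    length (ε ∷ filterᵇ (set K) Hs)             ≤⟨ card-≥-list {set K} unique inside ⟩
    card (set K) ∎
    where
    open ≤-Reasoning
    none : ∀ j → count (set K) (replicate j g) ≡ 0
    none zero = refl
    none (suc j) rewrite eq = none j
    unique : Unique (ε ∷ filterᵇ (set K) Hs)
    unique = All.tabulate (λ j e → proj₂ (Hs-sound (proj₁ (filterᵇ-sound (set K) Hs j))) (sym e)) ∷
      Unique.filter⁺ (T? ∘ set K) (Unique.filter⁺ (T? ∘ nonzero) elements-unique)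
    inside : ∀ {x} → x ∈ₗ ε ∷ filterᵇ (set K) Hs → x ∈ set K
    inside (here refl) = ε∈ K
    inside (there j) = mk∈ (proj₂ (filterᵇ-sound (set K) Hs j))
  ... | true = begin
    suc (count (set K) S)                       ≡⟨ cong suc (count-++ (set K) Hs (replicate i g)) ⟩
    suc (count (set K) Hs + count (set K) (replicate i g)) ≤⟨ s≤s (+-monoʳ-≤ (count (set K) Hs) (≤-trans (m≤m+n _ _) (≤-reflexive (trans (count-not (set K) (replicate i g)) (length-replicate i))))) ⟩
    suc (count (set K) Hs + i)                  ≡⟨ cong (λ k → suc (count (set K) Hs + k)) (length-applyUpTo f i) ⟨
    suc (count (set K) Hs + length M)           ≡⟨ cong suc (length-++ (filterᵇ (set K) Hs)) ⟨
    length (ε ∷ filterᵇ (set K) Hs ++ M)        ≤⟨ card-≥-list {set K} unique inside ⟩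
    card (set K) ∎
    where
    open ≤-Reasoning
    f : ℕ → 𝔸
    f j = suc j ⋆ g
    M : List 𝔸
    M = applyUpTo f i
    φ-f : ∀ {j} → j < i → φ (f j) ≡ suc j
    φ-f lt = φ-small (s≤s (≤-trans lt (n≤1+n i)))
    multiple∈ : ∀ j → j ⋆ g ∈ set K
    multiple∈ zero = ε∈ K
    multiple∈ (suc j) = ∙∈ K (mk∈ eq) (multiple∈ j)
    unique : Unique (ε ∷ filterᵇ (set K) Hs ++ M)
    unique = All.tabulate (λ {x} j → [ (λ k e → proj₂ (Hs-sound (proj₁ (filterᵇ-sound (set K) Hs k))) (sym e)) , positive ]′ (∈-++⁻ (filterᵇ (set K) Hs) j)) ∷
      Unique.++⁺ (Unique.filter⁺ (T? ∘ set K) (Unique.filter⁺ (T? ∘ nonzero) elements-unique))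
        (Unique.applyUpTo⁺₁ f i λ {a} {b} a<b b<i e → <⇒≢ a<b (suc-injective (trans (sym (φ-f (≤-trans a<b (<⇒≤ b<i)))) (trans (cong φ e) (φ-f b<i)))))
        λ (j , k) → disjoint j k
      where
      positive : ∀ {x} → x ∈ₗ M → ε ≢ x
      positive k refl with j , lt , e ← ∈-applyUpTo⁻ f k with () ← trans (sym φ-ε) (trans (cong φ e) (φ-f lt))
      disjoint : ∀ {x} → x ∈ₗ filterᵇ (set K) Hs → x ∈ₗ M → ⊥
      disjoint a b with j , lt , refl ← ∈-applyUpTo⁻ f b with () ← trans (sym (proj₁ (Hs-sound (proj₁ (filterᵇ-sound (set K) Hs a))))) (φ-f lt)
    inside : ∀ {x} → x ∈ₗ ε ∷ filterᵇ (set K) Hs ++ M → x ∈ set K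
    inside (here refl) = ε∈ K
    inside (there j) with ∈-++⁻ (filterᵇ (set K) Hs) j
    ... | inj₁ k = mk∈ (proj₂ (filterᵇ-sound (set K) Hs k))
    ... | inj₂ k with j , _ , refl ← ∈-applyUpTo⁻ f k = multiple∈ (suc j)

  copies-sum : ∀ n {T} → T ⊑ replicate n g → ∃ λ c → c ≤ n × φ (σ T) ≡ c % p
  copies-sum zero ⊑[] = 0 , z≤n , φ-ε
  copies-sum (suc n) (_ ⊑∷ʳ s) = let c , le , e = copies-sum n s in c , m≤n⇒m≤1+n le , e
  copies-sum (suc n) (refl ⊑∷ s) = let c , le , e = copies-sum n s in suc c , s≤s le ,
    trans (φ-homo g _) (trans (cong₂ (λ a b → (a + b) % p) φ-g e) (sym (%-distribˡ-+ 1 c p)))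

  kernel-sum : ∀ Xs {R T} → (∀ {x} → x ∈ₗ Xs → φ x ≡ 0) → T ⊑ Xs ++ R → ∃ λ T′ → T′ ⊑ R × φ (σ T) % p ≡ φ (σ T′) % p
  kernel-sum [] z s = _ , s , refl
  kernel-sum (x ∷ Xs) z (_ ⊑∷ʳ s) = kernel-sum Xs (z ∘ there) s
  kernel-sum (x ∷ Xs) {T = _ ∷ T} z (refl ⊑∷ s) = let T′ , s′ , e = kernel-sum Xs (z ∘ there) s in T′ , s′ ,
    trans (cong (_% p) (trans (φ-homo x _) (cong (λ k → (k + φ (σ T)) % p) (z (here refl))))) (trans (m%n%n≡m%n (φ (σ T)) p) e)

  missed : ∀ {T} → T ⊑ S → σ T ≢ suc i ⋆ g
  missed {T} s e with T′ , s′ , e′ ← kernel-sum Hs (λ j → proj₁ (Hs-sound j)) s with c , c≤i , e″ ← copies-sum i s′ =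
    <⇒≢ (s≤s c≤i) (begin
      c                       ≡⟨ m<n⇒m%n≡m (≤-trans (s≤s c≤i) (n≤1+n _)) ⟨
      c % p                   ≡⟨ m%n%n≡m%n c p ⟨
      c % p % p               ≡⟨ cong (_% p) e″ ⟨
      φ (σ T′) % p            ≡⟨ e′ ⟨
      φ (σ T) % p             ≡⟨ cong (λ x → φ x % p) e ⟩
      φ (suc i ⋆ g) % p       ≡⟨ cong (_% p) (φ-small ≤-refl) ⟩
      suc i % p               ≡⟨ m<n⇒m%n≡m ≤-refl ⟩
      suc i ∎)
    where open ≡-Reasoning

open import Defs

-- The group C_{n₁} ⊕ C_{n₂} and the assembly of both bounds.

module RankTwo (n₁ n₂ : ℕ) .{{nz₁ : NonZero n₁}} .{{nz₂ : NonZero n₂}} where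
  module R₁ = Residues n₁
  module R₂ = Residues n₂

  identityˡ′ : ∀ x → _+G_ n₁ n₂ (0G n₁ n₂) x ≡ x
  identityˡ′ (a , b) = cong₂ _,_ (R₁.add-identityˡ a) (R₂.add-identityˡ b)

  comm′ : ∀ x y → _+G_ n₁ n₂ x y ≡ _+G_ n₁ n₂ y x
  comm′ (a , b) (c , d) = cong₂ _,_ (R₁.add-comm a c) (R₂.add-comm b d)

  inverseˡ′ : ∀ x → _+G_ n₁ n₂ (-G_ n₁ n₂ x) x ≡ 0G n₁ n₂
  inverseˡ′ (a , b) = cong₂ _,_ (R₁.add-inverseˡ a) (R₂.add-inverseˡ b)

  isAbelianGroup′ : IsAbelianGroup _≡_ (_+G_ n₁ n₂) (0G n₁ n₂) (-G_ n₁ n₂)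
  isAbelianGroup′ = record
    { isGroup = record
      { isMonoid = record
        { isSemigroup = record
          { isMagma = record { isEquivalence = isEquivalence ; ∙-cong = cong₂ (_+G_ n₁ n₂) }
          ; assoc = λ { (a , b) (c , d) (e , f) → cong₂ _,_ (R₁.add-assoc a c e) (R₂.add-assoc b d f) }
          }
        ; identity = identityˡ′ , λ x → trans (comm′ x _) (identityˡ′ x)
        }
      ; inverse = inverseˡ′ , λ x → trans (comm′ x _) (inverseˡ′ x)
      ; ⁻¹-cong = cong (-G_ n₁ n₂)
      }
    ; comm = comm′
    }

  𝔾 : FiniteAbelianGroup
  𝔾 = record
    { G = G n₁ n₂
    ; _∙_ = _+G_ n₁ n₂
    ; ε = 0G n₁ n₂
    ; _⁻¹ = -G_ n₁ n₂
    ; isAbelianGroup = isAbelianGroup′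
    ; elements = elements n₁ n₂
    ; elements-unique = Unique.cartesianProduct⁺ (Unique.allFin⁺ n₁) (Unique.allFin⁺ n₂)
    ; elements-complete = λ { (a , b) → ∈-cartesianProduct⁺ (∈-allFin a) (∈-allFin b) }
    ; _≟_ = ≡-dec FinP._≟_ FinP._≟_
    }

  order≡ : order n₁ n₂ ≡ n₁ * n₂
  order≡ = trans (length-cartesianProduct (allFin n₁) (allFin n₂)) (cong₂ _*_ (length-allFin n₁) (length-allFin n₂))

  module S = Subsets 𝔾
  open S using (_⋆_; Sub; set; mk∈; un∈; card; card-def)

  multiple-coordinates : ∀ j x → toℕ (proj₁ (j ⋆ x)) ≡ (j * toℕ (proj₁ x)) % n₁ × toℕ (proj₂ (j ⋆ x)) ≡ (j * toℕ (proj₂ x)) % n₂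
  multiple-coordinates zero x = R₁.toℕ-mod 0 , R₂.toℕ-mod 0
  multiple-coordinates (suc j) x@(a , b) = let e , f = multiple-coordinates j x in
    trans (R₁.toℕ-mod _) (trans (cong (λ k → (toℕ a + k) % n₁) e) (%-idem-+ʳ (toℕ a) (j * toℕ a) n₁)) ,
    trans (R₂.toℕ-mod _) (trans (cong (λ k → (toℕ b + k) % n₂) f) (%-idem-+ʳ (toℕ b) (j * toℕ b) n₂))

  exponent : n₁ ∣ n₂ → ∀ x → n₂ ⋆ x ≡ 0G n₁ n₂
  exponent d x@(a , b) = let e , f = multiple-coordinates n₂ x in cong₂ _,_
    (FinP.toℕ-injective (trans e (trans (n∣m⇒m%n≡0 (n₂ * toℕ a) n₁ (∣m⇒∣m*n (toℕ a) d)) (sym (trans (R₁.toℕ-mod 0) (m<n⇒m%n≡m (>-nonZero⁻¹ n₁)))))))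
    (FinP.toℕ-injective (trans f (trans (n∣m⇒m%n≡0 (n₂ * toℕ b) n₂ (m∣m*n (toℕ b))) (sym (trans (R₂.toℕ-mod 0) (m<n⇒m%n≡m (>-nonZero⁻¹ n₂)))))))

  toSubgroup : Sub → Subgroup n₁ n₂
  toSubgroup H = record
    { mem = set H
    ; mem-0 = un∈ (S.ε∈ H)
    ; mem-+ = λ x y i j → un∈ (S.∙∈ H {x} {y} (mk∈ i) (mk∈ j))
    ; mem-neg = λ x i → un∈ (S.⁻¹∈ H {x} (mk∈ i))
    }

  fromSubgroup : Subgroup n₁ n₂ → Sub
  fromSubgroup H = record
    { set = Subgroup.mem H
    ; ε∈ = mk∈ (Subgroup.mem-0 H)
    ; ∙∈ = λ i j → mk∈ (Subgroup.mem-+ H _ _ (un∈ i) (un∈ j))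
    ; ⁻¹∈ = λ i → mk∈ (Subgroup.mem-neg H _ (un∈ i))
    }

  regular⇒ : ∀ {S} → Regular n₁ n₂ S → ∀ (H : Sub) {g} → g S.∉ set H → suc (count (set H) S) ≤ card (set H)
  regular⇒ {S} reg H {g} g∉ = ≤-trans (reg (toSubgroup H) (g , outside-false)) (≤-reflexive (sym (card-def (set H))))
    where
    outside-false : set H g ≡ false
    outside-false with set H g in eq
    ... | true = ⊥-elim (g∉ (mk∈ eq))
    ... | false = refl

  module _ (n₁∣n₂ : n₁ ∣ n₂) (p : ℕ) (pp : Prime p) (p∣ : p ∣ order n₁ n₂)
    (least : (q : ℕ) → Prime q → q ∣ order n₁ n₂ → p ≤ q)
    (3≤p : 3 ≤ p) (2p≤n₁ : 2 * p ≤ n₁) (large : 72 * p ^ 6 ≤ order n₁ n₂) where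

    private
      instance
        p≢0 : NonZero p
        p≢0 = prime⇒nonZero pp

    least-divisor : ∀ d q → d * q ≡ order n₁ n₂ → 2 ≤ d → p ≤ d
    least-divisor d q e 2≤d = let r , pr , r∣d = prime-divisor d 2≤d in
      ≤-trans (least r pr (subst (r ∣_) e (∣m⇒∣m*n q r∣d))) (∣⇒≤ {{>-nonZero (≤-trans (s≤s z≤n) 2≤d)}} r∣d)

    module U = UpperBound 𝔾 p n₂ 3≤p least-divisor (>-nonZero⁻¹ n₂) (exponent n₁∣n₂)
      (≤-trans (*-monoˡ-≤ n₂ 2p≤n₁) (≤-reflexive (sym order≡))) large

    threshold : ℕ
    threshold = order n₁ n₂ / p + p ∸ 2

    long : ∀ {S} → threshold ≤ length S → U.Long S
    long {S} le = begin
      order n₁ n₂ + p * p                     ≡⟨ cong (_+ p * p) (m/n*n≡m p∣) ⟨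
      order n₁ n₂ / p * p + p * p             ≡⟨ *-distribʳ-+ p (order n₁ n₂ / p) p ⟨
      (order n₁ n₂ / p + p) * p               ≤⟨ *-monoˡ-≤ p (≤-trans (m≤n+m∸n (order n₁ n₂ / p + p) 2) (+-monoʳ-≤ 2 le)) ⟩
      (2 + length S) * p                      ≡⟨ arith p (length S) ⟩
      p * length S + 2 * p ∎
      where
      open ≤-Reasoning
      arith : ∀ p s → (2 + s) * p ≡ p * s + 2 * p
      arith = solve-∀

    upper : C0Property n₁ n₂ threshold
    upper S reg le g = sums⁺-sound S (U.additive-basis S (regular⇒ {S} reg) (long {S} le) g)
      where open SubsetSums 𝔾 using (sums⁺-sound)

    p∣n₂ : p ∣ n₂
    p∣n₂ = [ (λ d → ∣-trans d n₁∣n₂) , (λ d → d) ]′ (euclidsLemma n₁ n₂ pp (subst (p ∣_) order≡ p∣))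

    -- Reduction of the second coordinate is a homomorphism because p divides n₂, and its kernel is
    -- the subgroup of index p in the extremal sequence.
    φ : G n₁ n₂ → ℕ
    φ (a , b) = toℕ b % p

    reduce : ∀ m → toℕ (m mod n₂) % p ≡ m % p
    reduce m = trans (cong (_% p) (R₂.toℕ-mod m)) (m∣n⇒o%n%m≡o%m p n₂ m p∣n₂)

    module _ (i : ℕ) (p≡ : p ≡ 2 + i) where

      g : G n₁ n₂
      g = (0 mod n₁ , 1 mod n₂)

      to-i : ∀ m → m % p ≡ m % (2 + i)
      to-i m = %-cong p≡
        where
        %-cong : ∀ {q} .{{_ : NonZero q}} → p ≡ q → m % p ≡ m % q
        %-cong refl = refl

      φ-homo : ∀ x y → φ (_+G_ n₁ n₂ x y) ≡ (φ x + φ y) % (2 + i)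
      φ-homo (a , b) (c , d) = trans (reduce (toℕ b + toℕ d)) (trans (%-distribˡ-+ (toℕ b) (toℕ d) p) (to-i _))

      φ-ε : φ (0G n₁ n₂) ≡ 0
      φ-ε = trans (reduce 0) (m<n⇒m%n≡m (>-nonZero⁻¹ p))

      φ-g : φ g ≡ 1 % (2 + i)
      φ-g = trans (reduce 1) (to-i 1)

      module L = LowerBound 𝔾 i φ φ-homo φ-ε g φ-g

      -- The pairs (a, kp) with k < n₂/p already provide |G|/p elements of the kernel.
      kernel-large : order n₁ n₂ / p ≤ card L.kernel
      kernel-large with divides m eq ← p∣n₂ = ≤-trans (≤-reflexive (begin
          order n₁ n₂ / p                      ≡⟨ cong (_/ p) (trans order≡ (trans (cong (n₁ *_) eq) (sym (*-assoc n₁ m p)))) ⟩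
          n₁ * m * p / p                       ≡⟨ m*n/n≡m (n₁ * m) p ⟩
          n₁ * m                               ≡⟨ cong₂ _*_ (length-allFin n₁) (trans (length-map f (allFin m)) (length-allFin m)) ⟨
          length (allFin n₁) * length Ms       ≡⟨ length-cartesianProduct (allFin n₁) Ms ⟨
          length (cartesianProduct (allFin n₁) Ms) ∎))
        (S.card-≥-list {L.kernel} (Unique.cartesianProduct⁺ (Unique.allFin⁺ n₁) (Unique.map⁺ f-injective (Unique.allFin⁺ m))) inside)
        where
        open ≡-Reasoning
        f : Fin m → Fin n₂
        f k = (toℕ k * p) mod n₂
        Ms : List (Fin n₂)
        Ms = map f (allFin m)
        toℕ-f : ∀ k → toℕ (f k) ≡ toℕ k * p
        toℕ-f k = trans (R₂.toℕ-mod _) (m<n⇒m%n≡m (subst (toℕ k * p <_) (sym eq) (*-monoˡ-< p (FinP.toℕ<n k))))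
        f-injective : ∀ {k l} → f k ≡ f l → k ≡ l
        f-injective {k} {l} e = FinP.toℕ-injective (*-cancelʳ-≡ (toℕ k) (toℕ l) p (trans (sym (toℕ-f k)) (trans (cong toℕ e) (toℕ-f l))))
        inside : ∀ {x} → x ∈ₗ cartesianProduct (allFin n₁) Ms → x S.∈ L.kernel
        inside {a , b} j with k , _ , refl ← ∈-map⁻ f (proj₂ (∈-cartesianProduct⁻ (allFin n₁) Ms j)) =
          S.∈⟪⟫⁺ L.kernel? (trans (cong (_% p) (toℕ-f k)) (m*n%n≡0 (toℕ k) p))

      lower : ∀ t → C0Property n₁ n₂ t → threshold ≤ t
      lower t c₀ = ≮⇒≥ λ t< → let T , s , _ , e = c₀ L.S regular (short t<) (suc i ⋆ g) in L.missed s e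
        where
        regular : Regular n₁ n₂ L.S
        regular H _ = ≤-trans (L.regular (fromSubgroup H)) (≤-reflexive (card-def (Subgroup.mem H)))
        short : t < threshold → t ≤ length L.S
        short t< = s≤s⁻¹ (≤-trans t< (≤-trans (≤-reflexive (trans (cong (λ k → order n₁ n₂ / p + k ∸ 2) p≡)
          (trans (cong (_∸ 2) (regroup (order n₁ n₂ / p) i)) (m+n∸m≡n 2 _)))) (≤-trans (+-monoˡ-≤ i kernel-large) L.length-S)))
          where
          regroup : ∀ a i → a + (2 + i) ≡ 2 + (a + i)
          regroup = solve-∀

theorem1p1 : (n₁ n₂ : ℕ) .{{nz₁ : NonZero n₁}} .{{nz₂ : NonZero n₂}} → n₁ ∣ n₂ →
    (p : ℕ) → (pp : Prime p) → p ∣ order n₁ n₂ →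
    ((q : ℕ) → Prime q → q ∣ order n₁ n₂ → p ≤ q) →
    3 ≤ p → 2 * p ≤ n₁ → 72 * p ^ 6 ≤ order n₁ n₂ →
    IsC0 n₁ n₂ (_/_ (order n₁ n₂) p {{prime⇒nonZero pp}} + p ∸ 2)
theorem1p1 n₁ n₂ d p pp p∣ least 3≤p 2p≤n₁ large =
  upper d p pp p∣ least 3≤p 2p≤n₁ large ,
  lower d p pp p∣ least 3≤p 2p≤n₁ large (p ∸ 2) (sym (m+[n∸m]≡n (≤-trans (n≤1+n 2) 3≤p)))
  where open RankTwo n₁ n₂
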